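{- Let $d,s,t$ be positive integers and let $v,w\in\mathbb{R}^d$. Let $A^v$ and $A^w$ be the two $(2t-1)\times s$ matrices representing CountSketches of $v$ and $w$ built with the same random hash functions, where the sign functions $g_i$ are 4-wise independent. Let $X$ denote the median of $\langle A^v_i, A^w_i\rangle$ over the rows $i=1,\dots,2t-1$. If $t=2$, then $$\mathbb{E}[(X-\langle v,w\rangle)^2] \le \min\left\{\frac{3\|v\|_1^2\|w\|_1^2}{s^2},\ \frac{2\|v\|_2^2\|w\|_2^2}{s}\right\},$$ and for every $t>1$, $$\mathbb{E}[|X-\langle v,w\rangle|^t] \le 2^{2t-1}\,\frac{\|v\|_1^t\|w\|_1^t}{s^t}\qquad\text{and}\qquad \mathbb{E}[(X-\langle v,w\rangle)^{2t}] \le 4^{2t-1}\,\frac{\|v\|_2^{2t}\|w\|_2^{2t}}{s^t}.$$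
   Context: Write $[m]=\{1,\dots,m\}$. A $k$-wise independent hash function is a random function whose values are independent and uniformly distributed when restricted to any set of at most $k$ keys. CountSketch with $2t-1$ rows and $s$ columns: for each row $i\in[2t-1]$ choose a 2-wise independent hash function $h_i:[d]\to[s]$ and a hash function $g_i:[d]\to\{ -1,1\}$ (here 4-wise independent), with $h_i$ independent of $g_i$, and the pairs $(h_i,g_i)$, $i\in[2t-1]$, independent and identically distributed. For a fixed vector $u\in\mathbb{R}^d$ the sketch is the $(2t-1)\times s$ matrix $A^u$ with entries $A^u_{i,k}=\sum_{l\in[d]:\,h_i(l)=k} g_i(l)u_l$. $A^u_i$ denotes the $i$th row of $A^u$, and $\langle A^v_i,A^w_i\rangle=\sum_{k=1}^s A^v_{i,k}A^w_{i,k}$. Expectations are over the random hash functions. $\|u\|_1=\sum_l|u_l|$ and $\|u\|_2=(\sum_l u_l^2)^{1/2}$. -}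

module Defs where

open import Algebra.Bundles.Raw using (RawSemiring)
import Algebra.Definitions.RawSemiring as RawSemiringDefinitions
open import Data.Bool.Base using (Bool; true; false; _∧_; if_then_else_)
open import Data.Fin.Base using (Fin; fromℕ<)
import Data.Fin.Properties as Fin
import Data.Integer.Base as ℤ
import Data.Integer.Properties as ℤ
open import Data.Nat.Base as ℕ using (ℕ; zero; suc; NonZero)
open import Data.Nat.Coprimality as Coprime using (1-coprimeTo)
import Data.Nat.Properties as ℕ
open import Data.Product.Base using (_×_; _,_; proj₁; proj₂; ∃)
open import Data.Rational.Base as ℚ using (ℚ; mkℚ; 0ℚ; 1ℚ; ½)
import Data.Rational.Properties as ℚ
open import Data.Rational.Solver using (module +-*-Solver)
import Data.Rational.Unnormalised.Base as ℚᵘ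
import Data.Rational.Unnormalised.Properties as ℚᵘ
open import Data.Sign.Base using (Sign)
import Data.Sign.Properties as Sign
open import Data.Sum.Base using (inj₁; inj₂)
open import Data.Vec.Base as Vec using (Vec; []; _∷_)
import Data.Vec.Functional as Vector
open Vector using (Vector)
open import Function.Base using (_∘_)
open import Function.Definitions using (Injective)
open import Level using (0ℓ)
open import Relation.Binary.Definitions using (DecidableEquality)
open import Relation.Binary.PropositionalEquality.Core
  using (_≡_; refl; sym; trans; cong; cong₂; subst)
open import Relation.Nullary.Decidable.Core using (yes; no; ⌊_⌋)
open import Relation.Nullary.Negation.Core using (contradiction)

module Rational where
  open import Data.Rational.Base
    using (↥_; _+_; _*_; -_; _-_; ∣_∣; _≤_; _<_; _⊔_; _⊓_; 1/_)
  open import Data.Rational.Properties using (_≤?_)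
  open ℚ.≤-Reasoning

  p≤∣p∣ : ∀ p → p ≤ ∣ p ∣
  p≤∣p∣ p with ℚ.≤-total 0ℚ p
  ... | inj₁ 0≤p = ℚ.≤-reflexive (sym (ℚ.0≤p⇒∣p∣≡p 0≤p))
  ... | inj₂ p≤0 = ℚ.≤-trans p≤0 (ℚ.0≤∣p∣ p)

  ∣p-q∣≡∣q-p∣ : ∀ p q → ∣ p - q ∣ ≡ ∣ q - p ∣
  ∣p-q∣≡∣q-p∣ p q = trans (sym (ℚ.∣-p∣≡∣p∣ (p - q))) (cong ∣_∣ lemma)
    where
    lemma : - (p - q) ≡ q - p
    lemma = solve 2 (λ p q → :- (p :- q) := q :- p) refl p q
      where open +-*-Solver

  ∣p-q∣≤ε⇒p≤q+ε : ∀ p q {ε} → ∣ p - q ∣ ≤ ε → p ≤ q + ε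
  ∣p-q∣≤ε⇒p≤q+ε p q {ε} h = begin
    p              ≡⟨ solve 2 (λ p q → p := q :+ (p :- q)) refl p q ⟩
    q + (p - q)    ≤⟨ ℚ.+-monoʳ-≤ q (ℚ.≤-trans (p≤∣p∣ (p - q)) h) ⟩
    q + ε          ∎
    where open +-*-Solver

  ∣p-q∣≤ε⇒q≤p+ε : ∀ p q {ε} → ∣ p - q ∣ ≤ ε → q ≤ p + ε
  ∣p-q∣≤ε⇒q≤p+ε p q {ε} h =
    ∣p-q∣≤ε⇒p≤q+ε q p (subst (_≤ ε) (∣p-q∣≡∣q-p∣ p q) h)

  private
    p≤q+ε⇒p-q≤ε : ∀ p q {ε} → p ≤ q + ε → p - q ≤ ε
    p≤q+ε⇒p-q≤ε p q {ε} h = begin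
      p - q        ≤⟨ ℚ.+-monoˡ-≤ (- q) h ⟩
      (q + ε) - q  ≡⟨ solve 2 (λ q e → (q :+ e) :- q := e) refl q ε ⟩
      ε            ∎
      where open +-*-Solver

  within : ∀ p q {ε} → p ≤ q + ε → q ≤ p + ε → ∣ p - q ∣ ≤ ε
  within p q {ε} h₁ h₂ with ℚ.∣p∣≡p∨∣p∣≡-p (p - q)
  ... | inj₁ eq = ℚ.≤-trans (ℚ.≤-reflexive eq) (p≤q+ε⇒p-q≤ε p q h₁)
  ... | inj₂ eq = begin
    ∣ p - q ∣   ≡⟨ eq ⟩
    - (p - q)   ≡⟨ solve 2 (λ p q → :- (p :- q) := q :- p) refl p q ⟩
    q - p       ≤⟨ p≤q+ε⇒p-q≤ε q p h₂ ⟩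
    ε           ∎
    where open +-*-Solver

  halves : ∀ ε → ε * ½ + ε * ½ ≡ ε
  halves ε = trans (sym (ℚ.*-distribˡ-+ ε ½ ½)) (ℚ.*-identityʳ ε)

  half>0 : ∀ {ε} → 0ℚ < ε → 0ℚ < ε * ½
  half>0 {ε} 0<ε = ℚ.positive⁻¹ (ε * ½) {{ℚ.pos*pos⇒pos ε {{ℚ.positive 0<ε}} ½}}

  *-pos : ∀ {p q} → 0ℚ < p → 0ℚ < q → 0ℚ < p * q
  *-pos {p} {q} 0<p 0<q =
    ℚ.positive⁻¹ (p * q) {{ℚ.pos*pos⇒pos p {{ℚ.positive 0<p}} q {{ℚ.positive 0<q}}}}

  *-mono-≤ : ∀ p q r s → 0ℚ ≤ r → 0ℚ ≤ q → p ≤ q → r ≤ s → p * r ≤ q * s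
  *-mono-≤ p q r s 0≤r 0≤q p≤q r≤s = ℚ.≤-trans
    (ℚ.*-monoʳ-≤-nonNeg r {{ℚ.nonNegative 0≤r}} p≤q)
    (ℚ.*-monoˡ-≤-nonNeg q {{ℚ.nonNegative 0≤q}} r≤s)

  +-close : ∀ p p′ q q′ {δ δ′} → ∣ p - q ∣ ≤ δ → ∣ p′ - q′ ∣ ≤ δ′ →
            ∣ (p + p′) - (q + q′) ∣ ≤ δ + δ′
  +-close p p′ q q′ {δ} {δ′} h h′ = begin
    ∣ (p + p′) - (q + q′) ∣    ≡⟨ cong ∣_∣ (solve 4 (λ p p′ q q′ →
                                    (p :+ p′) :- (q :+ q′) := (p :- q) :+ (p′ :- q′)) refl p p′ q q′) ⟩
    ∣ (p - q) + (p′ - q′) ∣    ≤⟨ ℚ.∣p+q∣≤∣p∣+∣q∣ (p - q) (p′ - q′) ⟩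
    ∣ p - q ∣ + ∣ p′ - q′ ∣    ≤⟨ ℚ.+-mono-≤ h h′ ⟩
    δ + δ′                     ∎
    where open +-*-Solver

  neg-close : ∀ p q {ε} → ∣ p - q ∣ ≤ ε → ∣ (- p) - (- q) ∣ ≤ ε
  neg-close p q {ε} h = begin
    ∣ (- p) - (- q) ∣   ≡⟨ cong ∣_∣ (solve 2 (λ p q → (:- p) :- (:- q) := q :- p) refl p q) ⟩
    ∣ q - p ∣           ≡⟨ ∣p-q∣≡∣q-p∣ q p ⟩
    ∣ p - q ∣           ≤⟨ h ⟩
    ε                   ∎
    where open +-*-Solver

  abs-close : ∀ p q {ε} → ∣ p - q ∣ ≤ ε → ∣ ∣ p ∣ - ∣ q ∣ ∣ ≤ ε
  abs-close p q {ε} h = within (∣ p ∣) (∣ q ∣) (half p q h) (half q p (subst (_≤ ε) (∣p-q∣≡∣q-p∣ p q) h))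
    where
    half : ∀ a b → ∣ a - b ∣ ≤ ε → ∣ a ∣ ≤ ∣ b ∣ + ε
    half a b h = begin
      ∣ a ∣               ≡⟨ cong ∣_∣ (solve 2 (λ a b → a := b :+ (a :- b)) refl a b) ⟩
      ∣ b + (a - b) ∣     ≤⟨ ℚ.∣p+q∣≤∣p∣+∣q∣ b (a - b) ⟩
      ∣ b ∣ + ∣ a - b ∣   ≤⟨ ℚ.+-monoʳ-≤ (∣ b ∣) h ⟩
      ∣ b ∣ + ε           ∎
      where open +-*-Solver

  ⊔-close : ∀ p p′ q q′ {ε} → ∣ p - q ∣ ≤ ε → ∣ p′ - q′ ∣ ≤ ε →
            ∣ (p ⊔ p′) - (q ⊔ q′) ∣ ≤ ε
  ⊔-close p p′ q q′ {ε} h h′ = within (p ⊔ p′) (q ⊔ q′)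
    (half p p′ q q′ (∣p-q∣≤ε⇒p≤q+ε p q h) (∣p-q∣≤ε⇒p≤q+ε p′ q′ h′))
    (half q q′ p p′ (∣p-q∣≤ε⇒q≤p+ε p q h) (∣p-q∣≤ε⇒q≤p+ε p′ q′ h′))
    where
    half : ∀ a b c d → a ≤ c + ε → b ≤ d + ε → a ⊔ b ≤ (c ⊔ d) + ε
    half a b c d u v = begin
      a ⊔ b               ≤⟨ ℚ.⊔-mono-≤ u v ⟩
      (c + ε) ⊔ (d + ε)   ≡⟨ ℚ.mono-≤-distrib-⊔ (ℚ.+-monoˡ-≤ ε) c d ⟨
      (c ⊔ d) + ε         ∎

  ⊓-close : ∀ p p′ q q′ {ε} → ∣ p - q ∣ ≤ ε → ∣ p′ - q′ ∣ ≤ ε →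
            ∣ (p ⊓ p′) - (q ⊓ q′) ∣ ≤ ε
  ⊓-close p p′ q q′ {ε} h h′ = within (p ⊓ p′) (q ⊓ q′)
    (half p p′ q q′ (∣p-q∣≤ε⇒p≤q+ε p q h) (∣p-q∣≤ε⇒p≤q+ε p′ q′ h′))
    (half q q′ p p′ (∣p-q∣≤ε⇒q≤p+ε p q h) (∣p-q∣≤ε⇒q≤p+ε p′ q′ h′))
    where
    half : ∀ a b c d → a ≤ c + ε → b ≤ d + ε → a ⊓ b ≤ (c ⊓ d) + ε
    half a b c d u v = begin
      a ⊓ b               ≤⟨ ℚ.⊓-mono-≤ u v ⟩
      (c + ε) ⊓ (d + ε)   ≡⟨ ℚ.mono-≤-distrib-⊓ (ℚ.+-monoˡ-≤ ε) c d ⟨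
      (c ⊓ d) + ε         ∎

  *-close : ∀ p p′ q q′ {B B′ δ δ′} → ∣ p ∣ ≤ B → ∣ q′ ∣ ≤ B′ →
            ∣ p - q ∣ ≤ δ → ∣ p′ - q′ ∣ ≤ δ′ →
            ∣ p * p′ - q * q′ ∣ ≤ B * δ′ + B′ * δ
  *-close p p′ q q′ {B} {B′} {δ} {δ′} p≤B q′≤B′ h h′ = begin
    ∣ p * p′ - q * q′ ∣                       ≡⟨ cong ∣_∣ (solve 4 (λ p p′ q q′ →
                                                   p :* p′ :- q :* q′ := p :* (p′ :- q′) :+ q′ :* (p :- q))
                                                   refl p p′ q q′) ⟩
    ∣ p * (p′ - q′) + q′ * (p - q) ∣          ≤⟨ ℚ.∣p+q∣≤∣p∣+∣q∣ (p * (p′ - q′)) (q′ * (p - q)) ⟩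
    ∣ p * (p′ - q′) ∣ + ∣ q′ * (p - q) ∣      ≡⟨ cong₂ _+_ (ℚ.∣p*q∣≡∣p∣*∣q∣ p (p′ - q′))
                                                           (ℚ.∣p*q∣≡∣p∣*∣q∣ q′ (p - q)) ⟩
    ∣ p ∣ * ∣ p′ - q′ ∣ + ∣ q′ ∣ * ∣ p - q ∣  ≤⟨ ℚ.+-mono-≤
                                                   (*-mono-≤ (∣ p ∣) B (∣ p′ - q′ ∣) δ′ (ℚ.0≤∣p∣ (p′ - q′)) (ℚ.≤-trans (ℚ.0≤∣p∣ p) p≤B) p≤B h′)
                                                   (*-mono-≤ (∣ q′ ∣) B′ (∣ p - q ∣) δ (ℚ.0≤∣p∣ (p - q)) (ℚ.≤-trans (ℚ.0≤∣p∣ q′) q′≤B′) q′≤B′ h) ⟩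
    B * δ′ + B′ * δ                           ∎
    where open +-*-Solver

  *-cancel-1/ : ∀ B .{{_ : ℚ.NonZero B}} ε → B * (ε * 1/ B) ≡ ε
  *-cancel-1/ B ε = begin-equality
    B * (ε * 1/ B)   ≡⟨ solve 3 (λ b e i → b :* (e :* i) := e :* (b :* i)) refl B ε (1/ B) ⟩
    ε * (B * 1/ B)   ≡⟨ cong (ε *_) (ℚ.*-inverseʳ B) ⟩
    ε * 1ℚ           ≡⟨ ℚ.*-identityʳ ε ⟩
    ε                ∎
    where open +-*-Solver

  -- 1 / (n + 1)
  step : ℕ → ℚ
  step n = mkℚ (ℤ.+ 1) n (1-coprimeTo (suc n))

  0<step : ∀ n → 0ℚ < step n
  0<step n = ℚ.positive⁻¹ (step n)

  step≤ : ∀ {ε} → 0ℚ < ε → ∃ λ N → ∀ n → N ℕ.≤ n → step n ≤ ε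
  step≤ {ε@(mkℚ (ℤ.+ zero) d c)} 0<ε = contradiction (ℚ.positive 0<ε) λ ()
  step≤ {ε@(mkℚ (ℤ.-[1+ p ]) d c)} 0<ε = contradiction (ℚ.positive 0<ε) λ ()
  step≤ {ε@(mkℚ (ℤ.+ suc p) d c)} 0<ε = d , λ n d≤n → ℚ.*≤*
    (ℤ.+≤+ (ℕ.≤-trans (ℕ.≤-reflexive (ℕ.+-identityʳ (suc d)))
      (ℕ.≤-trans (ℕ.s≤s d≤n) (ℕ.m≤m+n (suc n) (p ℕ.* suc n)))))

  grid : ℕ → ℕ → ℚ
  grid n j = ℤ.+ j ℚ./ suc n

  grid-suc : ∀ n j → grid n (suc j) ≡ grid n j + step n
  grid-suc n j = ℚ.toℚᵘ-injective (begin-equalityᵘ)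
    where
    open import Data.Integer.Solver renaming (module +-*-Solver to ℤSolver)
    begin-equalityᵘ : ℚ.toℚᵘ (grid n (suc j)) ℚᵘ.≃ ℚ.toℚᵘ (grid n j + step n)
    begin-equalityᵘ = ℚᵘ.≃-trans (ℚ.toℚᵘ-fromℚᵘ (ℚᵘ.mkℚᵘ (ℤ.+ suc j) n))
      (ℚᵘ.≃-trans
        (ℚᵘ.*≡* (ℤSolver.solve 2 (λ j n → (ℤSolver.con (ℤ.+ 1) ℤSolver.:+ j) ℤSolver.:* (n ℤSolver.:* n)
            ℤSolver.:= (j ℤSolver.:* n ℤSolver.:+ ℤSolver.con (ℤ.+ 1) ℤSolver.:* n) ℤSolver.:* n) refl (ℤ.+ j) (ℤ.+ suc n)))
        (ℚᵘ.≃-sym (ℚᵘ.≃-trans (ℚ.toℚᵘ-homo-+ (grid n j) (step n))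
          (ℚᵘ.+-congˡ (ℚ.toℚᵘ (step n)) (ℚ.toℚᵘ-fromℚᵘ (ℚᵘ.mkℚᵘ (ℤ.+ j) n))))))

  0≤grid : ∀ n j → 0ℚ ≤ grid n j
  0≤grid n j = ℚ.nonNegative⁻¹ (grid n j) {{ℚ.normalize-nonNeg j (suc n)}}

  -- The largest j / (n + 1) with j ≤ k whose square is at most q.
  search : ℕ → ℚ → ℕ → ℚ
  search n q zero    = grid n 0
  search n q (suc j) with grid n (suc j) * grid n (suc j) ≤? q
  ... | yes _ = grid n (suc j)
  ... | no  _ = search n q j

  -- An approximation from below, to within 1 / (n + 1), of the square
  -- root of a nonnegative rational.
  root : ℕ → ℚ → ℚ
  root n q = search n q (suc n ℕ.* suc ℤ.∣ ↥ q ∣)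

  0≤search : ∀ n q k → 0ℚ ≤ search n q k
  0≤search n q zero = 0≤grid n 0
  0≤search n q (suc j) with grid n (suc j) * grid n (suc j) ≤? q
  ... | yes _ = 0≤grid n (suc j)
  ... | no  _ = 0≤search n q j

  search-lower : ∀ n {q} k → 0ℚ ≤ q → search n q k * search n q k ≤ q
  search-lower n {q} zero 0≤q = subst (λ r → r * r ≤ q) (sym (ℚ.0/n≡0 (suc n))) 0≤q
  search-lower n {q} (suc j) 0≤q with grid n (suc j) * grid n (suc j) ≤? q
  ... | yes p = p
  ... | no  _ = search-lower n j 0≤q

  search-upper : ∀ n {q} k → q < grid n (suc k) * grid n (suc k) →
                 q < (search n q k + step n) * (search n q k + step n)
  search-upper n {q} zero h = subst (λ r → q < r * r) (grid-suc n 0) h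
  search-upper n {q} (suc j) h with grid n (suc j) * grid n (suc j) ≤? q
  ... | yes _ = subst (λ r → q < r * r) (grid-suc n (suc j)) h
  ... | no ¬p = search-upper n j (ℚ.≰⇒> ¬p)

  private
    integer : ℕ → ℚ
    integer a = mkℚ (ℤ.+ a) 0 (Coprime.sym (1-coprimeTo a))

    q<integer : ∀ q → q < integer (suc ℤ.∣ ↥ q ∣)
    q<integer (mkℚ (ℤ.+ a) d _) = ℚ.*<* (subst (ℤ._< ℤ.+ (suc a ℕ.* suc d))
      (sym (ℤ.*-identityʳ (ℤ.+ a))) (ℤ.+<+ (ℕ.m≤m*n (suc a) (suc d))))
    q<integer (mkℚ ℤ.-[1+ a ] d _) = ℚ.*<* ℤ.-<+

    1≤integer : ∀ a → 1ℚ ≤ integer (suc a)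
    1≤integer a = ℚ.*≤* (ℤ.+≤+ (ℕ.s≤s ℕ.z≤n))

    integer≤grid : ∀ n a → integer (suc a) ≤ grid n (suc (suc n ℕ.* suc a))
    integer≤grid n a = ℚ.toℚᵘ-cancel-≤ (ℚᵘ.≤-respʳ-≃
      (ℚᵘ.≃-sym (ℚ.toℚᵘ-fromℚᵘ (ℚᵘ.mkℚᵘ (ℤ.+ suc (suc n ℕ.* suc a)) n)))
      (ℚᵘ.*≤* (ℤ.+≤+ (ℕ.≤-trans (ℕ.≤-reflexive (ℕ.*-comm (suc a) (suc n)))
        (ℕ.≤-trans (ℕ.n≤1+n _) (ℕ.≤-reflexive (sym (ℕ.*-identityʳ _))))))))

  q<grid² : ∀ n q → let J = suc (suc n ℕ.* suc ℤ.∣ ↥ q ∣) in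
            q < grid n J * grid n J
  q<grid² n q = begin-strict
    q        <⟨ q<integer q ⟩
    a        ≡⟨ ℚ.*-identityʳ a ⟨
    a * 1ℚ   ≤⟨ *-mono-≤ a g 1ℚ g (ℚ.<⇒≤ (ℚ.positive⁻¹ 1ℚ)) (0≤grid n J) a≤g (ℚ.≤-trans (1≤integer ℤ.∣ ↥ q ∣) a≤g) ⟩
    g * g    ∎
    where
    J : ℕ
    J = suc (suc n ℕ.* suc ℤ.∣ ↥ q ∣)
    a g : ℚ
    g = grid n J
    a = integer (suc ℤ.∣ ↥ q ∣)
    a≤g : a ≤ g
    a≤g = integer≤grid n ℤ.∣ ↥ q ∣

  0≤root : ∀ n q → 0ℚ ≤ root n q
  0≤root n q = 0≤search n q (suc n ℕ.* suc ℤ.∣ ↥ q ∣)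

  root-lower : ∀ n q → 0ℚ ≤ q → root n q * root n q ≤ q
  root-lower n q = search-lower n (suc n ℕ.* suc ℤ.∣ ↥ q ∣)

  root-upper : ∀ n q → q < (root n q + step n) * (root n q + step n)
  root-upper n q = search-upper n (suc n ℕ.* suc ℤ.∣ ↥ q ∣) (q<grid² n q)


  root-close : ∀ a b {ε} m n → 0ℚ < ε → 0ℚ ≤ a → step n ≤ ε * ½ →
               ∣ a - b ∣ ≤ (ε * ½) * (ε * ½) → root m a ≤ root n b + ε
  root-close a b {ε} m n 0<ε 0≤a s≤e h = ℚ.≮⇒≥ λ r+ε<s →
    ℚ.<-irrefl refl (begin-strict
      (r + ε) * (r + ε)              ≤⟨ *-mono-≤ (r + ε) (root m a) (r + ε) (root m a) 0≤r+ε (0≤root m a) (ℚ.<⇒≤ r+ε<s) (ℚ.<⇒≤ r+ε<s) ⟩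
      root m a * root m a            ≤⟨ root-lower m a 0≤a ⟩
      a                              ≤⟨ ∣p-q∣≤ε⇒p≤q+ε a b h ⟩
      b + e * e                      <⟨ ℚ.+-monoˡ-< (e * e) (root-upper n b) ⟩
      (r + step n) * (r + step n) + e * e
                                     ≤⟨ ℚ.+-monoˡ-≤ (e * e) (*-mono-≤ (r + step n) (r + e) (r + step n) (r + e) (0≤r+ (0<step n)) (0≤r+ 0<e) r+s≤r+e r+s≤r+e) ⟩
      (r + e) * (r + e) + e * e      ≡⟨ cong (_+ e * e) (ℚ.+-identityʳ ((r + e) * (r + e))) ⟨
      (r + e) * (r + e) + 0ℚ + e * e ≤⟨ ℚ.+-monoˡ-≤ (e * e) (ℚ.+-monoʳ-≤ ((r + e) * (r + e)) 0≤cross) ⟩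
      (r + e) * (r + e) + ((r + e) * e + (r + e) * e) + e * e
                                     ≡⟨ solve 2 (λ r e →
                                          (r :+ e) :* (r :+ e) :+ ((r :+ e) :* e :+ (r :+ e) :* e) :+ e :* e
                                          := (r :+ (e :+ e)) :* (r :+ (e :+ e))) refl r e ⟩
      (r + (e + e)) * (r + (e + e))  ≡⟨ cong (λ x → (r + x) * (r + x)) (halves ε) ⟩
      (r + ε) * (r + ε)              ∎)
    where
    open +-*-Solver
    r e : ℚ
    r = root n b
    e = ε * ½
    0<e : 0ℚ < e
    0<e = half>0 0<ε
    0≤r+ : ∀ {x} → 0ℚ < x → 0ℚ ≤ r + x
    0≤r+ 0<x = ℚ.+-mono-≤ (0≤root n b) (ℚ.<⇒≤ 0<x)
    0≤r+ε : 0ℚ ≤ r + ε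
    0≤r+ε = 0≤r+ 0<ε
    r+s≤r+e : r + step n ≤ r + e
    r+s≤r+e = ℚ.+-monoʳ-≤ r s≤e
    0≤[r+e]e : 0ℚ ≤ (r + e) * e
    0≤[r+e]e = ℚ.nonNegative⁻¹ ((r + e) * e) {{ℚ.nonNeg*nonNeg⇒nonNeg (r + e) {{ℚ.nonNegative (0≤r+ 0<e)}} e {{ℚ.nonNegative (ℚ.<⇒≤ 0<e)}}}}
    0≤cross : 0ℚ ≤ (r + e) * e + (r + e) * e
    0≤cross = ℚ.+-mono-≤ 0≤[r+e]e 0≤[r+e]e

infix  4 _≃_ _≤_
infixl 6 _+_ _-_ _⊔_
infixl 7 _*_ _/_ _⊓_
infix  8 -_ √_

-- Equality of reals is the relation _≃_ below, not _≡_.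
record ℝ : Set where
  constructor mkℝ
  field
    approx : ℕ → ℚ
    cauchy : ∀ ε → 0ℚ ℚ.< ε → ∃ λ N → ∀ m n → N ℕ.≤ m → N ℕ.≤ n →
             ℚ.∣ approx m ℚ.- approx n ∣ ℚ.≤ ε

open ℝ public

record _≃_ (x y : ℝ) : Set where
  constructor *≃*
  field
    drop-*≃* : ∀ ε → 0ℚ ℚ.< ε → ∃ λ N → ∀ n → N ℕ.≤ n →
               ℚ.∣ approx x n ℚ.- approx y n ∣ ℚ.≤ ε

record _≤_ (x y : ℝ) : Set where
  constructor *≤*
  field
    drop-*≤* : ∀ ε → 0ℚ ℚ.< ε → ∃ λ N → ∀ n → N ℕ.≤ n →
               approx x n ℚ.≤ approx y n ℚ.+ ε

open _≃_ public
open _≤_ public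

1>0 : 0ℚ ℚ.< 1ℚ
1>0 = ℚ.positive⁻¹ 1ℚ

boundIndex : ℝ → ℕ
boundIndex x = proj₁ (cauchy x 1ℚ 1>0)

-- |approx x n| ≤ bound x for n ≥ boundIndex x.
bound : ℝ → ℚ
bound x = ℚ.∣ approx x (boundIndex x) ∣ ℚ.+ 1ℚ

0<bound : ∀ x → 0ℚ ℚ.< bound x
0<bound x = ℚ.+-mono-≤-< (ℚ.0≤∣p∣ (approx x (boundIndex x))) 1>0

∣approx∣≤bound : ∀ x n → boundIndex x ℕ.≤ n → ℚ.∣ approx x n ∣ ℚ.≤ bound x
∣approx∣≤bound x n N≤n = Rational.∣p-q∣≤ε⇒p≤q+ε (ℚ.∣ approx x n ∣) (ℚ.∣ approx x N ∣)
  (Rational.abs-close (approx x n) (approx x N) (proj₂ (cauchy x 1ℚ 1>0) n N N≤n ℕ.≤-refl))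
  where
  N : ℕ
  N = boundIndex x

private
  module Share (x : ℝ) where
    instance
      bound-positive : ℚ.Positive (bound x)
      bound-positive = ℚ.positive (0<bound x)
      bound-nonZero : ℚ.NonZero (bound x)
      bound-nonZero = ℚ.pos⇒nonZero (bound x)

    -- (ε / 2) / bound x
    share : ℚ → ℚ
    share ε = (ε ℚ.* ½) ℚ.* (ℚ.1/ bound x)

    0<share : ∀ {ε} → 0ℚ ℚ.< ε → 0ℚ ℚ.< share ε
    0<share 0<ε = Rational.*-pos (Rational.half>0 0<ε)
      (ℚ.positive⁻¹ (ℚ.1/ bound x) {{ℚ.1/pos⇒pos (bound x)}})

    bound*share : ∀ ε → bound x ℚ.* share ε ≡ ε ℚ.* ½
    bound*share ε = Rational.*-cancel-1/ (bound x) (ε ℚ.* ½)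

  open Share using (share; 0<share; bound*share)

  shares : ∀ x y ε → bound x ℚ.* share x ε ℚ.+ bound y ℚ.* share y ε ≡ ε
  shares x y ε = trans (cong₂ ℚ._+_ (bound*share x ε) (bound*share y ε)) (Rational.halves ε)

  map : (f : ℚ → ℚ) →
        (∀ p q {ε} → ℚ.∣ p ℚ.- q ∣ ℚ.≤ ε → ℚ.∣ f p ℚ.- f q ∣ ℚ.≤ ε) →
        ℝ → ℝ
  map f close x = mkℝ (λ n → f (approx x n)) λ ε 0<ε → let N , h = cauchy x ε 0<ε in
    N , λ m n N≤m N≤n → close (approx x m) (approx x n) (h m n N≤m N≤n)

  map₂ : (f : ℚ → ℚ → ℚ) →
         (∀ p p′ q q′ {ε} → ℚ.∣ p ℚ.- q ∣ ℚ.≤ ε → ℚ.∣ p′ ℚ.- q′ ∣ ℚ.≤ ε →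
           ℚ.∣ f p p′ ℚ.- f q q′ ∣ ℚ.≤ ε) →
         ℝ → ℝ → ℝ
  map₂ f close x y = mkℝ (λ n → f (approx x n) (approx y n)) λ ε 0<ε →
    let M , g = cauchy x ε 0<ε
        N , h = cauchy y ε 0<ε
    in M ℕ.⊔ N , λ m n ≤m ≤n →
      close (approx x m) (approx y m) (approx x n) (approx y n)
        (g m n (ℕ.m⊔n≤o⇒m≤o M N ≤m) (ℕ.m⊔n≤o⇒m≤o M N ≤n))
        (h m n (ℕ.m⊔n≤o⇒n≤o M N ≤m) (ℕ.m⊔n≤o⇒n≤o M N ≤n))

-- Without opacity, types mentioning real arithmetic unfold to the
-- moduli of convergence when normalised.
opaque
  fromℚ : ℚ → ℝ
  fromℚ q = mkℝ (λ _ → q) λ ε 0<ε → 0 , λ _ _ _ _ →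
    subst (λ p → ℚ.∣ p ∣ ℚ.≤ ε) (sym (ℚ.+-inverseʳ q)) (ℚ.<⇒≤ 0<ε)

  -_ : ℝ → ℝ
  -_ = map ℚ.-_ Rational.neg-close

  ∣_∣ : ℝ → ℝ
  ∣_∣ = map ℚ.∣_∣ Rational.abs-close

  _⊔_ : ℝ → ℝ → ℝ
  _⊔_ = map₂ ℚ._⊔_ Rational.⊔-close

  _⊓_ : ℝ → ℝ → ℝ
  _⊓_ = map₂ ℚ._⊓_ Rational.⊓-close

  _+_ : ℝ → ℝ → ℝ
  x + y = mkℝ (λ n → approx x n ℚ.+ approx y n) λ ε 0<ε →
    let M , g = cauchy x (ε ℚ.* ½) (Rational.half>0 0<ε)
        N , h = cauchy y (ε ℚ.* ½) (Rational.half>0 0<ε)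
    in M ℕ.⊔ N , λ m n ≤m ≤n → ℚ.≤-trans
      (Rational.+-close (approx x m) (approx y m) (approx x n) (approx y n)
        (g m n (ℕ.m⊔n≤o⇒m≤o M N ≤m) (ℕ.m⊔n≤o⇒m≤o M N ≤n))
        (h m n (ℕ.m⊔n≤o⇒n≤o M N ≤m) (ℕ.m⊔n≤o⇒n≤o M N ≤n)))
      (ℚ.≤-reflexive (Rational.halves ε))

  _*_ : ℝ → ℝ → ℝ
  x * y = mkℝ (λ n → approx x n ℚ.* approx y n) λ ε 0<ε →
    let M , g = cauchy x (share y ε) (0<share y 0<ε)
        N , h = cauchy y (share x ε) (0<share x 0<ε)
        K = boundIndex x
        L = boundIndex y
    in (M ℕ.⊔ N) ℕ.⊔ (K ℕ.⊔ L) , λ m n ≤m ≤n →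
      let M⊔N≤m = ℕ.m⊔n≤o⇒m≤o (M ℕ.⊔ N) (K ℕ.⊔ L) ≤m
          M⊔N≤n = ℕ.m⊔n≤o⇒m≤o (M ℕ.⊔ N) (K ℕ.⊔ L) ≤n
          K⊔L≤m = ℕ.m⊔n≤o⇒n≤o (M ℕ.⊔ N) (K ℕ.⊔ L) ≤m
          K⊔L≤n = ℕ.m⊔n≤o⇒n≤o (M ℕ.⊔ N) (K ℕ.⊔ L) ≤n
      in ℚ.≤-trans
        (Rational.*-close (approx x m) (approx y m) (approx x n) (approx y n)
          (∣approx∣≤bound x m (ℕ.m⊔n≤o⇒m≤o K L K⊔L≤m))
          (∣approx∣≤bound y n (ℕ.m⊔n≤o⇒n≤o K L K⊔L≤n))
          (g m n (ℕ.m⊔n≤o⇒m≤o M N M⊔N≤m) (ℕ.m⊔n≤o⇒m≤o M N M⊔N≤n))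
          (h m n (ℕ.m⊔n≤o⇒n≤o M N M⊔N≤m) (ℕ.m⊔n≤o⇒n≤o M N M⊔N≤n)))
        (ℚ.≤-reflexive (shares x y ε))

  -- The square root of the positive part of x.
  √_ : ℝ → ℝ
  √ x = mkℝ (λ n → Rational.root n (approx x⁺ n)) λ ε 0<ε →
    let 0<ε/2 = Rational.half>0 0<ε
        M , g = cauchy x⁺ (ε ℚ.* ½ ℚ.* (ε ℚ.* ½)) (Rational.*-pos 0<ε/2 0<ε/2)
        N , h = Rational.step≤ 0<ε/2
    in M ℕ.⊔ N , λ m n ≤m ≤n →
      let M≤m = ℕ.m⊔n≤o⇒m≤o M N ≤m
          M≤n = ℕ.m⊔n≤o⇒m≤o M N ≤n
      in Rational.within (Rational.root m (approx x⁺ m)) (Rational.root n (approx x⁺ n))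
        (Rational.root-close (approx x⁺ m) (approx x⁺ n) m n 0<ε (0≤x⁺ m)
          (h n (ℕ.m⊔n≤o⇒n≤o M N ≤n)) (g m n M≤m M≤n))
        (Rational.root-close (approx x⁺ n) (approx x⁺ m) n m 0<ε (0≤x⁺ n)
          (h m (ℕ.m⊔n≤o⇒n≤o M N ≤m)) (g n m M≤n M≤m))
    where
    x⁺ : ℝ
    x⁺ = x ⊔ fromℚ 0ℚ
    0≤x⁺ : ∀ n → 0ℚ ℚ.≤ approx x⁺ n
    0≤x⁺ n = ℚ.p≤q⊔p (approx x n) 0ℚ

fromℕ : ℕ → ℝ
fromℕ n = fromℚ (ℤ.+ n ℚ./ 1)

0ℝ 1ℝ : ℝ
0ℝ = fromℕ 0
1ℝ = fromℕ 1

_-_ : ℝ → ℝ → ℝ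
x - y = x + (- y)

_/_ : ℝ → (n : ℕ) .{{_ : NonZero n}} → ℝ
x / n = x * fromℚ (ℤ.+ 1 ℚ./ n)

+-*-rawSemiring : RawSemiring 0ℓ 0ℓ
+-*-rawSemiring = record
  { Carrier = ℝ ; _≈_ = _≃_ ; _+_ = _+_ ; _*_ = _*_ ; 0# = 0ℝ ; 1# = 1ℝ }

open RawSemiringDefinitions +-*-rawSemiring public using (_^_; sum; product)

⟨_,_⟩ : ∀ {d} → Vector ℝ d → Vector ℝ d → ℝ
⟨ u , v ⟩ = sum λ l → u l * v l

‖_‖₁ : ∀ {d} → Vector ℝ d → ℝ
‖ u ‖₁ = sum λ l → ∣ u l ∣

‖_‖₂ : ∀ {d} → Vector ℝ d → ℝ
‖ u ‖₂ = √ sum λ l → u l ^ 2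

-- The order on ℝ is not decidable, but sorting by means of binary
-- minima and maxima needs no decisions.
insert : ∀ {n} → ℝ → Vec ℝ n → Vec ℝ (suc n)
insert x []       = x ∷ []
insert x (y ∷ ys) = x ⊓ y ∷ insert (x ⊔ y) ys

sort : ∀ {n} → Vec ℝ n → Vec ℝ n
sort []       = []
sort (x ∷ xs) = insert x (sort xs)

-- The t-th smallest of 2t - 1 numbers; the index below counts from 0.
median : ∀ t .{{_ : NonZero t}} → Vector ℝ (2 ℕ.* t ℕ.∸ 1) → ℝ
median (suc k) y = Vec.lookup (sort (Vec.tabulate y)) (fromℕ< {k} (ℕ.m<m+n k ℕ.z<s))

record FiniteProbabilitySpace : Set where
  field
    size     : ℕ
    weight   : Fin size → ℝ
    0≤weight : ∀ ω → 0ℝ ≤ weight ω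
    total    : sum weight ≃ 1ℝ

  Ω : Set
  Ω = Fin size

  𝔼 : (Ω → ℝ) → ℝ
  𝔼 X = sum λ ω → weight ω * X ω

  ℙ : (Ω → Bool) → ℝ
  ℙ A = 𝔼 λ ω → if A ω then 1ℝ else 0ℝ

  Independent : ∀ {A : Set} {n} → (Fin n → Ω → A) → Set
  Independent {A} {n} X = (B : Fin n → A → Bool) →
    ℙ (λ ω → Vector.foldr _∧_ true λ i → B i (X i ω)) ≃ product λ i → ℙ (B i ∘ X i)

  infix 4 _⊥_
  _⊥_ : ∀ {A B : Set} → (Ω → A) → (Ω → B) → Set
  _⊥_ {A} {B} X Y = (C : A → Bool) (D : B → Bool) →
    ℙ (λ ω → C (X ω) ∧ D (Y ω)) ≃ ℙ (C ∘ X) * ℙ (D ∘ Y)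

  IdenticallyDistributed : ∀ {A : Set} → (Ω → A) → (Ω → A) → Set
  IdenticallyDistributed {A} X Y = (B : A → Bool) → ℙ (B ∘ X) ≃ ℙ (B ∘ Y)

  -- X is uniform on a type of cardinality c.
  Uniform : ∀ {A : Set} → DecidableEquality A → (c : ℕ) .{{_ : NonZero c}} → (Ω → A) → Set
  Uniform _≟_ c X = ∀ a → ℙ (λ ω → ⌊ X ω ≟ a ⌋) ≃ 1ℝ / c

  -- A random function from Fin d to a type of cardinality c, stored as
  -- the vector of its values.
  WiseIndependent : ∀ {A : Set} → DecidableEquality A → (c : ℕ) .{{_ : NonZero c}} →
                    ℕ → ∀ {d} → (Ω → Vec A d) → Set
  WiseIndependent _≟_ c k {d} f = ∀ m → m ℕ.≤ k → (key : Fin m → Fin d) → Injective _≡_ _≡_ key →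
    Independent (λ j ω → Vec.lookup (f ω) (key j)) ×
    (∀ j → Uniform _≟_ c λ ω → Vec.lookup (f ω) (key j))

signValue : Sign → ℝ
signValue Sign.+ = 1ℝ
signValue Sign.- = - 1ℝ

record CountSketch (P : FiniteProbabilitySpace) (d s rows : ℕ) .{{_ : NonZero s}} : Set where
  open FiniteProbabilitySpace P
  field
    h : Fin rows → Ω → Vec (Fin s) d
    g : Fin rows → Ω → Vec Sign d
    h-2-wise              : ∀ i → WiseIndependent Fin._≟_ s 2 (h i)
    g-4-wise              : ∀ i → WiseIndependent Sign._≟_ 2 4 (g i)
    h⊥g                   : ∀ i → h i ⊥ g i
    rows-independent      : Independent λ i ω → h i ω , g i ω
    rows-equidistributed  : ∀ i j → IdenticallyDistributed (λ ω → h i ω , g i ω) (λ ω → h j ω , g j ω)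

  sketch : Vector ℝ d → Ω → Fin rows → Vector ℝ s
  sketch u ω i k = sum λ l →
    if ⌊ Vec.lookup (h i ω) l Fin.≟ k ⌋ then signValue (Vec.lookup (g i ω) l) * u l else 0ℝ

{-# OPTIONS --safe #-}
-- The error of a row is Z = Σ_{l≠m} [h l = h m] g l g m v_l w_m.  It has mean
-- zero, E|Z| ≤ ‖v‖₁‖w‖₁/s since two distinct keys collide with probability 1/s,
-- and E Z² ≤ 2‖v‖₂²‖w‖₂²/s, since by 4-wise independence only the pairs of terms
-- on the same two keys are correlated.  At least t of the 2t − 1 rows err by no
-- less than their median does, in the same direction, so |X − ⟨v,w⟩|^t is at most
-- the elementary symmetric polynomial e_t(|Z₁|,…,|Z₂ₜ₋₁|), whose expectation is
-- e_t(E|Z₁|,…) by independence of the rows; likewise for (X − ⟨v,w⟩)^2t and the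
-- Zᵢ².
--
-- For t = 2 the bound E(X − ⟨v,w⟩)² ≤ E Z² without a loss comes from a pointwise
-- inequality: the median D of a, b, c satisfies
--   3D² ≤ a² + b² + c² + a h(b,c) + b h(a,c) + c h(a,b),
--   h(x,y) = |max(x,y)| − |min(x,y)|,
-- and the last three terms vanish in expectation, as the rows are independent and
-- have mean zero.
--
-- Arithmetic on reals acts termwise on the approximating sequences, so that
-- (in)equalities between rational expressions hold for reals as well.
module Submission where

import Algebra.Solver.Ring.NaturalCoefficients.Default as NaturalCoefficientsSolver
open import Algebra.Bundles using (CommutativeRing)
open import Algebra.Structures using (IsCommutativeRing)
open import Data.Bool.Base using (Bool; true; false; _∧_; if_then_else_)
open import Data.Bool.Properties using (∧-idem)
open import Data.Fin.Base using (Fin; zero; suc; toℕ; fromℕ<; combine; remQuot; funToFin; finToFun)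
open import Data.Fin.Patterns using (0F; 1F; 2F)
import Data.Fin.Properties as Fin
import Data.Integer.Base as ℤ
open import Data.Integer.Solver using () renaming (module +-*-Solver to ℤ-Solver)
open import Data.Nat.Base as ℕ using (ℕ; zero; suc; NonZero)
import Data.Nat.Properties as ℕ
open import Data.Nat.Properties using (m^n≢0)
open import Data.Product.Base using (_×_; _,_; proj₁; proj₂)
open import Data.Rational.Base as ℚ using (ℚ; 0ℚ; 1ℚ; ½)
import Data.Rational.Properties as ℚ
open import Data.Rational.Solver using (module +-*-Solver)
import Data.Rational.Unnormalised.Base as ℚᵘ
import Data.Rational.Unnormalised.Properties as ℚᵘ
open import Data.Sign.Base using (Sign)
import Data.Sign.Properties as Sign
open import Data.Sum.Base using (_⊎_; inj₁; inj₂)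
open import Data.Vec.Base as Vec using (Vec; []; _∷_)
open import Data.Vec.Functional as Vector using (Vector)
import Data.Vec.Properties as Vec
open import Data.Vec.Relation.Unary.All as All using (All; []; _∷_)
import Data.Vec.Relation.Unary.All.Properties as All
open import Data.Vec.Relation.Unary.AllPairs using (AllPairs; []; _∷_)
open import Defs using (module Rational)
open import Function.Base using (_∘_)
open import Function.Definitions using (Injective)
open import Level using (0ℓ)
open import Relation.Binary.Bundles using (Poset)
open import Relation.Binary.PropositionalEquality.Core
  using (_≡_; _≢_; refl; sym; trans; cong; cong₂; subst; subst₂)
open import Relation.Nullary.Decidable.Core using (yes; no; ⌊_⌋)
open import Relation.Nullary.Negation.Core using (contradiction)

-- The order on reals cannot be decided, so no step may ask which row attains the median or whether
-- an error is positive. Case distinctions are confined to rational approximations. For reals they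
-- are replaced by lattice identities: `∣ z ∣` is the maximum of the positive and the negative part
-- of z, each bounded from its own side of the sorted list, and sorting preserves elementary
-- symmetric polynomials because minimum and maximum have the same symmetric functions as the two
-- numbers they come from.
--
-- Independence is given for events only. Since the hash functions of a row take finitely many
-- values, every function of them is a combination of indicators, and the product rule for
-- expectations follows.
--
-- The constants: `e t` at 2t - 1 equal arguments has binom(2t - 1, t) terms, at most 2^(2t - 1),
-- and exactly 3 when t = 2. The bound on even powers acquires a further 2^t from the 2 in E Z².
-- That 2 counts the two orders, (l, m) and (m, l), in which a pair of keys occurs.

-- The median of three rational numbers

module MedianOfThree where
  open import Data.Rational.Base using (_+_; _*_; -_; _-_; ∣_∣; _≤_; _⊔_; _⊓_)
  open +-*-Solver
  open ℚ.≤-Reasoning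

  -- Negating both arguments negates the gap, so a row error times the gap of the other two is
  -- unchanged when all three errors change sign.
  gap : ℚ → ℚ → ℚ
  gap p q = ∣ p ⊔ q ∣ - ∣ p ⊓ q ∣

  -- The middle entry of `sort` on three numbers with the insertions carried out, so that `median 2`
  -- unfolds to this very shape.
  med : ℚ → ℚ → ℚ → ℚ
  med x y z = (x ⊔ (y ⊓ z)) ⊓ (y ⊔ z)

  bound₃ : (x y z u v w : ℚ) → ℚ
  bound₃ x y z u v w = (x * x + y * y + z * z) + (x * u + y * v + z * w)

  thrice : ℚ → ℚ
  thrice p = p + p + p

  ∣p∣*∣p∣≡p*p : ∀ p → ∣ p ∣ * ∣ p ∣ ≡ p * p
  ∣p∣*∣p∣≡p*p p with ℚ.∣p∣≡p∨∣p∣≡-p p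
  ... | inj₁ eq = cong (λ a → a * a) eq
  ... | inj₂ eq = trans (cong (λ a → a * a) eq) (solve 1 (λ p → (:- p) :* (:- p) := p :* p) refl p)

  0≤p² : ∀ p → 0ℚ ≤ p * p
  0≤p² p = ℚ.≤-trans (Rational.*-mono-≤ 0ℚ (∣ p ∣) 0ℚ (∣ p ∣) ℚ.≤-refl (ℚ.0≤∣p∣ p) (ℚ.0≤∣p∣ p) (ℚ.0≤∣p∣ p))
                     (ℚ.≤-reflexive (∣p∣*∣p∣≡p*p p))

  private
    0≤*  : ∀ {p q} → 0ℚ ≤ p → 0ℚ ≤ q → 0ℚ ≤ p * q
    0≤* {p} {q} 0≤p 0≤q = Rational.*-mono-≤ 0ℚ p 0ℚ q ℚ.≤-refl 0≤p 0≤p 0≤q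

    0≤q-p : ∀ {p q} → p ≤ q → 0ℚ ≤ q - p
    0≤q-p {p} p≤q = ℚ.≤-trans (ℚ.≤-reflexive (sym (ℚ.+-inverseʳ p))) (ℚ.+-monoˡ-≤ (- p) p≤q)

    p≤p+q : ∀ p {q} → 0ℚ ≤ q → p ≤ p + q
    p≤p+q p 0≤q = ℚ.≤-trans (ℚ.≤-reflexive (sym (ℚ.+-identityʳ p))) (ℚ.+-monoʳ-≤ p 0≤q)

    p≤0⇒∣p∣≡-p : ∀ {p} → p ≤ 0ℚ → ∣ p ∣ ≡ - p
    p≤0⇒∣p∣≡-p {p} p≤0 = trans (sym (ℚ.∣-p∣≡∣p∣ p)) (ℚ.0≤p⇒∣p∣≡p (ℚ.neg-antimono-≤ p≤0))

    -- With the median d nonnegative, the absolute values of d and M open up and only the sign of m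
    -- is left to distinguish. The right side exceeds the left by (m - d)² + (M - d)(M + 3d) when m
    -- ≥ 0 and by (m + M)² + 2d(M - d) when m ≤ 0.
    sorted-nonNeg : ∀ {m d M} → m ≤ d → d ≤ M → 0ℚ ≤ d →
                    thrice (d * d) ≤ bound₃ m d M (∣ M ∣ - ∣ d ∣) (∣ M ∣ - ∣ m ∣) (∣ d ∣ - ∣ m ∣)
    sorted-nonNeg {m} {d} {M} m≤d d≤M 0≤d = subst₂
      (λ D N → thrice (d * d) ≤ bound₃ m d M (N - D) (N - ∣ m ∣) (D - ∣ m ∣))
      (sym (ℚ.0≤p⇒∣p∣≡p 0≤d)) (sym (ℚ.0≤p⇒∣p∣≡p (ℚ.≤-trans 0≤d d≤M))) (by-sign (ℚ.≤-total 0ℚ m))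
      where
      by-sign : 0ℚ ≤ m ⊎ m ≤ 0ℚ → thrice (d * d) ≤ bound₃ m d M (M - d) (M - ∣ m ∣) (d - ∣ m ∣)
      by-sign (inj₁ 0≤m) rewrite ℚ.0≤p⇒∣p∣≡p 0≤m = begin
        thrice (d * d)
          ≤⟨ p≤p+q (thrice (d * d)) (ℚ.+-mono-≤ (0≤p² (m - d))
               (0≤* (0≤q-p d≤M) (ℚ.+-mono-≤ (ℚ.+-mono-≤ (ℚ.+-mono-≤ (ℚ.≤-trans 0≤d d≤M) 0≤d) 0≤d) 0≤d))) ⟩
        thrice (d * d) + ((m - d) * (m - d) + (M - d) * (M + d + d + d))
          ≡⟨ solve 3 (λ m d M →
               (d :* d :+ d :* d :+ d :* d) :+ ((m :- d) :* (m :- d) :+ (M :- d) :* (M :+ d :+ d :+ d))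
               := (m :* m :+ d :* d :+ M :* M) :+ (m :* (M :- d) :+ d :* (M :- m) :+ M :* (d :- m))) refl m d M ⟩
        bound₃ m d M (M - d) (M - m) (d - m)  ∎
      by-sign (inj₂ m≤0) rewrite p≤0⇒∣p∣≡-p m≤0 = begin
        thrice (d * d)
          ≤⟨ p≤p+q (thrice (d * d)) (ℚ.+-mono-≤ (0≤p² (m + M))
               (0≤* (ℚ.+-mono-≤ 0≤d 0≤d) (0≤q-p d≤M))) ⟩
        thrice (d * d) + ((m + M) * (m + M) + (d + d) * (M - d))
          ≡⟨ solve 3 (λ m d M →
               (d :* d :+ d :* d :+ d :* d) :+ ((m :+ M) :* (m :+ M) :+ (d :+ d) :* (M :- d))
               := (m :* m :+ d :* d :+ M :* M) :+ (m :* (M :- d) :+ d :* (M :- (:- m)) :+ M :* (d :- (:- m)))) refl m d M ⟩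
        bound₃ m d M (M - d) (M - (- m)) (d - (- m))  ∎

    -- Negating all three numbers reverses their order and leaves both sides unchanged, which
    -- reduces d ≤ 0 to d ≥ 0.
    sorted : ∀ {m d M} → m ≤ d → d ≤ M →
             thrice (d * d) ≤ bound₃ m d M (∣ M ∣ - ∣ d ∣) (∣ M ∣ - ∣ m ∣) (∣ d ∣ - ∣ m ∣)
    sorted {m} {d} {M} m≤d d≤M with ℚ.≤-total 0ℚ d
    ... | inj₁ 0≤d = sorted-nonNeg m≤d d≤M 0≤d
    ... | inj₂ d≤0 = begin
      thrice (d * d)
        ≡⟨ solve 1 (λ d → d :* d :+ d :* d :+ d :* d :=
             (:- d) :* (:- d) :+ (:- d) :* (:- d) :+ (:- d) :* (:- d)) refl d ⟩
      thrice ((- d) * (- d))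
        ≤⟨ sorted-nonNeg (ℚ.neg-antimono-≤ d≤M) (ℚ.neg-antimono-≤ m≤d) (ℚ.neg-antimono-≤ d≤0) ⟩
      bound₃ (- M) (- d) (- m) (∣ - m ∣ - ∣ - d ∣) (∣ - m ∣ - ∣ - M ∣) (∣ - d ∣ - ∣ - M ∣)
        ≡⟨ abs-neg ⟩
      bound₃ (- M) (- d) (- m) (∣ m ∣ - ∣ d ∣) (∣ m ∣ - ∣ M ∣) (∣ d ∣ - ∣ M ∣)
        ≡⟨ solve 6 (λ m d M m′ d′ M′ →
             ((:- M) :* (:- M) :+ (:- d) :* (:- d) :+ (:- m) :* (:- m))
               :+ ((:- M) :* (m′ :- d′) :+ (:- d) :* (m′ :- M′) :+ (:- m) :* (d′ :- M′))
             := (m :* m :+ d :* d :+ M :* M) :+ (m :* (M′ :- d′) :+ d :* (M′ :- m′) :+ M :* (d′ :- m′)))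
             refl m d M (∣ m ∣) (∣ d ∣) (∣ M ∣) ⟩
      bound₃ m d M (∣ M ∣ - ∣ d ∣) (∣ M ∣ - ∣ m ∣) (∣ d ∣ - ∣ m ∣)  ∎
      where
      abs-neg : bound₃ (- M) (- d) (- m) (∣ - m ∣ - ∣ - d ∣) (∣ - m ∣ - ∣ - M ∣) (∣ - d ∣ - ∣ - M ∣) ≡
                bound₃ (- M) (- d) (- m) (∣ m ∣ - ∣ d ∣) (∣ m ∣ - ∣ M ∣) (∣ d ∣ - ∣ M ∣)
      abs-neg rewrite ℚ.∣-p∣≡∣p∣ m | ℚ.∣-p∣≡∣p∣ d | ℚ.∣-p∣≡∣p∣ M = refl

    gap-≤ : ∀ {p q} → p ≤ q → gap p q ≡ ∣ q ∣ - ∣ p ∣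
    gap-≤ p≤q = cong₂ (λ a b → ∣ a ∣ - ∣ b ∣) (ℚ.p≤q⇒p⊔q≡q p≤q) (ℚ.p≤q⇒p⊓q≡p p≤q)

    gap-comm : ∀ p q → gap p q ≡ gap q p
    gap-comm p q = cong₂ (λ a b → ∣ a ∣ - ∣ b ∣) (ℚ.⊔-comm p q) (ℚ.⊓-comm p q)

    gap-≥ : ∀ {p q} → q ≤ p → gap p q ≡ ∣ p ∣ - ∣ q ∣
    gap-≥ {p} {q} q≤p = trans (gap-comm p q) (gap-≤ q≤p)

    bound₃-cong : ∀ x y z {u u′ v v′ w w′} → u ≡ u′ → v ≡ v′ → w ≡ w′ → bound₃ x y z u v w ≡ bound₃ x y z u′ v′ w′
    bound₃-cong x y z refl refl refl = refl

    -- Once the place of x relative to y ≤ z is known, the median collapses to one of the numbers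
    -- and the bound is that of `sorted` up to a permutation.
    y≤z-case : ∀ x {y z} → y ≤ z → thrice (med x y z * med x y z) ≤ bound₃ x y z (gap y z) (gap x z) (gap x y)
    y≤z-case x {y} {z} y≤z with ℚ.≤-total x y
    ... | inj₁ x≤y = begin
      thrice (med x y z * med x y z)
        ≡⟨ cong (λ d → thrice (d * d)) (trans (cong₂ (λ a b → (x ⊔ a) ⊓ b) (ℚ.p≤q⇒p⊓q≡p y≤z) (ℚ.p≤q⇒p⊔q≡q y≤z))
             (trans (cong (_⊓ z) (ℚ.p≤q⇒p⊔q≡q x≤y)) (ℚ.p≤q⇒p⊓q≡p y≤z))) ⟩
      thrice (y * y)
        ≤⟨ sorted x≤y y≤z ⟩
      bound₃ x y z (∣ z ∣ - ∣ y ∣) (∣ z ∣ - ∣ x ∣) (∣ y ∣ - ∣ x ∣)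
        ≡⟨ bound₃-cong x y z (gap-≤ y≤z) (gap-≤ (ℚ.≤-trans x≤y y≤z)) (gap-≤ x≤y) ⟨
      bound₃ x y z (gap y z) (gap x z) (gap x y)  ∎
    ... | inj₂ y≤x with ℚ.≤-total x z
    ...   | inj₁ x≤z = begin
      thrice (med x y z * med x y z)
        ≡⟨ cong (λ d → thrice (d * d)) (trans (cong₂ (λ a b → (x ⊔ a) ⊓ b) (ℚ.p≤q⇒p⊓q≡p y≤z) (ℚ.p≤q⇒p⊔q≡q y≤z))
             (trans (cong (_⊓ z) (ℚ.p≥q⇒p⊔q≡p y≤x)) (ℚ.p≤q⇒p⊓q≡p x≤z))) ⟩
      thrice (x * x)
        ≤⟨ sorted y≤x x≤z ⟩
      bound₃ y x z (∣ z ∣ - ∣ x ∣) (∣ z ∣ - ∣ y ∣) (∣ x ∣ - ∣ y ∣)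
        ≡⟨ bound₃-cong y x z (gap-≤ x≤z) (gap-≤ y≤z) (gap-≥ y≤x) ⟨
      bound₃ y x z (gap x z) (gap y z) (gap x y)
        ≡⟨ solve 6 (λ x y z u v w →
             (y :* y :+ x :* x :+ z :* z) :+ (y :* v :+ x :* u :+ z :* w)
             := (x :* x :+ y :* y :+ z :* z) :+ (x :* u :+ y :* v :+ z :* w)) refl x y z (gap y z) (gap x z) (gap x y) ⟩
      bound₃ x y z (gap y z) (gap x z) (gap x y)  ∎
    ...   | inj₂ z≤x = begin
      thrice (med x y z * med x y z)
        ≡⟨ cong (λ d → thrice (d * d)) (trans (cong₂ (λ a b → (x ⊔ a) ⊓ b) (ℚ.p≤q⇒p⊓q≡p y≤z) (ℚ.p≤q⇒p⊔q≡q y≤z))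
             (trans (cong (_⊓ z) (ℚ.p≥q⇒p⊔q≡p y≤x)) (ℚ.p≥q⇒p⊓q≡q z≤x))) ⟩
      thrice (z * z)
        ≤⟨ sorted y≤z z≤x ⟩
      bound₃ y z x (∣ x ∣ - ∣ z ∣) (∣ x ∣ - ∣ y ∣) (∣ z ∣ - ∣ y ∣)
        ≡⟨ bound₃-cong y z x (gap-≥ z≤x) (gap-≥ y≤x) (gap-≤ y≤z) ⟨
      bound₃ y z x (gap x z) (gap x y) (gap y z)
        ≡⟨ solve 6 (λ x y z u v w →
             (y :* y :+ z :* z :+ x :* x) :+ (y :* v :+ z :* w :+ x :* u)
             := (x :* x :+ y :* y :+ z :* z) :+ (x :* u :+ y :* v :+ z :* w)) refl x y z (gap y z) (gap x z) (gap x y) ⟩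
      bound₃ x y z (gap y z) (gap x z) (gap x y)  ∎

  med-bound : ∀ x y z → thrice (med x y z * med x y z) ≤ bound₃ x y z (gap y z) (gap x z) (gap x y)
  med-bound x y z with ℚ.≤-total y z
  ... | inj₁ y≤z = y≤z-case x y≤z
  ... | inj₂ z≤y = begin
    thrice (med x y z * med x y z)
      ≡⟨ cong (λ d → thrice (d * d)) (cong₂ (λ a b → (x ⊔ a) ⊓ b) (ℚ.⊓-comm y z) (ℚ.⊔-comm y z)) ⟩
    thrice (med x z y * med x z y)
      ≤⟨ y≤z-case x z≤y ⟩
    bound₃ x z y (gap z y) (gap x y) (gap x z)
      ≡⟨ bound₃-cong x z y (gap-comm z y) refl refl ⟩
    bound₃ x z y (gap y z) (gap x y) (gap x z)
      ≡⟨ solve 6 (λ x y z u v w →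
           (x :* x :+ z :* z :+ y :* y) :+ (x :* u :+ z :* w :+ y :* v)
           := (x :* x :+ y :* y :+ z :* z) :+ (x :* u :+ y :* v :+ z :* w)) refl x y z (gap y z) (gap x z) (gap x y) ⟩
    bound₃ x y z (gap y z) (gap x z) (gap x y)  ∎

  -- Translation is monotone, hence commutes with minima and maxima: the error of the median is the
  -- median of the errors.
  med-shift : ∀ x y z r → med x y z + r ≡ med (x + r) (y + r) (z + r)
  med-shift x y z r = trans (ℚ.mono-≤-distrib-⊓ mono (x ⊔ (y ⊓ z)) (y ⊔ z)) (cong₂ _⊓_
    (trans (ℚ.mono-≤-distrib-⊔ mono x (y ⊓ z)) (cong ((x + r) ⊔_) (ℚ.mono-≤-distrib-⊓ mono y z)))
    (ℚ.mono-≤-distrib-⊔ mono y z))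
    where
    mono : ∀ {p q} → p ≤ q → p + r ≤ q + r
    mono = ℚ.+-monoˡ-≤ r

  p*q≤½p²+½q² : ∀ p q → p * q ≤ ½ * (p * p) + ½ * (q * q)
  p*q≤½p²+½q² p q = begin
    p * q
      ≤⟨ p≤p+q (p * q) (0≤* {½} (ℚ.nonNegative⁻¹ ½) (0≤p² (p - q))) ⟩
    p * q + ½ * ((p - q) * (p - q))
      ≡⟨ solve 2 (λ p q → p :* q :+ con ½ :* ((p :- q) :* (p :- q)) := con ½ :* (p :* p) :+ con ½ :* (q :* q)) refl p q ⟩
    ½ * (p * p) + ½ * (q * q)  ∎

-- The factor 2^t comes from the 2 in the second moment of a row. It fits into a second 2^n because
-- t ≤ 2t - 1.
2^n*2^t≤4^n : ∀ t .{{_ : NonZero t}} → let n = 2 ℕ.* t ℕ.∸ 1 in 2 ℕ.^ n ℕ.* 2 ℕ.^ t ℕ.≤ 4 ℕ.^ n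
2^n*2^t≤4^n t@(suc k) = begin
  2 ℕ.^ n ℕ.* 2 ℕ.^ t   ≡⟨ ℕ.^-distribˡ-+-* 2 n t ⟨
  2 ℕ.^ (n ℕ.+ t)       ≤⟨ ℕ.^-monoʳ-≤ 2 (ℕ.+-monoʳ-≤ n t≤n+0) ⟩
  2 ℕ.^ (2 ℕ.* n)       ≡⟨ ℕ.^-*-assoc 2 2 n ⟨
  4 ℕ.^ n               ∎
  where
  open ℕ.≤-Reasoning
  n : ℕ
  n = 2 ℕ.* t ℕ.∸ 1
  t≤n+0 : t ℕ.≤ n ℕ.+ 0
  t≤n+0 = ℕ.≤-trans (ℕ.≤-trans (ℕ.m≤n+m (suc k) k) (ℕ.+-monoʳ-≤ k (ℕ.s≤s (ℕ.m≤m+n k 0)))) (ℕ.m≤m+n n 0)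

open import Defs

-- The order and the ring structure of the reals

≃-pointwise : ∀ {x y} → (∀ n → approx x n ≡ approx y n) → x ≃ y
≃-pointwise {x} {y} h = *≃* λ ε 0<ε → 0 , λ n _ →
  subst (ℚ._≤ ε) (sym (trans (cong (λ p → ℚ.∣ p ℚ.- approx y n ∣) (h n))
                             (cong ℚ.∣_∣ (ℚ.+-inverseʳ (approx y n)))))
        (ℚ.<⇒≤ 0<ε)

≤-pointwise : ∀ {x y} → (∀ n → approx x n ℚ.≤ approx y n) → x ≤ y
≤-pointwise {x} {y} h = *≤* λ ε 0<ε → 0 , λ n _ → ℚ.≤-trans (h n)
  (ℚ.≤-trans (ℚ.≤-reflexive (sym (ℚ.+-identityʳ (approx y n))))
             (ℚ.+-monoʳ-≤ (approx y n) (ℚ.<⇒≤ 0<ε)))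

≤-refl : ∀ {x} → x ≤ x
≤-refl = ≤-pointwise λ _ → ℚ.≤-refl

≤-trans : ∀ {x y z} → x ≤ y → y ≤ z → x ≤ z
≤-trans {x} {y} {z} (*≤* f) (*≤* g) = *≤* λ ε 0<ε →
  let M , f′ = f (ε ℚ.* ½) (Rational.half>0 0<ε)
      N , g′ = g (ε ℚ.* ½) (Rational.half>0 0<ε)
  in M ℕ.⊔ N , λ n ≤n → begin
    approx x n                             ≤⟨ f′ n (ℕ.m⊔n≤o⇒m≤o M N ≤n) ⟩
    approx y n ℚ.+ ε ℚ.* ½                 ≤⟨ ℚ.+-monoˡ-≤ _ (g′ n (ℕ.m⊔n≤o⇒n≤o M N ≤n)) ⟩
    approx z n ℚ.+ ε ℚ.* ½ ℚ.+ ε ℚ.* ½     ≡⟨ ℚ.+-assoc (approx z n) _ _ ⟩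
    approx z n ℚ.+ (ε ℚ.* ½ ℚ.+ ε ℚ.* ½)   ≡⟨ cong (approx z n ℚ.+_) (Rational.halves ε) ⟩
    approx z n ℚ.+ ε                       ∎
  where open ℚ.≤-Reasoning

≤-antisym : ∀ {x y} → x ≤ y → y ≤ x → x ≃ y
≤-antisym {x} {y} (*≤* f) (*≤* g) = *≃* λ ε 0<ε →
  let M , f′ = f ε 0<ε
      N , g′ = g ε 0<ε
  in M ℕ.⊔ N , λ n ≤n → Rational.within (approx x n) (approx y n)
    (f′ n (ℕ.m⊔n≤o⇒m≤o M N ≤n)) (g′ n (ℕ.m⊔n≤o⇒n≤o M N ≤n))

≃⇒≤ : ∀ {x y} → x ≃ y → x ≤ y
≃⇒≤ {x} {y} (*≃* f) = *≤* λ ε 0<ε → let N , f′ = f ε 0<ε in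
  N , λ n N≤n → Rational.∣p-q∣≤ε⇒p≤q+ε (approx x n) (approx y n) (f′ n N≤n)

≃⇒≥ : ∀ {x y} → x ≃ y → y ≤ x
≃⇒≥ {x} {y} (*≃* f) = *≤* λ ε 0<ε → let N , f′ = f ε 0<ε in
  N , λ n N≤n → Rational.∣p-q∣≤ε⇒q≤p+ε (approx x n) (approx y n) (f′ n N≤n)

≃-refl : ∀ {x} → x ≃ x
≃-refl = ≃-pointwise λ _ → refl

≃-sym : ∀ {x y} → x ≃ y → y ≃ x
≃-sym h = ≤-antisym (≃⇒≥ h) (≃⇒≤ h)

≃-trans : ∀ {x y z} → x ≃ y → y ≃ z → x ≃ z
≃-trans h k = ≤-antisym (≤-trans (≃⇒≤ h) (≃⇒≤ k)) (≤-trans (≃⇒≥ k) (≃⇒≥ h))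

≤-poset : Poset 0ℓ 0ℓ 0ℓ
≤-poset = record
  { Carrier = ℝ ; _≈_ = _≃_ ; _≤_ = _≤_
  ; isPartialOrder = record
    { isPreorder = record
      { isEquivalence = record { refl = ≃-refl ; sym = ≃-sym ; trans = ≃-trans }
      ; reflexive = ≃⇒≤
      ; trans = ≤-trans }
    ; antisym = ≤-antisym } }

opaque
  unfolding _+_ _*_ -_ _⊔_ _⊓_ fromℚ

  +-mono-≤ : ∀ {x y u v} → x ≤ y → u ≤ v → x + u ≤ y + v
  +-mono-≤ {x} {y} {u} {v} (*≤* f) (*≤* g) = *≤* λ ε 0<ε →
    let M , f′ = f (ε ℚ.* ½) (Rational.half>0 0<ε)
        N , g′ = g (ε ℚ.* ½) (Rational.half>0 0<ε)
    in M ℕ.⊔ N , λ n ≤n → begin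
      approx x n ℚ.+ approx u n
        ≤⟨ ℚ.+-mono-≤ (f′ n (ℕ.m⊔n≤o⇒m≤o M N ≤n)) (g′ n (ℕ.m⊔n≤o⇒n≤o M N ≤n)) ⟩
      approx y n ℚ.+ ε ℚ.* ½ ℚ.+ (approx v n ℚ.+ ε ℚ.* ½)
        ≡⟨ solve 3 (λ y v e → (y :+ e) :+ (v :+ e) := (y :+ v) :+ (e :+ e)) refl (approx y n) (approx v n) (ε ℚ.* ½) ⟩
      approx y n ℚ.+ approx v n ℚ.+ (ε ℚ.* ½ ℚ.+ ε ℚ.* ½)
        ≡⟨ cong (approx y n ℚ.+ approx v n ℚ.+_) (Rational.halves ε) ⟩
      approx y n ℚ.+ approx v n ℚ.+ ε  ∎
    where
    open ℚ.≤-Reasoning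
    open +-*-Solver

  neg-antimono-≤ : ∀ {x y} → x ≤ y → - y ≤ - x
  neg-antimono-≤ {x} {y} (*≤* f) = *≤* λ ε 0<ε → let N , f′ = f ε 0<ε in N , λ n N≤n → begin
    ℚ.- approx y n
      ≡⟨ solve 2 (λ y e → :- y := :- (y :+ e) :+ e) refl (approx y n) ε ⟩
    ℚ.- (approx y n ℚ.+ ε) ℚ.+ ε
      ≤⟨ ℚ.+-monoˡ-≤ ε (ℚ.neg-antimono-≤ (f′ n N≤n)) ⟩
    ℚ.- approx x n ℚ.+ ε  ∎
    where
    open ℚ.≤-Reasoning
    open +-*-Solver

  -- The approximations of x are eventually bounded by `bound x`, so bringing y and z within ε
  -- divided by that bound brings the products within ε.
  *-congˡ : ∀ x {y z} → y ≃ z → x * y ≃ x * z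
  *-congˡ x {y} {z} (*≃* f) = *≃* λ ε 0<ε →
    let B = bound x
        instance
          pos : ℚ.Positive B
          pos = ℚ.positive (0<bound x)
          nz : ℚ.NonZero B
          nz = ℚ.pos⇒nonZero B
        δ = ε ℚ.* (ℚ.1/ B)
        N , f′ = f δ (Rational.*-pos 0<ε (ℚ.positive⁻¹ (ℚ.1/ B) {{ℚ.1/pos⇒pos B}}))
        K = boundIndex x
    in N ℕ.⊔ K , λ n ≤n →
      let x′ = approx x n ; y′ = approx y n ; z′ = approx z n in begin
      ℚ.∣ x′ ℚ.* y′ ℚ.- x′ ℚ.* z′ ∣
        ≡⟨ cong ℚ.∣_∣ (solve 3 (λ x y z → x :* y :- x :* z := x :* (y :- z)) refl x′ y′ z′) ⟩
      ℚ.∣ x′ ℚ.* (y′ ℚ.- z′) ∣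
        ≡⟨ ℚ.∣p*q∣≡∣p∣*∣q∣ x′ (y′ ℚ.- z′) ⟩
      ℚ.∣ x′ ∣ ℚ.* ℚ.∣ y′ ℚ.- z′ ∣
        ≤⟨ Rational.*-mono-≤ _ _ _ _ (ℚ.0≤∣p∣ (y′ ℚ.- z′)) (ℚ.<⇒≤ (0<bound x))
             (∣approx∣≤bound x n (ℕ.m⊔n≤o⇒n≤o N K ≤n)) (f′ n (ℕ.m⊔n≤o⇒m≤o N K ≤n)) ⟩
      B ℚ.* δ
        ≡⟨ Rational.*-cancel-1/ B ε ⟩
      ε  ∎
    where
    open ℚ.≤-Reasoning
    open +-*-Solver

  *-comm : ∀ x y → x * y ≃ y * x
  *-comm x y = ≃-pointwise λ n → ℚ.*-comm (approx x n) (approx y n)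

  x≤x⊔y : ∀ x y → x ≤ x ⊔ y
  x≤x⊔y x y = ≤-pointwise λ n → ℚ.p≤p⊔q (approx x n) (approx y n)

  x≤y⊔x : ∀ x y → x ≤ y ⊔ x
  x≤y⊔x x y = ≤-pointwise λ n → ℚ.p≤q⊔p (approx y n) (approx x n)

  x⊓y≤x⊔y : ∀ x y → x ⊓ y ≤ x ⊔ y
  x⊓y≤x⊔y x y = ≤-pointwise λ n → ℚ.p⊓q≤p⊔q (approx x n) (approx y n)

  ⊔-lub : ∀ {x y z} → x ≤ z → y ≤ z → x ⊔ y ≤ z
  ⊔-lub (*≤* f) (*≤* g) = *≤* λ ε 0<ε →
    let M , f′ = f ε 0<ε
        N , g′ = g ε 0<ε
    in M ℕ.⊔ N , λ n ≤n → ℚ.⊔-lub (f′ n (ℕ.m⊔n≤o⇒m≤o M N ≤n)) (g′ n (ℕ.m⊔n≤o⇒n≤o M N ≤n))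

  ⊓-glb : ∀ {x y z} → z ≤ x → z ≤ y → z ≤ x ⊓ y
  ⊓-glb {x} {y} (*≤* f) (*≤* g) = *≤* λ ε 0<ε →
    let M , f′ = f ε 0<ε
        N , g′ = g ε 0<ε
    in M ℕ.⊔ N , λ n ≤n → ℚ.≤-trans
      (ℚ.⊓-glb (f′ n (ℕ.m⊔n≤o⇒m≤o M N ≤n)) (g′ n (ℕ.m⊔n≤o⇒n≤o M N ≤n)))
      (ℚ.≤-reflexive (sym (ℚ.mono-≤-distrib-⊓ (ℚ.+-monoˡ-≤ ε) (approx x n) (approx y n))))

+-cong : ∀ {x y u v} → x ≃ y → u ≃ v → x + u ≃ y + v
+-cong h k = ≤-antisym (+-mono-≤ (≃⇒≤ h) (≃⇒≤ k)) (+-mono-≤ (≃⇒≥ h) (≃⇒≥ k))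

-‿cong : ∀ {x y} → x ≃ y → - x ≃ - y
-‿cong h = ≤-antisym (neg-antimono-≤ (≃⇒≥ h)) (neg-antimono-≤ (≃⇒≤ h))

*-cong : ∀ {x y u v} → x ≃ y → u ≃ v → x * u ≃ y * v
*-cong {x} {y} {u} {v} h k = ≃-trans (*-congˡ x k)
  (≃-trans (*-comm x v) (≃-trans (*-congˡ v h) (*-comm v y)))

⊔-cong : ∀ {x y u v} → x ≃ y → u ≃ v → x ⊔ u ≃ y ⊔ v
⊔-cong {x} {y} {u} {v} h k = ≤-antisym
  (⊔-lub (≤-trans (≃⇒≤ h) (x≤x⊔y y v)) (≤-trans (≃⇒≤ k) (x≤y⊔x v y)))
  (⊔-lub (≤-trans (≃⇒≥ h) (x≤x⊔y x u)) (≤-trans (≃⇒≥ k) (x≤y⊔x u x)))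

opaque
  unfolding _+_ _*_ -_ ∣_∣ _⊔_ _⊓_ fromℚ

  private
    assoc⁺ : ∀ x y z → (x + y) + z ≃ x + (y + z)
    assoc⁺ x y z = ≃-pointwise λ n → ℚ.+-assoc (approx x n) (approx y n) (approx z n)

    comm⁺ : ∀ x y → x + y ≃ y + x
    comm⁺ x y = ≃-pointwise λ n → ℚ.+-comm (approx x n) (approx y n)

    identityˡ⁺ : ∀ x → 0ℝ + x ≃ x
    identityˡ⁺ x = ≃-pointwise λ n → ℚ.+-identityˡ (approx x n)

    identityʳ⁺ : ∀ x → x + 0ℝ ≃ x
    identityʳ⁺ x = ≃-pointwise λ n → ℚ.+-identityʳ (approx x n)

    inverseˡ⁺ : ∀ x → - x + x ≃ 0ℝ
    inverseˡ⁺ x = ≃-pointwise λ n → ℚ.+-inverseˡ (approx x n)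

    inverseʳ⁺ : ∀ x → x + - x ≃ 0ℝ
    inverseʳ⁺ x = ≃-pointwise λ n → ℚ.+-inverseʳ (approx x n)

    assoc* : ∀ x y z → (x * y) * z ≃ x * (y * z)
    assoc* x y z = ≃-pointwise λ n → ℚ.*-assoc (approx x n) (approx y n) (approx z n)

    identityˡ* : ∀ x → 1ℝ * x ≃ x
    identityˡ* x = ≃-pointwise λ n → ℚ.*-identityˡ (approx x n)

    identityʳ* : ∀ x → x * 1ℝ ≃ x
    identityʳ* x = ≃-pointwise λ n → ℚ.*-identityʳ (approx x n)

    distribˡ*⁺ : ∀ x y z → x * (y + z) ≃ x * y + x * z
    distribˡ*⁺ x y z = ≃-pointwise λ n → ℚ.*-distribˡ-+ (approx x n) (approx y n) (approx z n)

    distribʳ*⁺ : ∀ x y z → (y + z) * x ≃ y * x + z * x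
    distribʳ*⁺ x y z = ≃-pointwise λ n → ℚ.*-distribʳ-+ (approx x n) (approx y n) (approx z n)

isCommutativeRing : IsCommutativeRing _≃_ _+_ _*_ -_ 0ℝ 1ℝ
isCommutativeRing = record
  { isRing = record
    { +-isAbelianGroup = record
      { isGroup = record
        { isMonoid = record
          { isSemigroup = record
            { isMagma = record
              { isEquivalence = record { refl = ≃-refl ; sym = ≃-sym ; trans = ≃-trans }
              ; ∙-cong = +-cong }
            ; assoc = assoc⁺ }
          ; identity = identityˡ⁺ , identityʳ⁺ }
        ; inverse = inverseˡ⁺ , inverseʳ⁺
        ; ⁻¹-cong = -‿cong }
      ; comm = comm⁺ }
    ; *-cong = *-cong
    ; *-assoc = assoc*
    ; *-identity = identityˡ* , identityʳ*
    ; distrib = distribˡ*⁺ , distribʳ*⁺ }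
  ; *-comm = *-comm }

commutativeRing : CommutativeRing 0ℓ 0ℓ
commutativeRing = record { isCommutativeRing = isCommutativeRing }

open CommutativeRing commutativeRing
  using ( semiring; commutativeSemiring; +-congˡ; +-identityˡ; +-identityʳ; +-assoc
        ; *-identityˡ; *-identityʳ; *-assoc; zeroˡ; zeroʳ; -‿inverseʳ; distribˡ; distribʳ )

-- Absolute values, positive parts and square roots

opaque
  unfolding _+_ _*_ -_ ∣_∣ _⊔_ _⊓_ fromℚ √_

  0≤1 : 0ℝ ≤ 1ℝ
  0≤1 = ≤-pointwise λ _ → ℚ.<⇒≤ 1>0

  0≤⊔0 : ∀ x → 0ℝ ≤ x ⊔ 0ℝ
  0≤⊔0 x = ≤-pointwise λ n → ℚ.p≤q⊔p (approx x n) 0ℚ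

  0≤∣x∣ : ∀ x → 0ℝ ≤ ∣ x ∣
  0≤∣x∣ x = ≤-pointwise λ n → ℚ.0≤∣p∣ (approx x n)

  x≤∣x∣ : ∀ x → x ≤ ∣ x ∣
  x≤∣x∣ x = ≤-pointwise λ n → Rational.p≤∣p∣ (approx x n)

  -x≤∣x∣ : ∀ x → - x ≤ ∣ x ∣
  -x≤∣x∣ x = ≤-pointwise λ n → ℚ.≤-trans (Rational.p≤∣p∣ (ℚ.- approx x n)) (ℚ.≤-reflexive (ℚ.∣-p∣≡∣p∣ (approx x n)))

  ∣∣-homo-* : ∀ x y → ∣ x * y ∣ ≃ ∣ x ∣ * ∣ y ∣
  ∣∣-homo-* x y = ≃-pointwise λ n → ℚ.∣p*q∣≡∣p∣*∣q∣ (approx x n) (approx y n)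

  ∣x+y∣≤∣x∣+∣y∣ : ∀ x y → ∣ x + y ∣ ≤ ∣ x ∣ + ∣ y ∣
  ∣x+y∣≤∣x∣+∣y∣ x y = ≤-pointwise λ n → ℚ.∣p+q∣≤∣p∣+∣q∣ (approx x n) (approx y n)

  ∣0∣≃0 : ∣ 0ℝ ∣ ≃ 0ℝ
  ∣0∣≃0 = ≃-pointwise λ _ → refl

  ∣1∣≃1 : ∣ 1ℝ ∣ ≃ 1ℝ
  ∣1∣≃1 = ≃-pointwise λ _ → refl

  ∣-1∣≃1 : ∣ - 1ℝ ∣ ≃ 1ℝ
  ∣-1∣≃1 = ≃-pointwise λ _ → refl

  -- A nonnegative real may have negative approximations, so a product of nonnegative reals cannot
  -- be treated termwise. Positive parts can, and a nonnegative real equals its positive part.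
  0≤⊔0*⊔0 : ∀ x y → 0ℝ ≤ (x ⊔ 0ℝ) * (y ⊔ 0ℝ)
  0≤⊔0*⊔0 x y = ≤-pointwise λ n → Rational.*-mono-≤ 0ℚ (approx x n ℚ.⊔ 0ℚ) 0ℚ (approx y n ℚ.⊔ 0ℚ)
    ℚ.≤-refl (ℚ.p≤q⊔p (approx x n) 0ℚ) (ℚ.p≤q⊔p (approx x n) 0ℚ) (ℚ.p≤q⊔p (approx y n) 0ℚ)

  -- Stands in for a case distinction on the sign of x: an upper bound on `∣ x ∣` may be shown for
  -- the positive and the negative part separately.
  ∣x∣-cases : ∀ x → ∣ x ∣ ≃ (x ⊔ 0ℝ) ⊔ (- x ⊔ 0ℝ)
  ∣x∣-cases x = ≃-pointwise λ n → lemma (approx x n)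
    where
    lemma : ∀ p → ℚ.∣ p ∣ ≡ (p ℚ.⊔ 0ℚ) ℚ.⊔ (ℚ.- p ℚ.⊔ 0ℚ)
    lemma p = ℚ.≤-antisym (≤∣∣ (ℚ.∣p∣≡p∨∣p∣≡-p p))
      (ℚ.⊔-lub (ℚ.⊔-lub (Rational.p≤∣p∣ p) (ℚ.0≤∣p∣ p))
        (ℚ.⊔-lub (ℚ.≤-trans (Rational.p≤∣p∣ (ℚ.- p)) (ℚ.≤-reflexive (ℚ.∣-p∣≡∣p∣ p))) (ℚ.0≤∣p∣ p)))
      where
      ≤∣∣ : ℚ.∣ p ∣ ≡ p ⊎ ℚ.∣ p ∣ ≡ ℚ.- p → ℚ.∣ p ∣ ℚ.≤ (p ℚ.⊔ 0ℚ) ℚ.⊔ (ℚ.- p ℚ.⊔ 0ℚ)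
      ≤∣∣ (inj₁ eq) = ℚ.≤-trans (ℚ.≤-reflexive eq) (ℚ.≤-trans (ℚ.p≤p⊔q p 0ℚ) (ℚ.p≤p⊔q _ _))
      ≤∣∣ (inj₂ eq) = ℚ.≤-trans (ℚ.≤-reflexive eq) (ℚ.≤-trans (ℚ.p≤p⊔q (ℚ.- p) 0ℚ) (ℚ.p≤q⊔p (p ℚ.⊔ 0ℚ) _))

  -- Beyond the opaque block products and roots no longer reduce; this equation and the next record
  -- their approximations.
  approx-* : ∀ x y n → approx (x * y) n ≡ approx x n ℚ.* approx y n
  approx-* x y n = refl

  approx-√ : ∀ x n → approx (√ x) n ≡ Rational.root n (approx x n ℚ.⊔ 0ℚ)
  approx-√ x n = refl

-- The grid search falls short by less than one step s, so q < (r + s)² = r² + (2r + s)s. The bound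
-- b on r and s ≤ 1 make the excess linear in the step.
root-gap : ∀ n q {b δ} → 0ℚ ℚ.≤ b → Rational.root n q ℚ.≤ b → Rational.step n ℚ.≤ δ →
           q ℚ.≤ Rational.root n q ℚ.* Rational.root n q ℚ.+ (b ℚ.+ b ℚ.+ 1ℚ) ℚ.* δ
root-gap n q {b} {δ} 0≤b r≤b s≤δ = begin
  q                                  ≤⟨ ℚ.<⇒≤ (Rational.root-upper n q) ⟩
  (r ℚ.+ s) ℚ.* (r ℚ.+ s)            ≡⟨ solve 2 (λ r s → (r :+ s) :* (r :+ s) := r :* r :+ (r :+ r :+ s) :* s) refl r s ⟩
  r ℚ.* r ℚ.+ (r ℚ.+ r ℚ.+ s) ℚ.* s
    ≤⟨ ℚ.+-monoʳ-≤ (r ℚ.* r) (Rational.*-mono-≤ _ _ _ _ (ℚ.<⇒≤ (Rational.0<step n))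
         (ℚ.+-mono-≤ (ℚ.+-mono-≤ 0≤b 0≤b) (ℚ.<⇒≤ 1>0))
         (ℚ.+-mono-≤ (ℚ.+-mono-≤ r≤b r≤b) step≤1) s≤δ) ⟩
  r ℚ.* r ℚ.+ (b ℚ.+ b ℚ.+ 1ℚ) ℚ.* δ  ∎
  where
  open ℚ.≤-Reasoning
  open +-*-Solver
  r = Rational.root n q
  s = Rational.step n
  step≤1 : Rational.step n ℚ.≤ 1ℚ
  step≤1 = ℚ.*≤* (ℤ.+≤+ (ℕ.s≤s ℕ.z≤n))

-- The direction in which a sum of squares is bounded by the square of `‖_‖₂`. Since `bound (√ x)`
-- controls the roots from some index on, a step of at most ε / B suffices.
x≤√x*√x : ∀ x → x ≤ √ x * √ x
x≤√x*√x x = *≤* λ ε 0<ε →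
  let N , st = Rational.step≤ (Rational.*-pos 0<ε (ℚ.positive⁻¹ (ℚ.1/ B) {{ℚ.1/pos⇒pos B}}))
      K = boundIndex (√ x)
  in N ℕ.⊔ K , λ n ≤n → begin
    approx x n
      ≤⟨ ℚ.p≤p⊔q (approx x n) 0ℚ ⟩
    approx x n ℚ.⊔ 0ℚ
      ≤⟨ root-gap n (approx x n ℚ.⊔ 0ℚ) 0≤b
           (subst (ℚ._≤ bound (√ x)) (approx-√ x n)
             (ℚ.≤-trans (Rational.p≤∣p∣ (approx (√ x) n)) (∣approx∣≤bound (√ x) n (ℕ.m⊔n≤o⇒n≤o N K ≤n))))
           (st n (ℕ.m⊔n≤o⇒m≤o N K ≤n)) ⟩
    Rational.root n (approx x n ℚ.⊔ 0ℚ) ℚ.* Rational.root n (approx x n ℚ.⊔ 0ℚ) ℚ.+ B ℚ.* (ε ℚ.* (ℚ.1/ B))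
      ≡⟨ cong₂ ℚ._+_ (sym (trans (approx-* (√ x) (√ x) n) (cong (λ r → r ℚ.* r) (approx-√ x n))))
                     (Rational.*-cancel-1/ B ε) ⟩
    approx (√ x * √ x) n ℚ.+ ε  ∎
  where
  open ℚ.≤-Reasoning
  B : ℚ
  B = bound (√ x) ℚ.+ bound (√ x) ℚ.+ 1ℚ
  0≤b : 0ℚ ℚ.≤ bound (√ x)
  0≤b = ℚ.<⇒≤ (0<bound (√ x))
  instance
    B-positive : ℚ.Positive B
    B-positive = ℚ.positive (ℚ.+-mono-≤-< (ℚ.+-mono-≤ 0≤b 0≤b) 1>0)
    B-nonZero : ℚ.NonZero B
    B-nonZero = ℚ.pos⇒nonZero B

0≤x⇒x⊔0≃x : ∀ {x} → 0ℝ ≤ x → x ⊔ 0ℝ ≃ x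
0≤x⇒x⊔0≃x {x} 0≤x = ≤-antisym (⊔-lub ≤-refl 0≤x) (x≤x⊔y x 0ℝ)

*-nonNeg : ∀ {x y} → 0ℝ ≤ x → 0ℝ ≤ y → 0ℝ ≤ x * y
*-nonNeg {x} {y} 0≤x 0≤y = ≤-trans (0≤⊔0*⊔0 x y) (≃⇒≤ (*-cong (0≤x⇒x⊔0≃x 0≤x) (0≤x⇒x⊔0≃x 0≤y)))

open import Algebra.Properties.Semiring.Sum semiring using (∑-distrib-+; ∑-comm; *-distribˡ-sum; *-distribʳ-sum)
open import Algebra.Properties.Semiring.Exp semiring using (^-congˡ; ^-assocʳ)
open import Algebra.Properties.CommutativeSemiring.Exp commutativeSemiring using (^-distrib-*)
module Solver = NaturalCoefficientsSolver commutativeSemiring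
open import Relation.Binary.Reasoning.PartialOrder ≤-poset

-- Finite sums, products and indicators

∑-cong : ∀ {n} {f g : Fin n → ℝ} → (∀ i → f i ≃ g i) → sum f ≃ sum g
∑-cong {zero}  h = ≃-refl
∑-cong {suc n} h = +-cong (h zero) (∑-cong λ i → h (suc i))

∑-mono : ∀ {n} {f g : Fin n → ℝ} → (∀ i → f i ≤ g i) → sum f ≤ sum g
∑-mono {zero}  h = ≤-refl
∑-mono {suc n} h = +-mono-≤ (h zero) (∑-mono λ i → h (suc i))

∑-zero : ∀ {n} {f : Fin n → ℝ} → (∀ i → f i ≃ 0ℝ) → sum f ≃ 0ℝ
∑-zero {zero}  h = ≃-refl
∑-zero {suc n} h = ≃-trans (+-cong (h zero) (∑-zero λ i → h (suc i))) (+-identityˡ 0ℝ)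

∏-cong : ∀ {n} {f g : Fin n → ℝ} → (∀ i → f i ≃ g i) → product f ≃ product g
∏-cong {zero}  h = ≃-refl
∏-cong {suc n} h = *-cong (h zero) (∏-cong λ i → h (suc i))

≃-reflexive : ∀ {x y} → x ≡ y → x ≃ y
≃-reflexive refl = ≃-refl

0≤y-x : ∀ {x y} → x ≤ y → 0ℝ ≤ y + - x
0≤y-x {x} {y} x≤y = begin
  0ℝ        ≈⟨ -‿inverseʳ x ⟨
  x + - x   ≤⟨ +-mono-≤ x≤y ≤-refl ⟩
  y + - x   ∎

y≃x+[y-x] : ∀ x y → y ≃ x + (y + - x)
y≃x+[y-x] x y = begin-equality
  y                ≈⟨ +-identityʳ y ⟨
  y + 0ℝ           ≈⟨ +-congˡ (-‿inverseʳ x) ⟨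
  y + (x + - x)    ≈⟨ Solver.solve 3 (λ x y z → y :+ (x :+ z) := x :+ (y :+ z)) ≃-refl x y (- x) ⟩
  x + (y + - x)    ∎
  where open Solver

*-monoʳ-≤ : ∀ {x y z} → 0ℝ ≤ x → y ≤ z → x * y ≤ x * z
*-monoʳ-≤ {x} {y} {z} 0≤x y≤z = begin
  x * y                    ≈⟨ +-identityʳ _ ⟨
  x * y + 0ℝ               ≤⟨ +-mono-≤ ≤-refl (*-nonNeg 0≤x (0≤y-x y≤z)) ⟩
  x * y + x * (z + - y)    ≈⟨ distribˡ x y (z + - y) ⟨
  x * (y + (z + - y))      ≈⟨ *-congˡ x (y≃x+[y-x] y z) ⟨
  x * z                    ∎

*-monoˡ-≤ : ∀ {x y z} → 0ℝ ≤ z → x ≤ y → x * z ≤ y * z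
*-monoˡ-≤ {x} {y} {z} 0≤z x≤y = begin
  x * z   ≈⟨ *-comm x z ⟩
  z * x   ≤⟨ *-monoʳ-≤ 0≤z x≤y ⟩
  z * y   ≈⟨ *-comm z y ⟩
  y * z   ∎

*-mono-≤ : ∀ {x y u v} → 0ℝ ≤ x → 0ℝ ≤ v → x ≤ y → u ≤ v → x * u ≤ y * v
*-mono-≤ 0≤x 0≤v x≤y u≤v = ≤-trans (*-monoʳ-≤ 0≤x u≤v) (*-monoˡ-≤ 0≤v x≤y)

+-nonNeg : ∀ {x y} → 0ℝ ≤ x → 0ℝ ≤ y → 0ℝ ≤ x + y
+-nonNeg 0≤x 0≤y = ≤-trans (≃⇒≥ (+-identityˡ 0ℝ)) (+-mono-≤ 0≤x 0≤y)

∑-nonNeg : ∀ {n} {f : Fin n → ℝ} → (∀ i → 0ℝ ≤ f i) → 0ℝ ≤ sum f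
∑-nonNeg {zero}  h = ≤-refl
∑-nonNeg {suc n} h = +-nonNeg (h zero) (∑-nonNeg (h ∘ suc))

^-nonNeg : ∀ {x} n → 0ℝ ≤ x → 0ℝ ≤ x ^ n
^-nonNeg zero    0≤x = 0≤1
^-nonNeg (suc n) 0≤x = *-nonNeg 0≤x (^-nonNeg n 0≤x)

∏-one : ∀ n → product {n} (λ _ → 1ℝ) ≃ 1ℝ
∏-one zero    = ≃-refl
∏-one (suc n) = ≃-trans (*-identityˡ _) (∏-one n)

∏-nonempty-zero : ∀ {n} {f : Fin (suc n) → ℝ} → f zero ≃ 0ℝ → product f ≃ 0ℝ
∏-nonempty-zero h = ≃-trans (*-cong h ≃-refl) (zeroˡ _)

𝟙 : Bool → ℝ
𝟙 b = if b then 1ℝ else 0ℝ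

𝟙-∧ : ∀ a b → 𝟙 (a ∧ b) ≃ 𝟙 a * 𝟙 b
𝟙-∧ true  b = ≃-sym (*-identityˡ (𝟙 b))
𝟙-∧ false b = ≃-sym (zeroˡ (𝟙 b))

𝟙*-select : ∀ b x → 𝟙 b * x ≃ (if b then x else 0ℝ)
𝟙*-select true  x = *-identityˡ x
𝟙*-select false x = zeroˡ x

δ : ∀ {n} → Fin n → Fin n → ℝ
δ i j = 𝟙 ⌊ i Fin.≟ j ⌋

δ-refl : ∀ {n} (i : Fin n) → δ i i ≡ 1ℝ
δ-refl i with i Fin.≟ i
... | yes _  = refl
... | no i≢i = contradiction refl i≢i

δ-≢ : ∀ {n} {i j : Fin n} → i ≢ j → δ i j ≡ 0ℝ
δ-≢ {i = i} {j} i≢j with i Fin.≟ j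
... | yes i≡j = contradiction i≡j i≢j
... | no _    = refl

δ-suc : ∀ {n} (i j : Fin n) → δ (suc i) (suc j) ≡ δ i j
δ-suc i j with i Fin.≟ j
... | yes _ = refl
... | no  _ = refl

∑-δ : ∀ {n} (j : Fin n) (f : Fin n → ℝ) → sum (λ i → δ j i * f i) ≃ f j
∑-δ zero f = begin-equality
  1ℝ * f zero + sum (λ i → 0ℝ * f (suc i))   ≈⟨ +-cong (*-identityˡ _) (∑-zero {f = λ i → 0ℝ * f (suc i)} λ i → zeroˡ (f (suc i))) ⟩
  f zero + 0ℝ                                ≈⟨ +-identityʳ _ ⟩
  f zero                                     ∎
∑-δ (suc j) f = begin-equality
  0ℝ * f zero + sum (λ i → δ (suc j) (suc i) * f (suc i))
    ≈⟨ +-cong (zeroˡ _) (∑-cong λ i → *-cong (≃-reflexive (δ-suc j i)) ≃-refl) ⟩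
  0ℝ + sum (λ i → δ j i * f (suc i))
    ≈⟨ +-identityˡ _ ⟩
  sum (λ i → δ j i * f (suc i))
    ≈⟨ ∑-δ j (f ∘ suc) ⟩
  f (suc j)  ∎

-- Functions on finite types

record Finite (A : Set) : Set where
  field
    size          : ℕ
    encode        : A → Fin size
    decode        : Fin size → A
    decode-encode : ∀ a → decode (encode a) ≡ a

  -- Exhibits f as a combination of indicators of the events that the code of a is i. Codes outside
  -- the image of `encode` have indicator zero, so a retraction of `Fin size` onto A is enough
  -- structure.
  expand : ∀ (f : A → ℝ) a → f a ≃ sum λ i → δ (encode a) i * f (decode i)
  expand f a = ≃-trans (≃-reflexive (cong f (sym (decode-encode a))))
                       (≃-sym (∑-δ (encode a) (f ∘ decode)))

Fin-finite : ∀ n → Finite (Fin n)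
Fin-finite n = record { size = n ; encode = λ i → i ; decode = λ i → i ; decode-encode = λ _ → refl }

Sign-finite : Finite Sign
Sign-finite = record { size = 2 ; encode = enc ; decode = dec ; decode-encode = dec-enc }
  where
  enc : Sign → Fin 2
  enc Sign.+ = zero
  enc Sign.- = suc zero
  dec : Fin 2 → Sign
  dec zero    = Sign.+
  dec (suc _) = Sign.-
  dec-enc : ∀ s → dec (enc s) ≡ s
  dec-enc Sign.+ = refl
  dec-enc Sign.- = refl

×-finite : ∀ {A B} → Finite A → Finite B → Finite (A × B)
×-finite F G = record
  { size   = F.size ℕ.* G.size
  ; encode = λ (a , b) → combine (F.encode a) (G.encode b)
  ; decode = decode′ ∘ remQuot G.size
  ; decode-encode = λ (a , b) → trans (cong decode′ (Fin.remQuot-combine (F.encode a) (G.encode b)))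
                                      (cong₂ _,_ (F.decode-encode a) (G.decode-encode b)) }
  where
  module F = Finite F
  module G = Finite G
  decode′ : Fin F.size × Fin G.size → _
  decode′ (i , j) = F.decode i , G.decode j

Vec-finite : ∀ {A} → Finite A → ∀ d → Finite (Vec A d)
Vec-finite F d = record
  { size   = F.size ℕ.^ d
  ; encode = λ u → funToFin (F.encode ∘ Vec.lookup u)
  ; decode = λ i → Vec.tabulate (F.decode ∘ finToFun i)
  ; decode-encode = λ u → trans
      (Vec.tabulate-cong λ l → trans (cong F.decode (Fin.finToFun-funToFin (F.encode ∘ Vec.lookup u) l))
                                     (F.decode-encode (Vec.lookup u l)))
      (Vec.tabulate∘lookup u) }
  where module F = Finite F

-- The elementary symmetric polynomial of degree k, split by whether the head is among the chosen
-- entries; this recursion lets independent variables be peeled off one at a time.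
e : ∀ {n} → ℕ → Vec ℝ n → ℝ
e zero    xs       = 1ℝ
e (suc k) []       = 0ℝ
e (suc k) (x ∷ xs) = x * e k xs + e (suc k) xs

-- Expectation and independence

module Expectation (P : FiniteProbabilitySpace) where
  open FiniteProbabilitySpace P

  𝔼-cong : {X Y : Ω → ℝ} → (∀ ω → X ω ≃ Y ω) → 𝔼 X ≃ 𝔼 Y
  𝔼-cong h = ∑-cong λ ω → *-congˡ (weight ω) (h ω)

  𝔼-mono : {X Y : Ω → ℝ} → (∀ ω → X ω ≤ Y ω) → 𝔼 X ≤ 𝔼 Y
  𝔼-mono h = ∑-mono λ ω → *-monoʳ-≤ (0≤weight ω) (h ω)

  𝔼-const : ∀ c → 𝔼 (λ _ → c) ≃ c
  𝔼-const c = begin-equality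
    sum (λ ω → weight ω * c)   ≈⟨ *-distribʳ-sum c weight ⟨
    sum weight * c             ≈⟨ *-cong total ≃-refl ⟩
    1ℝ * c                     ≈⟨ *-identityˡ c ⟩
    c                          ∎

  𝔼-+ : (X Y : Ω → ℝ) → 𝔼 (λ ω → X ω + Y ω) ≃ 𝔼 X + 𝔼 Y
  𝔼-+ X Y = ≃-trans (∑-cong λ ω → distribˡ (weight ω) (X ω) (Y ω)) (∑-distrib-+ (λ ω → weight ω * X ω) (λ ω → weight ω * Y ω))

  𝔼-*ˡ : ∀ c (X : Ω → ℝ) → 𝔼 (λ ω → c * X ω) ≃ c * 𝔼 X
  𝔼-*ˡ c X = ≃-sym (≃-trans (*-distribˡ-sum c λ ω → weight ω * X ω)
    (∑-cong λ ω → Solver.solve 3 (λ c w x → c :* (w :* x) := w :* (c :* x)) ≃-refl c (weight ω) (X ω)))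
    where open Solver

  𝔼-∑ : ∀ {n} (X : Fin n → Ω → ℝ) → 𝔼 (λ ω → sum λ i → X i ω) ≃ sum λ i → 𝔼 (X i)
  𝔼-∑ X = ≃-trans (∑-cong λ ω → *-distribˡ-sum (weight ω) λ i → X i ω) (∑-comm λ ω i → weight ω * X i ω)

  𝔼-nonNeg : {X : Ω → ℝ} → (∀ ω → 0ℝ ≤ X ω) → 0ℝ ≤ 𝔼 X
  𝔼-nonNeg h = ≤-trans (≃⇒≥ (𝔼-const 0ℝ)) (𝔼-mono h)

  -- Indicators of events span the functions on a finite type.
  extend : ∀ {A} → Finite A → (W : Ω → ℝ) (Y : Ω → A) (c : ℝ) →
           (∀ B → 𝔼 (λ ω → W ω * 𝟙 (B (Y ω))) ≃ c * ℙ (B ∘ Y)) →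
           ∀ f → 𝔼 (λ ω → W ω * f (Y ω)) ≃ c * 𝔼 (f ∘ Y)
  extend F W Y c h f = begin-equality
    𝔼 (λ ω → W ω * f (Y ω))
      ≈⟨ 𝔼-cong (λ ω → ≃-trans (*-congˡ (W ω) (expand f (Y ω)))
           (≃-trans (*-distribˡ-sum (W ω) (λ i → δ (encode (Y ω)) i * f (decode i)))
             (∑-cong λ i → Solver.solve 3 (λ w b y → w :* (b :* y) := y :* (w :* b)) ≃-refl (W ω) (δ (encode (Y ω)) i) (f (decode i))))) ⟩
    𝔼 (λ ω → sum λ i → f (decode i) * (W ω * δ (encode (Y ω)) i))
      ≈⟨ 𝔼-∑ (λ i ω → f (decode i) * (W ω * δ (encode (Y ω)) i)) ⟩
    sum (λ i → 𝔼 (λ ω → f (decode i) * (W ω * δ (encode (Y ω)) i)))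
      ≈⟨ ∑-cong (λ i → ≃-trans (𝔼-*ˡ (f (decode i)) (λ ω → W ω * δ (encode (Y ω)) i))
           (≃-trans (*-congˡ (f (decode i)) (h λ a → ⌊ encode a Fin.≟ i ⌋))
             (Solver.solve 3 (λ y c p → y :* (c :* p) := c :* (y :* p)) ≃-refl (f (decode i)) c (𝔼 λ ω → δ (encode (Y ω)) i)))) ⟩
    sum (λ i → c * (f (decode i) * 𝔼 (λ ω → δ (encode (Y ω)) i)))
      ≈⟨ *-distribˡ-sum c (λ i → f (decode i) * 𝔼 (λ ω → δ (encode (Y ω)) i)) ⟨
    c * sum (λ i → f (decode i) * 𝔼 (λ ω → δ (encode (Y ω)) i))
      ≈⟨ *-congˡ c (∑-cong λ i → 𝔼-*ˡ (f (decode i)) (λ ω → δ (encode (Y ω)) i)) ⟨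
    c * sum (λ i → 𝔼 (λ ω → f (decode i) * δ (encode (Y ω)) i))
      ≈⟨ *-congˡ c (𝔼-∑ (λ i ω → f (decode i) * δ (encode (Y ω)) i)) ⟨
    c * 𝔼 (λ ω → sum λ i → f (decode i) * δ (encode (Y ω)) i)
      ≈⟨ *-congˡ c (𝔼-cong λ ω → ≃-trans (∑-cong λ i → *-comm (f (decode i)) (δ (encode (Y ω)) i)) (≃-sym (expand f (Y ω)))) ⟩
    c * 𝔼 (f ∘ Y)  ∎
    where
    open Finite F
    open Solver

  -- `Y ⊥ Z` speaks of pairs of events. `extend` passes from indicators to functions in one variable
  -- at a time, with the other variable in the weight.
  ⊥⇒𝔼-* : ∀ {A B} → Finite A → Finite B → (Y : Ω → A) (Z : Ω → B) → Y ⊥ Z →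
          ∀ f g → 𝔼 (λ ω → f (Y ω) * g (Z ω)) ≃ 𝔼 (f ∘ Y) * 𝔼 (g ∘ Z)
  ⊥⇒𝔼-* F G Y Z Y⊥Z f g = extend G (f ∘ Y) Z (𝔼 (f ∘ Y)) (λ D → begin-equality
    𝔼 (λ ω → f (Y ω) * 𝟙 (D (Z ω)))
      ≈⟨ 𝔼-cong (λ ω → *-comm (f (Y ω)) (𝟙 (D (Z ω)))) ⟩
    𝔼 (λ ω → 𝟙 (D (Z ω)) * f (Y ω))
      ≈⟨ extend F (λ ω → 𝟙 (D (Z ω))) Y (ℙ (D ∘ Z)) (λ C → begin-equality
           𝔼 (λ ω → 𝟙 (D (Z ω)) * 𝟙 (C (Y ω)))
             ≈⟨ 𝔼-cong (λ ω → ≃-trans (*-comm (𝟙 (D (Z ω))) (𝟙 (C (Y ω)))) (≃-sym (𝟙-∧ (C (Y ω)) (D (Z ω))))) ⟩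
           ℙ (λ ω → C (Y ω) ∧ D (Z ω))
             ≈⟨ Y⊥Z C D ⟩
           ℙ (C ∘ Y) * ℙ (D ∘ Z)
             ≈⟨ *-comm (ℙ (C ∘ Y)) (ℙ (D ∘ Z)) ⟩
           ℙ (D ∘ Z) * ℙ (C ∘ Y)  ∎) f ⟩
    ℙ (D ∘ Z) * 𝔼 (f ∘ Y)
      ≈⟨ *-comm (ℙ (D ∘ Z)) (𝔼 (f ∘ Y)) ⟩
    𝔼 (f ∘ Y) * ℙ (D ∘ Z)  ∎) g

  -- The weight W holds the factors already split off, and c is its expectation. Carrying both along
  -- keeps the joint independence of those factors and the remaining variables through an induction
  -- on n.
  Factors : ∀ {A : Set} {n} → (Ω → ℝ) → ℝ → (Fin n → Ω → A) → Set
  Factors {A} {n} W c Y = (f : Fin n → A → ℝ) →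
    𝔼 (λ ω → W ω * product λ i → f i (Y i ω)) ≃ c * product λ i → 𝔼 (f i ∘ Y i)

  -- Variables turn from events to functions one at a time: `extend` frees the head while the others
  -- are still indicators, after which the head joins the weight and the hypothesis holds for the
  -- tail.
  factors : ∀ {A n} → Finite A → (W : Ω → ℝ) (c : ℝ) (Y : Fin n → Ω → A) →
            (∀ (B : Fin n → A → Bool) → 𝔼 (λ ω → W ω * 𝟙 (Vector.foldr _∧_ true λ i → B i (Y i ω))) ≃ c * product λ i → ℙ (B i ∘ Y i)) →
            Factors W c Y
  factors {n = zero}  F W c Y h f = h λ ()
  factors {A} {suc n} F W c Y h f = begin-equality
    𝔼 (λ ω → W ω * (f zero (Y zero ω) * product λ i → f (suc i) (Y (suc i) ω)))
      ≈⟨ 𝔼-cong (λ ω → *-assoc (W ω) (f zero (Y zero ω)) (product λ i → f (suc i) (Y (suc i) ω))) ⟨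
    𝔼 (λ ω → W ω * f zero (Y zero ω) * product λ i → f (suc i) (Y (suc i) ω))
      ≈⟨ factors F (λ ω → W ω * f zero (Y zero ω)) (c * 𝔼 (f zero ∘ Y zero)) (Y ∘ suc) step (f ∘ suc) ⟩
    c * 𝔼 (f zero ∘ Y zero) * product (λ i → 𝔼 (f (suc i) ∘ Y (suc i)))
      ≈⟨ *-assoc c (𝔼 (f zero ∘ Y zero)) (product (λ i → 𝔼 (f (suc i) ∘ Y (suc i)))) ⟩
    c * (𝔼 (f zero ∘ Y zero) * product (λ i → 𝔼 (f (suc i) ∘ Y (suc i))))  ∎
    where
    open Solver
    all : (Fin n → A → Bool) → Ω → Bool
    all B ω = Vector.foldr _∧_ true λ i → B i (Y (suc i) ω)
    probs : (Fin n → A → Bool) → ℝ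
    probs B = product λ i → ℙ (B i ∘ Y (suc i))
    cons : (A → Bool) → (Fin n → A → Bool) → Fin (suc n) → A → Bool
    cons B₀ B zero    = B₀
    cons B₀ B (suc i) = B i
    step : ∀ (B : Fin n → A → Bool) → 𝔼 (λ ω → W ω * f zero (Y zero ω) * 𝟙 (all B ω)) ≃ c * 𝔼 (f zero ∘ Y zero) * probs B
    step B = begin-equality
      𝔼 (λ ω → W ω * f zero (Y zero ω) * 𝟙 (all B ω))
        ≈⟨ 𝔼-cong (λ ω → solve 3 (λ w x b → w :* x :* b := w :* b :* x) ≃-refl (W ω) (f zero (Y zero ω)) (𝟙 (all B ω))) ⟩
      𝔼 (λ ω → W ω * 𝟙 (all B ω) * f zero (Y zero ω))
        ≈⟨ extend F (λ ω → W ω * 𝟙 (all B ω)) (Y zero) (c * probs B) (λ B₀ → begin-equality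
             𝔼 (λ ω → W ω * 𝟙 (all B ω) * 𝟙 (B₀ (Y zero ω)))
               ≈⟨ 𝔼-cong (λ ω → ≃-trans
                    (solve 3 (λ w x b → w :* x :* b := w :* (b :* x)) ≃-refl (W ω) (𝟙 (all B ω)) (𝟙 (B₀ (Y zero ω))))
                    (*-congˡ (W ω) (≃-sym (𝟙-∧ (B₀ (Y zero ω)) (all B ω))))) ⟩
             𝔼 (λ ω → W ω * 𝟙 (B₀ (Y zero ω) ∧ all B ω))
               ≈⟨ h (cons B₀ B) ⟩
             c * (ℙ (B₀ ∘ Y zero) * probs B)
               ≈⟨ solve 3 (λ c p q → c :* (p :* q) := c :* q :* p) ≃-refl c (ℙ (B₀ ∘ Y zero)) (probs B) ⟩
             c * probs B * ℙ (B₀ ∘ Y zero)  ∎) (f zero) ⟩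
      c * probs B * 𝔼 (f zero ∘ Y zero)
        ≈⟨ solve 3 (λ c q x → c :* q :* x := c :* x :* q) ≃-refl c (probs B) (𝔼 (f zero ∘ Y zero)) ⟩
      c * 𝔼 (f zero ∘ Y zero) * probs B  ∎

  independent⇒factors : ∀ {A n} → Finite A → (Y : Fin n → Ω → A) → Independent Y → Factors (λ _ → 1ℝ) 1ℝ Y
  independent⇒factors F Y ind = factors F (λ _ → 1ℝ) 1ℝ Y λ B →
    ≃-trans (𝔼-cong λ ω → *-identityˡ _) (≃-trans (ind B) (≃-sym (*-identityˡ _)))

  independent⇒𝔼-∏ : ∀ {A n} → Finite A → (Y : Fin n → Ω → A) → Independent Y → (f : Fin n → A → ℝ) →
                    𝔼 (λ ω → product λ i → f i (Y i ω)) ≃ product λ i → 𝔼 (f i ∘ Y i)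
  independent⇒𝔼-∏ F Y ind f = ≃-trans (𝔼-cong λ ω → ≃-sym (*-identityˡ _))
    (≃-trans (independent⇒factors F Y ind f) (*-identityˡ _))

  factors-𝔼-weight : ∀ {A n W c} (Y : Fin n → Ω → A) → Factors W c Y → 𝔼 W ≃ c
  factors-𝔼-weight {n = n} {W} {c} Y H = begin-equality
    𝔼 W                                        ≈⟨ 𝔼-cong (λ ω → ≃-trans (*-congˡ (W ω) (∏-one n)) (*-identityʳ (W ω))) ⟨
    𝔼 (λ ω → W ω * product {n} λ _ → 1ℝ)       ≈⟨ H (λ _ _ → 1ℝ) ⟩
    c * product {n} (λ _ → 𝔼 λ _ → 1ℝ)         ≈⟨ *-congˡ c (≃-trans (∏-cong {n} λ _ → 𝔼-const 1ℝ) (∏-one n)) ⟩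
    c * 1ℝ                                     ≈⟨ *-identityʳ c ⟩
    c                                          ∎

  factors-scale : ∀ {A n W c} (Y : Fin (suc n) → Ω → A) → Factors W c Y → ∀ g →
                  Factors (λ ω → W ω * g (Y zero ω)) (c * 𝔼 (g ∘ Y zero)) (Y ∘ suc)
  factors-scale {A} {n} {W} {c} Y H g f = begin-equality
    𝔼 (λ ω → W ω * g (Y zero ω) * product λ i → f i (Y (suc i) ω))
      ≈⟨ 𝔼-cong (λ ω → *-assoc (W ω) _ _) ⟩
    𝔼 (λ ω → W ω * (g (Y zero ω) * product λ i → f i (Y (suc i) ω)))
      ≈⟨ H (λ { zero → g ; (suc i) → f i }) ⟩
    c * (𝔼 (g ∘ Y zero) * product (λ i → 𝔼 (f i ∘ Y (suc i))))
      ≈⟨ *-assoc c _ _ ⟨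
    c * 𝔼 (g ∘ Y zero) * product (λ i → 𝔼 (f i ∘ Y (suc i)))  ∎

  factors-tail : ∀ {A n W c} (Y : Fin (suc n) → Ω → A) → Factors W c Y → Factors W c (Y ∘ suc)
  factors-tail {A} {n} {W} {c} Y H f = begin-equality
    𝔼 (λ ω → W ω * product λ i → f i (Y (suc i) ω))
      ≈⟨ 𝔼-cong (λ ω → *-cong (*-identityʳ (W ω)) ≃-refl) ⟨
    𝔼 (λ ω → W ω * 1ℝ * product λ i → f i (Y (suc i) ω))
      ≈⟨ factors-scale Y H (λ _ → 1ℝ) f ⟩
    c * 𝔼 (λ _ → 1ℝ) * product (λ i → 𝔼 (f i ∘ Y (suc i)))
      ≈⟨ *-cong (≃-trans (*-congˡ c (𝔼-const 1ℝ)) (*-identityʳ c)) ≃-refl ⟩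
    c * product (λ i → 𝔼 (f i ∘ Y (suc i)))  ∎

  -- `e` has degree at most one in each variable. Along its recursion the head either enters the
  -- weight or is replaced by the constant 1, and in both cases the tail still factors.
  factors-e : ∀ {A n W c} (Y : Fin n → Ω → A) → Factors W c Y → ∀ k (f : Fin n → A → ℝ) →
              𝔼 (λ ω → W ω * e k (Vec.tabulate λ i → f i (Y i ω))) ≃ c * e k (Vec.tabulate λ i → 𝔼 (f i ∘ Y i))
  factors-e {W = W} {c} Y H zero f = ≃-trans (𝔼-cong λ ω → *-identityʳ (W ω))
    (≃-trans (factors-𝔼-weight Y H) (≃-sym (*-identityʳ c)))
  factors-e {n = zero} {W} {c} Y H (suc k) f = ≃-trans (𝔼-cong λ ω → zeroʳ (W ω))
    (≃-trans (𝔼-const 0ℝ) (≃-sym (zeroʳ c)))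
  factors-e {n = suc n} {W} {c} Y H (suc k) f = begin-equality
    𝔼 (λ ω → W ω * (x ω * e k (xs ω) + e (suc k) (xs ω)))
      ≈⟨ 𝔼-cong (λ ω → solve 4 (λ w x p q → w :* (x :* p :+ q) := w :* x :* p :+ w :* q) ≃-refl (W ω) (x ω) (e k (xs ω)) (e (suc k) (xs ω))) ⟩
    𝔼 (λ ω → W ω * x ω * e k (xs ω) + W ω * e (suc k) (xs ω))
      ≈⟨ 𝔼-+ (λ ω → W ω * x ω * e k (xs ω)) (λ ω → W ω * e (suc k) (xs ω)) ⟩
    𝔼 (λ ω → W ω * x ω * e k (xs ω)) + 𝔼 (λ ω → W ω * e (suc k) (xs ω))
      ≈⟨ +-cong (factors-e (Y ∘ suc) (factors-scale Y H (f zero)) k (f ∘ suc)) (factors-e (Y ∘ suc) (factors-tail Y H) (suc k) (f ∘ suc)) ⟩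
    c * 𝔼 x * e k ys + c * e (suc k) ys
      ≈⟨ solve 4 (λ c x p q → c :* x :* p :+ c :* q := c :* (x :* p :+ q)) ≃-refl c (𝔼 x) (e k ys) (e (suc k) ys) ⟩
    c * (𝔼 x * e k ys + e (suc k) ys)  ∎
    where
    open Solver
    x : Ω → ℝ
    x ω = f zero (Y zero ω)
    xs : Ω → Vec ℝ n
    xs ω = Vec.tabulate λ i → f (suc i) (Y (suc i) ω)
    ys : Vec ℝ n
    ys = Vec.tabulate λ i → 𝔼 (f (suc i) ∘ Y (suc i))

  independent⇒𝔼-e : ∀ {A n} → Finite A → (Y : Fin n → Ω → A) → Independent Y → ∀ k (f : Fin n → A → ℝ) →
                    𝔼 (λ ω → e k (Vec.tabulate λ i → f i (Y i ω))) ≃ e k (Vec.tabulate λ i → 𝔼 (f i ∘ Y i))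
  independent⇒𝔼-e F Y ind k f = ≃-trans (𝔼-cong λ ω → ≃-sym (*-identityˡ _))
    (≃-trans (factors-e Y (independent⇒factors F Y ind) k f) (*-identityˡ _))

-- The median and elementary symmetric polynomials

^-mono : ∀ {x y} n → 0ℝ ≤ x → x ≤ y → x ^ n ≤ y ^ n
^-mono zero    0≤x x≤y = ≤-refl
^-mono (suc n) 0≤x x≤y = *-mono-≤ 0≤x (^-nonNeg n (≤-trans 0≤x x≤y)) x≤y (^-mono n 0≤x x≤y)

-- Minimum and maximum are the two numbers in some order, so a commutative operation cannot tell the
-- difference.
min-max-invariant : ∀ {A : Set} (_∙_ : A → A → A) → (∀ a b → a ∙ b ≡ b ∙ a) → (φ : ℚ → A) → ∀ p q →
                    φ (p ℚ.⊓ q) ∙ φ (p ℚ.⊔ q) ≡ φ p ∙ φ q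
min-max-invariant _∙_ comm φ p q with ℚ.≤-total p q
... | inj₁ p≤q = cong₂ (λ a b → φ a ∙ φ b) (ℚ.p≤q⇒p⊓q≡p p≤q) (ℚ.p≤q⇒p⊔q≡q p≤q)
... | inj₂ q≤p = trans (cong₂ (λ a b → φ a ∙ φ b) (ℚ.p≥q⇒p⊓q≡q q≤p) (ℚ.p≥q⇒p⊔q≡p q≤p)) (comm (φ q) (φ p))

opaque
  unfolding _+_ _*_ -_ ∣_∣ _⊔_ _⊓_ fromℚ

  x⊓y≤y : ∀ x y → x ⊓ y ≤ y
  x⊓y≤y x y = ≤-pointwise λ n → ℚ.p⊓q≤q (approx x n) (approx y n)

  ∣x∣*∣x∣≃x*x : ∀ x → ∣ x ∣ * ∣ x ∣ ≃ x * x
  ∣x∣*∣x∣≃x*x x = ≃-pointwise λ n → MedianOfThree.∣p∣*∣p∣≡p*p (approx x n)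

  approx-^-cong : ∀ x y n {k} → approx x k ≡ approx y k → approx (x ^ n) k ≡ approx (y ^ n) k
  approx-^-cong x y zero    eq = refl
  approx-^-cong x y (suc n) eq = cong₂ ℚ._*_ eq (approx-^-cong x y n eq)

  -- At every approximation the maximum is one of its arguments, which covers all signs of x and y.
  ⊔-^-≤ : ∀ x y n → (x ⊔ y) ^ n ≤ x ^ n ⊔ y ^ n
  ⊔-^-≤ x y n = ≤-pointwise λ k → lemma k (ℚ.⊔-sel (approx x k) (approx y k))
    where
    lemma : ∀ k → approx (x ⊔ y) k ≡ approx x k ⊎ approx (x ⊔ y) k ≡ approx y k →
            approx ((x ⊔ y) ^ n) k ℚ.≤ approx (x ^ n) k ℚ.⊔ approx (y ^ n) k
    lemma k (inj₁ eq) = ℚ.≤-trans (ℚ.≤-reflexive (approx-^-cong (x ⊔ y) x n eq)) (ℚ.p≤p⊔q (approx (x ^ n) k) (approx (y ^ n) k))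
    lemma k (inj₂ eq) = ℚ.≤-trans (ℚ.≤-reflexive (approx-^-cong (x ⊔ y) y n eq)) (ℚ.p≤q⊔p (approx (x ^ n) k) (approx (y ^ n) k))

  symmetric-∣-μ∣₊ : ∀ μ x y → ∣ x ⊓ y - μ ∣ + ∣ x ⊔ y - μ ∣ ≃ ∣ x - μ ∣ + ∣ y - μ ∣
  symmetric-∣-μ∣₊ μ x y = ≃-pointwise λ n →
    min-max-invariant ℚ._+_ ℚ.+-comm (λ p → ℚ.∣ p ℚ.- approx μ n ∣) (approx x n) (approx y n)

  symmetric-∣-μ∣ₓ : ∀ μ x y → ∣ x ⊓ y - μ ∣ * ∣ x ⊔ y - μ ∣ ≃ ∣ x - μ ∣ * ∣ y - μ ∣
  symmetric-∣-μ∣ₓ μ x y = ≃-pointwise λ n →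
    min-max-invariant ℚ._*_ ℚ.*-comm (λ p → ℚ.∣ p ℚ.- approx μ n ∣) (approx x n) (approx y n)

  symmetric-^2₊ : ∀ μ x y → (x ⊓ y - μ) ^ 2 + (x ⊔ y - μ) ^ 2 ≃ (x - μ) ^ 2 + (y - μ) ^ 2
  symmetric-^2₊ μ x y = ≃-pointwise λ n →
    min-max-invariant ℚ._+_ ℚ.+-comm (λ p → (p ℚ.- approx μ n) ℚ.* ((p ℚ.- approx μ n) ℚ.* 1ℚ)) (approx x n) (approx y n)

  symmetric-^2ₓ : ∀ μ x y → (x ⊓ y - μ) ^ 2 * (x ⊔ y - μ) ^ 2 ≃ (x - μ) ^ 2 * (y - μ) ^ 2
  symmetric-^2ₓ μ x y = ≃-pointwise λ n →
    min-max-invariant ℚ._*_ ℚ.*-comm (λ p → (p ℚ.- approx μ n) ℚ.* ((p ℚ.- approx μ n) ℚ.* 1ℚ)) (approx x n) (approx y n)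

e-nonNeg : ∀ {n} k {xs : Vec ℝ n} → All (0ℝ ≤_) xs → 0ℝ ≤ e k xs
e-nonNeg zero    _           = 0≤1
e-nonNeg (suc k) []          = ≤-refl
e-nonNeg (suc k) (0≤x ∷ 0≤xs) = +-nonNeg (*-nonNeg 0≤x (e-nonNeg k 0≤xs)) (e-nonNeg (suc k) 0≤xs)

e-mono : ∀ {n} {f g : Fin n → ℝ} k → (∀ i → 0ℝ ≤ f i) → (∀ i → f i ≤ g i) →
         e k (Vec.tabulate f) ≤ e k (Vec.tabulate g)
e-mono         zero    _   _   = ≤-refl
e-mono {zero}  (suc k) _   _   = ≤-refl
e-mono {suc n} (suc k) 0≤f f≤g = +-mono-≤
  (*-mono-≤ (0≤f zero) (e-nonNeg k (All.tabulate⁺ λ i → ≤-trans (0≤f (suc i)) (f≤g (suc i))))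
            (f≤g zero) (e-mono k (0≤f ∘ suc) (f≤g ∘ suc)))
  (e-mono (suc k) (0≤f ∘ suc) (f≤g ∘ suc))

-- One insertion step replaces two entries by their minimum and maximum. Sum and product of the two
-- values of f determine every symmetric polynomial in them, and can be compared without deciding
-- which entry is smaller.
Symmetric : (ℝ → ℝ) → Set
Symmetric f = ∀ x y → f (x ⊓ y) + f (x ⊔ y) ≃ f x + f y × f (x ⊓ y) * f (x ⊔ y) ≃ f x * f y

e-cong-tail : ∀ {n} {xs ys : Vec ℝ n} x → (∀ k → e k xs ≃ e k ys) → ∀ k → e k (x ∷ xs) ≃ e k (x ∷ ys)
e-cong-tail x h zero    = ≃-refl
e-cong-tail x h (suc k) = +-cong (*-congˡ x (h k)) (h (suc k))

-- Grouped by how many of the two leading entries they contain, the terms involve these only through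
-- x y and x + y.
e-cong-head₂ : ∀ {n x y u v} (zs : Vec ℝ n) → x + y ≃ u + v → x * y ≃ u * v →
               ∀ k → e k (x ∷ y ∷ zs) ≃ e k (u ∷ v ∷ zs)
e-cong-head₂ zs sum≃ prod≃ zero = ≃-refl
e-cong-head₂ {x = x} {y} {u} {v} zs sum≃ prod≃ (suc zero) = begin-equality
  x * 1ℝ + (y * 1ℝ + e 1 zs)   ≈⟨ expand₁ x y ⟩
  x + y + e 1 zs               ≈⟨ +-cong sum≃ ≃-refl ⟩
  u + v + e 1 zs               ≈⟨ expand₁ u v ⟨
  u * 1ℝ + (v * 1ℝ + e 1 zs)   ∎
  where
  expand₁ : ∀ a b → a * 1ℝ + (b * 1ℝ + e 1 zs) ≃ a + b + e 1 zs
  expand₁ a b = ≃-trans (+-cong (*-identityʳ a) (+-cong (*-identityʳ b) ≃-refl)) (≃-sym (+-assoc a b (e 1 zs)))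
e-cong-head₂ {x = x} {y} {u} {v} zs sum≃ prod≃ (suc (suc k)) = begin-equality
  x * (y * E₀ + E₁) + (y * E₁ + E₂)   ≈⟨ expand₂ x y ⟩
  x * y * E₀ + (x + y) * E₁ + E₂      ≈⟨ +-cong (+-cong (*-cong prod≃ ≃-refl) (*-cong sum≃ ≃-refl)) ≃-refl ⟩
  u * v * E₀ + (u + v) * E₁ + E₂      ≈⟨ expand₂ u v ⟨
  u * (v * E₀ + E₁) + (v * E₁ + E₂)   ∎
  where
  E₀ E₁ E₂ : ℝ
  E₀ = e k zs
  E₁ = e (suc k) zs
  E₂ = e (suc (suc k)) zs
  expand₂ : ∀ a b → a * (b * E₀ + E₁) + (b * E₁ + E₂) ≃ a * b * E₀ + (a + b) * E₁ + E₂
  expand₂ a b = solve 5 (λ a b p q r → a :* (b :* p :+ q) :+ (b :* q :+ r) := a :* b :* p :+ (a :+ b) :* q :+ r)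
                  ≃-refl a b E₀ E₁ E₂
    where open Solver

e-insert : ∀ {f} → Symmetric f → ∀ {n} x (ys : Vec ℝ n) k →
           e k (Vec.map f (insert x ys)) ≃ e k (f x ∷ Vec.map f ys)
e-insert     sym-f x []       k = ≃-refl
e-insert {f} sym-f x (y ∷ ys) k = ≃-trans
  (e-cong-tail (f (x ⊓ y)) (e-insert sym-f (x ⊔ y) ys) k)
  (e-cong-head₂ (Vec.map f ys) (proj₁ (sym-f x y)) (proj₂ (sym-f x y)) k)

e-sort : ∀ {f} → Symmetric f → ∀ {n} (xs : Vec ℝ n) k → e k (Vec.map f (sort xs)) ≃ e k (Vec.map f xs)
e-sort     sym-f []       k = ≃-refl
e-sort {f} sym-f (x ∷ xs) k = ≃-trans (e-insert sym-f x (sort xs) k) (e-cong-tail (f x) (e-sort sym-f xs) k)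

insert-All : ∀ {n z x} {ys : Vec ℝ n} → z ≤ x → All (z ≤_) ys → All (z ≤_) (insert x ys)
insert-All z≤x []           = z≤x ∷ []
insert-All {x = x} {y ∷ ys} z≤x (z≤y ∷ z≤ys) = ⊓-glb z≤x z≤y ∷ insert-All (≤-trans z≤x (x≤x⊔y x y)) z≤ys

insert-sorted : ∀ {n} x {ys : Vec ℝ n} → AllPairs _≤_ ys → AllPairs _≤_ (insert x ys)
insert-sorted x []             = [] ∷ []
insert-sorted x {y ∷ ys} (y≤ys ∷ sorted) =
  insert-All (x⊓y≤x⊔y x y) (All.map (≤-trans (x⊓y≤y x y)) y≤ys) ∷ insert-sorted (x ⊔ y) sorted

sort-sorted : ∀ {n} (xs : Vec ℝ n) → AllPairs _≤_ (sort xs)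
sort-sorted []       = []
sort-sorted (x ∷ xs) = insert-sorted x (sort-sorted xs)

module _ {f : ℝ → ℝ} (0≤f : ∀ x → 0ℝ ≤ f x) where

  e-map-nonNeg : ∀ {n} k (xs : Vec ℝ n) → 0ℝ ≤ e k (Vec.map f xs)
  e-map-nonNeg k xs = e-nonNeg k (All.map⁺ (All.universal 0≤f xs))

  e-full : ∀ {n ρ} {xs : Vec ℝ n} → 0ℝ ≤ ρ → All (λ x → ρ ≤ f x) xs → ρ ^ n ≤ e n (Vec.map f xs)
  e-full 0≤ρ [] = ≤-refl
  e-full {suc n} {ρ} {x ∷ xs} 0≤ρ (ρ≤fx ∷ ρ≤fxs) = begin
    ρ * ρ ^ n                            ≤⟨ *-mono-≤ 0≤ρ (e-map-nonNeg n xs) ρ≤fx (e-full 0≤ρ ρ≤fxs) ⟩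
    f x * e n (Vec.map f xs)             ≈⟨ +-identityʳ _ ⟨
    f x * e n (Vec.map f xs) + 0ℝ        ≤⟨ +-mono-≤ ≤-refl (e-map-nonNeg (suc n) xs) ⟩
    e (suc n) (Vec.map f (x ∷ xs))       ∎

  e-tail : ∀ {n} k x (xs : Vec ℝ n) → e k (Vec.map f xs) ≤ e k (Vec.map f (x ∷ xs))
  e-tail zero    x xs = ≤-refl
  e-tail (suc k) x xs = ≤-trans (≃⇒≥ (+-identityˡ _))
    (+-mono-≤ (*-nonNeg (0≤f x) (e-map-nonNeg k xs)) ≤-refl)

  -- The n - j entries from position j on are no smaller than entry j, so their product alone is at
  -- least ρ^(n - j); the entries before them only add nonnegative terms. With n = 2t - 1 and j = t
  -- - 1 the degree is t.
  e-above : ∀ {n ρ} {xs : Vec ℝ n} → AllPairs _≤_ xs → ∀ j → 0ℝ ≤ ρ →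
            (∀ x → Vec.lookup xs j ≤ x → ρ ≤ f x) →
            ρ ^ (n ℕ.∸ toℕ j) ≤ e (n ℕ.∸ toℕ j) (Vec.map f xs)
  e-above {xs = x ∷ xs} (x≤xs ∷ sorted) zero 0≤ρ ρ≤f = e-full 0≤ρ (ρ≤f x ≤-refl ∷ All.map (λ {y} → ρ≤f y) x≤xs)
  e-above {suc n} {xs = x ∷ xs} (x≤xs ∷ sorted) (suc j) 0≤ρ ρ≤f =
    ≤-trans (e-above sorted j 0≤ρ ρ≤f) (e-tail (n ℕ.∸ toℕ j) x xs)

  -- The mirror image: the product of the entries up to position j is one of the terms of `e` and
  -- has j + 1 factors, which is again t for j = t - 1.
  e-below : ∀ {n σ} {xs : Vec ℝ n} → AllPairs _≤_ xs → ∀ j → 0ℝ ≤ σ →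
            (∀ x → x ≤ Vec.lookup xs j → σ ≤ f x) →
            σ ^ suc (toℕ j) ≤ e (suc (toℕ j)) (Vec.map f xs)
  e-below {σ = σ} {x ∷ xs} (x≤xs ∷ sorted) zero 0≤σ σ≤f = begin
    σ * 1ℝ                                ≈⟨ +-identityʳ _ ⟨
    σ * 1ℝ + 0ℝ                           ≤⟨ +-mono-≤ (*-mono-≤ 0≤σ 0≤1 (σ≤f x ≤-refl) ≤-refl) (e-map-nonNeg 1 xs) ⟩
    f x * 1ℝ + e 1 (Vec.map f xs)         ∎
  e-below {σ = σ} {x ∷ xs} (x≤xs ∷ sorted) (suc j) 0≤σ σ≤f = begin
    σ * σ ^ suc (toℕ j)
      ≈⟨ +-identityʳ _ ⟨
    σ * σ ^ suc (toℕ j) + 0ℝ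
      ≤⟨ +-mono-≤ (*-mono-≤ 0≤σ (e-map-nonNeg (suc (toℕ j)) xs) (σ≤f x (All.lookup⁺ x≤xs j)) (e-below sorted j 0≤σ σ≤f))
                  (e-map-nonNeg (suc (suc (toℕ j))) xs) ⟩
    f x * e (suc (toℕ j)) (Vec.map f xs) + e (suc (suc (toℕ j))) (Vec.map f xs)  ∎

-- At least t of the 2t − 1 numbers lie on either side of their median.
median^t≤e : ∀ {f} t .{{_ : NonZero t}} (y : Vector ℝ (2 ℕ.* t ℕ.∸ 1)) {φ ρ σ} → Symmetric f →
             (∀ x → 0ℝ ≤ f x) → 0ℝ ≤ φ → 0ℝ ≤ ρ → 0ℝ ≤ σ →
             (∀ x → median t y ≤ x → ρ ≤ f x) → (∀ x → x ≤ median t y → σ ≤ f x) → φ ≤ ρ ⊔ σ →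
             φ ^ t ≤ e t (Vec.tabulate (f ∘ y))
median^t≤e {f} (suc k) y {φ} {ρ} {σ} sym-f 0≤f 0≤φ 0≤ρ 0≤σ ρ≤f σ≤f φ≤ρ⊔σ = begin
  φ ^ suc k                                  ≤⟨ ^-mono (suc k) 0≤φ φ≤ρ⊔σ ⟩
  (ρ ⊔ σ) ^ suc k                            ≤⟨ ⊔-^-≤ ρ σ (suc k) ⟩
  ρ ^ suc k ⊔ σ ^ suc k                      ≤⟨ ⊔-lub above below ⟩
  e (suc k) (Vec.map f (sort (Vec.tabulate y)))  ≈⟨ e-sort sym-f (Vec.tabulate y) (suc k) ⟩
  e (suc k) (Vec.map f (Vec.tabulate y))     ≡⟨ cong (e (suc k)) (Vec.tabulate-∘ f y) ⟨
  e (suc k) (Vec.tabulate (f ∘ y))           ∎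
  where
  j : Fin (2 ℕ.* suc k ℕ.∸ 1)
  j = fromℕ< {k} (ℕ.m<m+n k ℕ.z<s)
  toℕ-j : toℕ j ≡ k
  toℕ-j = Fin.toℕ-fromℕ< (ℕ.m<m+n k ℕ.z<s)
  n∸j : 2 ℕ.* suc k ℕ.∸ 1 ℕ.∸ toℕ j ≡ suc k
  n∸j = trans (cong (2 ℕ.* suc k ℕ.∸ 1 ℕ.∸_) toℕ-j) (trans (ℕ.m+n∸m≡n k (suc (k ℕ.+ 0))) (cong suc (ℕ.+-identityʳ k)))
  above : ρ ^ suc k ≤ e (suc k) (Vec.map f (sort (Vec.tabulate y)))
  above = subst (λ i → ρ ^ i ≤ e i (Vec.map f (sort (Vec.tabulate y)))) n∸j
    (e-above 0≤f (sort-sorted (Vec.tabulate y)) j 0≤ρ ρ≤f)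
  below : σ ^ suc k ≤ e (suc k) (Vec.map f (sort (Vec.tabulate y)))
  below = subst (λ i → σ ^ suc i ≤ e (suc i) (Vec.map f (sort (Vec.tabulate y)))) toℕ-j
    (e-below 0≤f (sort-sorted (Vec.tabulate y)) j 0≤σ σ≤f)

∣x∣^2≃x^2 : ∀ x → ∣ x ∣ ^ 2 ≃ x ^ 2
∣x∣^2≃x^2 x = ≃-trans (*-congˡ ∣ x ∣ (*-identityʳ ∣ x ∣)) (≃-trans (∣x∣*∣x∣≃x*x x) (*-congˡ x (≃-sym (*-identityʳ x))))

0≤x*x : ∀ x → 0ℝ ≤ x * x
0≤x*x x = ≤-trans (*-nonNeg (0≤∣x∣ x) (0≤∣x∣ x)) (≃⇒≤ (∣x∣*∣x∣≃x*x x))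

0≤x^2 : ∀ x → 0ℝ ≤ x ^ 2
0≤x^2 x = ≤-trans (0≤x*x x) (≃⇒≥ (*-congˡ x (*-identityʳ x)))

module _ (t : ℕ) .{{_ : NonZero t}} (y : Vector ℝ (2 ℕ.* t ℕ.∸ 1)) (μ : ℝ) where

  private
    -- The positive and the negative part of the median's error. An entry above the median errs by
    -- at least ρ and one below it by at least σ, whichever sign z has, since absolute errors also
    -- dominate the 0 in each maximum.
    z ρ σ : ℝ
    z = median t y - μ
    ρ = z ⊔ 0ℝ
    σ = - z ⊔ 0ℝ

    ρ≤ : ∀ x → median t y ≤ x → ρ ≤ ∣ x - μ ∣
    ρ≤ x m≤x = ⊔-lub (≤-trans (+-mono-≤ m≤x ≤-refl) (x≤∣x∣ (x - μ))) (0≤∣x∣ (x - μ))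

    σ≤ : ∀ x → x ≤ median t y → σ ≤ ∣ x - μ ∣
    σ≤ x x≤m = ⊔-lub (≤-trans (neg-antimono-≤ (+-mono-≤ x≤m ≤-refl)) (-x≤∣x∣ (x - μ))) (0≤∣x∣ (x - μ))

  median-∣∣-bound : ∣ z ∣ ^ t ≤ e t (Vec.tabulate λ i → ∣ y i - μ ∣)
  median-∣∣-bound = median^t≤e t y (λ a b → symmetric-∣-μ∣₊ μ a b , symmetric-∣-μ∣ₓ μ a b) (λ x → 0≤∣x∣ (x - μ)) (0≤∣x∣ z)
    (0≤⊔0 z) (0≤⊔0 (- z)) ρ≤ σ≤ (≃⇒≤ (∣x∣-cases z))

  median-^2-bound : z ^ (2 ℕ.* t) ≤ e t (Vec.tabulate λ i → (y i - μ) ^ 2)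
  median-^2-bound = begin
    z ^ (2 ℕ.* t)   ≈⟨ ^-assocʳ z 2 t ⟨
    (z ^ 2) ^ t     ≤⟨ median^t≤e t y (λ a b → symmetric-^2₊ μ a b , symmetric-^2ₓ μ a b) (λ x → 0≤x^2 (x - μ)) (0≤x^2 z)
                         (^-nonNeg 2 (0≤⊔0 z)) (^-nonNeg 2 (0≤⊔0 (- z)))
                         (λ x h → ≤-trans (^-mono 2 (0≤⊔0 z) (ρ≤ x h)) (≃⇒≤ (∣x∣^2≃x^2 (x - μ))))
                         (λ x h → ≤-trans (^-mono 2 (0≤⊔0 (- z)) (σ≤ x h)) (≃⇒≤ (∣x∣^2≃x^2 (x - μ))))
                         φ≤ ⟩
    e t (Vec.tabulate λ i → (y i - μ) ^ 2)  ∎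
    where
    φ≤ : z ^ 2 ≤ ρ ^ 2 ⊔ σ ^ 2
    φ≤ = begin
      z ^ 2            ≈⟨ ∣x∣^2≃x^2 z ⟨
      ∣ z ∣ ^ 2        ≈⟨ ^-congˡ 2 (∣x∣-cases z) ⟩
      (ρ ⊔ σ) ^ 2      ≤⟨ ⊔-^-≤ ρ σ 2 ⟩
      ρ ^ 2 ⊔ σ ^ 2    ∎

-- The median of three real numbers

gap : ℝ → ℝ → ℝ
gap x y = ∣ x ⊔ y ∣ - ∣ x ⊓ y ∣

opaque
  unfolding _+_ _*_ -_ ∣_∣ _⊔_ _⊓_ fromℚ

  -- Both sides are built from ring and lattice operations and absolute values, so `med-bound`
  -- applies to each triple of approximations after the shift by -μ.
  median₃-bound : ∀ x y z μ →
    let d = (x ⊔ (y ⊓ z)) ⊓ (y ⊔ z) - μ ; a = x - μ ; b = y - μ ; c = z - μ in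
    d * d + d * d + d * d ≤ (a * a + b * b + c * c) + (a * gap b c + b * gap a c + c * gap a b)
  median₃-bound x y z μ = ≤-pointwise λ n →
    let X = approx x n ; Y = approx y n ; Z = approx z n ; r = ℚ.- approx μ n in
    ℚ.≤-trans
      (ℚ.≤-reflexive (cong (λ d → MedianOfThree.thrice (d ℚ.* d)) (MedianOfThree.med-shift X Y Z r)))
      (MedianOfThree.med-bound (X ℚ.+ r) (Y ℚ.+ r) (Z ℚ.+ r))

  third : ℝ
  third = fromℚ (ℤ.+ 1 ℚ./ 3)

  0≤third : 0ℝ ≤ third
  0≤third = ≤-pointwise λ n → ℚ.nonNegative⁻¹ (ℤ.+ 1 ℚ./ 3)

  third-thrice : ∀ x → third * (x + x + x) ≃ x
  third-thrice x = ≃-pointwise λ n → solve 1 (λ p → con (ℤ.+ 1 ℚ./ 3) :* (p :+ p :+ p) := p) refl (approx x n)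
    where open +-*-Solver

  half : ℝ
  half = fromℚ ½

  half+half : half + half ≃ 1ℝ
  half+half = ≃-pointwise λ n → refl

  x*y≤½x²+½y² : ∀ x y → x * y ≤ half * (x * x) + half * (y * y)
  x*y≤½x²+½y² x y = ≤-pointwise λ n → MedianOfThree.p*q≤½p²+½q² (approx x n) (approx y n)

thrice-cancel-≤ : ∀ {x y} → x + x + x ≤ y + y + y → x ≤ y
thrice-cancel-≤ {x} {y} h = begin
  x                     ≈⟨ third-thrice x ⟨
  third * (x + x + x)   ≤⟨ *-monoʳ-≤ 0≤third h ⟩
  third * (y + y + y)   ≈⟨ third-thrice y ⟩
  y                     ∎

-- Moments of one row

suc/1 : ∀ n → ℤ.+ suc n ℚ./ 1 ≡ 1ℚ ℚ.+ (ℤ.+ n ℚ./ 1)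
suc/1 n = ℚ.toℚᵘ-injective (ℚᵘ.≃-trans (ℚ.toℚᵘ-fromℚᵘ (ℚᵘ.mkℚᵘ (ℤ.+ suc n) 0))
  (ℚᵘ.≃-trans (ℚᵘ.*≡* (solve 1 (λ n → (con (ℤ.+ 1) :+ n) :* con (ℤ.+ 1)
      := (con (ℤ.+ 1) :* con (ℤ.+ 1) :+ n :* con (ℤ.+ 1)) :* con (ℤ.+ 1)) refl (ℤ.+ n)))
    (ℚᵘ.≃-sym (ℚᵘ.≃-trans (ℚ.toℚᵘ-homo-+ 1ℚ (ℤ.+ n ℚ./ 1))
      (ℚᵘ.+-congʳ (ℚ.toℚᵘ 1ℚ) (ℚ.toℚᵘ-fromℚᵘ (ℚᵘ.mkℚᵘ (ℤ.+ n) 0)))))))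
  where open ℤ-Solver

n/1*1/n : ∀ n .{{_ : NonZero n}} → (ℤ.+ n ℚ./ 1) ℚ.* (ℤ.+ 1 ℚ./ n) ≡ 1ℚ
n/1*1/n n@(suc k) = ℚ.toℚᵘ-injective (ℚᵘ.≃-trans (ℚ.toℚᵘ-homo-* (ℤ.+ n ℚ./ 1) (ℤ.+ 1 ℚ./ n))
  (ℚᵘ.≃-trans (ℚᵘ.*-cong (ℚ.toℚᵘ-fromℚᵘ (ℚᵘ.mkℚᵘ (ℤ.+ n) 0)) (ℚ.toℚᵘ-fromℚᵘ (ℚᵘ.mkℚᵘ (ℤ.+ 1) k)))
    (ℚᵘ.*≡* (solve 1 (λ n → (n :* con (ℤ.+ 1)) :* con (ℤ.+ 1) := con (ℤ.+ 1) :* (con (ℤ.+ 1) :* n)) refl (ℤ.+ n)))))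
  where open ℤ-Solver

inv : (n : ℕ) .{{_ : NonZero n}} → ℝ
inv n = fromℚ (ℤ.+ 1 ℚ./ n)

opaque
  unfolding _+_ _*_ -_ fromℚ

  fromℕ-suc : ∀ n → fromℕ (suc n) ≃ 1ℝ + fromℕ n
  fromℕ-suc n = ≃-pointwise λ _ → suc/1 n

  fromℕ*inv : ∀ n .{{_ : NonZero n}} → fromℕ n * inv n ≃ 1ℝ
  fromℕ*inv n = ≃-pointwise λ _ → n/1*1/n n

  0≤inv : ∀ n .{{_ : NonZero n}} → 0ℝ ≤ inv n
  0≤inv n = ≤-pointwise λ _ → ℚ.nonNegative⁻¹ (ℤ.+ 1 ℚ./ n) {{ℚ.normalize-nonNeg 1 n}}

  -1*-1≃1 : (- 1ℝ) * (- 1ℝ) ≃ 1ℝ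
  -1*-1≃1 = ≃-pointwise λ _ → refl

∣∣-cong : ∀ {x y} → x ≃ y → ∣ x ∣ ≃ ∣ y ∣
∣∣-cong {x} {y} h = begin-equality
  ∣ x ∣                        ≈⟨ ∣x∣-cases x ⟩
  (x ⊔ 0ℝ) ⊔ (- x ⊔ 0ℝ)        ≈⟨ ⊔-cong (⊔-cong h ≃-refl) (⊔-cong (-‿cong h) ≃-refl) ⟩
  (y ⊔ 0ℝ) ⊔ (- y ⊔ 0ℝ)        ≈⟨ ∣x∣-cases y ⟨
  ∣ y ∣                        ∎

∑-const : ∀ n c → sum {n} (λ _ → c) ≃ fromℕ n * c
∑-const zero    c = ≃-sym (zeroˡ c)
∑-const (suc n) c = begin-equality
  c + sum {n} (λ _ → c)     ≈⟨ +-cong (≃-sym (*-identityˡ c)) (∑-const n c) ⟩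
  1ℝ * c + fromℕ n * c      ≈⟨ distribʳ c 1ℝ (fromℕ n) ⟨
  (1ℝ + fromℕ n) * c        ≈⟨ *-cong (fromℕ-suc n) ≃-refl ⟨
  fromℕ (suc n) * c         ∎

∣∑∣≤∑∣∣ : ∀ {n} (f : Fin n → ℝ) → ∣ sum f ∣ ≤ sum λ i → ∣ f i ∣
∣∑∣≤∑∣∣ {zero}  f = ≃⇒≤ ∣0∣≃0
∣∑∣≤∑∣∣ {suc n} f = ≤-trans (∣x+y∣≤∣x∣+∣y∣ (f zero) (sum (f ∘ suc))) (+-mono-≤ ≤-refl (∣∑∣≤∑∣∣ (f ∘ suc)))

∑*∑ : ∀ {m n} (f : Fin m → ℝ) (g : Fin n → ℝ) → sum f * sum g ≃ sum λ i → sum λ j → f i * g j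
∑*∑ f g = ≃-trans (*-distribʳ-sum (sum g) f) (∑-cong λ i → *-distribˡ-sum (f i) g)

∑∑-δδ : ∀ {m n} (a : Fin m) (b : Fin n) (K : Fin m → Fin n → ℝ) →
        sum (λ i → sum λ j → δ a i * δ b j * K i j) ≃ K a b
∑∑-δδ a b K = begin-equality
  sum (λ i → sum λ j → δ a i * δ b j * K i j)
    ≈⟨ ∑-cong (λ i → ≃-trans (∑-cong λ j → *-assoc (δ a i) (δ b j) (K i j))
         (≃-sym (*-distribˡ-sum (δ a i) λ j → δ b j * K i j))) ⟩
  sum (λ i → δ a i * sum λ j → δ b j * K i j)
    ≈⟨ ∑-δ a (λ i → sum λ j → δ b j * K i j) ⟩
  sum (λ j → δ b j * K a j)
    ≈⟨ ∑-δ b (K a) ⟩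
  K a b  ∎

δ-sym : ∀ {n} (i j : Fin n) → δ i j ≡ δ j i
δ-sym i j with i Fin.≟ j
... | yes refl = sym (δ-refl i)
... | no i≢j   = sym (δ-≢ (i≢j ∘ sym))

δ-idem : ∀ {n} (i j : Fin n) → δ i j * δ i j ≃ δ i j
δ-idem i j = 𝟙-idem ⌊ i Fin.≟ j ⌋
  where
  𝟙-idem : ∀ b → 𝟙 b * 𝟙 b ≃ 𝟙 b
  𝟙-idem b = ≃-trans (≃-sym (𝟙-∧ b b)) (≃-reflexive (cong 𝟙 (∧-idem b)))

∣δ∣≃δ : ∀ {n} (i j : Fin n) → ∣ δ i j ∣ ≃ δ i j
∣δ∣≃δ i j = ∣𝟙∣≃𝟙 ⌊ i Fin.≟ j ⌋
  where
  ∣𝟙∣≃𝟙 : ∀ b → ∣ 𝟙 b ∣ ≃ 𝟙 b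
  ∣𝟙∣≃𝟙 true  = ∣1∣≃1
  ∣𝟙∣≃𝟙 false = ∣0∣≃0

sign²≃1 : ∀ s → signValue s * signValue s ≃ 1ℝ
sign²≃1 Sign.+ = *-identityˡ 1ℝ
sign²≃1 Sign.- = -1*-1≃1

∣sign∣≃1 : ∀ s → ∣ signValue s ∣ ≃ 1ℝ
∣sign∣≃1 Sign.+ = ∣1∣≃1
∣sign∣≃1 Sign.- = ∣-1∣≃1

pair : ∀ {d} → Fin d → Fin d → Fin 2 → Fin d
pair l m = Vec.lookup (l ∷ m ∷ [])

pair-injective : ∀ {d} {l m : Fin d} → l ≢ m → Injective _≡_ _≡_ (pair l m)
pair-injective l≢m {zero}     {zero}     _  = refl
pair-injective l≢m {zero}     {suc zero} eq = contradiction eq l≢m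
pair-injective l≢m {suc zero} {zero}     eq = contradiction (sym eq) l≢m
pair-injective l≢m {suc zero} {suc zero} _  = refl

distinct₄ : ∀ {d} {a b p q : Fin d} → a ≢ b → a ≢ p → a ≢ q → b ≢ p → b ≢ q → p ≢ q →
            Injective _≡_ _≡_ (Vec.lookup (a ∷ b ∷ p ∷ q ∷ []))
distinct₄ ab ap aq bp bq pq {i} {j} = go i j
  where
  go : ∀ i j → Vec.lookup (_ ∷ _ ∷ _ ∷ _ ∷ []) i ≡ Vec.lookup (_ ∷ _ ∷ _ ∷ _ ∷ []) j → i ≡ j
  go zero zero _ = refl
  go zero (suc zero) eq = contradiction eq ab
  go zero (suc (suc zero)) eq = contradiction eq ap
  go zero (suc (suc (suc zero))) eq = contradiction eq aq
  go (suc zero) zero eq = contradiction (sym eq) ab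
  go (suc zero) (suc zero) _ = refl
  go (suc zero) (suc (suc zero)) eq = contradiction eq bp
  go (suc zero) (suc (suc (suc zero))) eq = contradiction eq bq
  go (suc (suc zero)) zero eq = contradiction (sym eq) ap
  go (suc (suc zero)) (suc zero) eq = contradiction (sym eq) bp
  go (suc (suc zero)) (suc (suc zero)) _ = refl
  go (suc (suc zero)) (suc (suc (suc zero))) eq = contradiction eq pq
  go (suc (suc (suc zero))) zero eq = contradiction (sym eq) aq
  go (suc (suc (suc zero))) (suc zero) eq = contradiction (sym eq) bq
  go (suc (suc (suc zero))) (suc (suc zero)) eq = contradiction (sym eq) pq
  go (suc (suc (suc zero))) (suc (suc (suc zero))) _ = refl

module Row {d s : ℕ} .{{_ : NonZero s}} (v w : Vector ℝ d) where

  Hash : Set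
  Hash = Vec (Fin s) d × Vec Sign d

  -- A row of `sketch` as a function of the hash functions instead of the outcome. Being a function
  -- on a finite type, it falls under the product rules for independent variables.
  rowSketch : Vector ℝ d → Hash → Vector ℝ s
  rowSketch u (η , γ) k = sum λ l →
    if ⌊ Vec.lookup η l Fin.≟ k ⌋ then signValue (Vec.lookup γ l) * u l else 0ℝ

  estimate err : Hash → ℝ
  estimate y = ⟨ rowSketch v y , rowSketch w y ⟩
  err y = estimate y - ⟨ v , w ⟩

  collide : Vec (Fin s) d → Fin d → Fin d → ℝ
  collide η l m = δ (Vec.lookup η l) (Vec.lookup η m)

  signs : Vec Sign d → Fin d → Fin d → ℝ
  signs γ l m = signValue (Vec.lookup γ l) * signValue (Vec.lookup γ m)

  -- Zero on the diagonal, whose contribution to the estimate is exactly the inner product. The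
  -- error thereby stays a sum over all pairs, with no side condition on the keys.
  offDiagonal : Fin d → Fin d → ℝ
  offDiagonal l m = if ⌊ l Fin.≟ m ⌋ then 0ℝ else v l * w m

  -- Lets facts about distinct keys be used inside sums over all pairs: on the diagonal both sides
  -- vanish.
  offDiagonal-cong : ∀ l m {x y} → (l ≢ m → x ≃ y) → offDiagonal l m * x ≃ offDiagonal l m * y
  offDiagonal-cong l m h with l Fin.≟ m
  ... | yes _  = ≃-trans (zeroˡ _) (≃-sym (zeroˡ _))
  ... | no l≢m = *-congˡ (v l * w m) (h l≢m)

  ∣offDiagonal∣-cong : ∀ l m {x y} → (l ≢ m → x ≃ y) → ∣ offDiagonal l m ∣ * x ≃ ∣ offDiagonal l m ∣ * y
  ∣offDiagonal∣-cong l m h with l Fin.≟ m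
  ... | yes _  = ≃-trans (∣0∣*≃0 _) (≃-sym (∣0∣*≃0 _))
    where
    ∣0∣*≃0 : ∀ x → ∣ 0ℝ ∣ * x ≃ 0ℝ
    ∣0∣*≃0 x = ≃-trans (*-cong ∣0∣≃0 ≃-refl) (zeroˡ x)
  ... | no l≢m = *-congˡ ∣ v l * w m ∣ (h l≢m)

  ∣offDiagonal∣≤ : ∀ l m → ∣ offDiagonal l m ∣ ≤ ∣ v l ∣ * ∣ w m ∣
  ∣offDiagonal∣≤ l m with l Fin.≟ m
  ... | yes _ = ≤-trans (≃⇒≤ ∣0∣≃0) (*-nonNeg (0≤∣x∣ (v l)) (0≤∣x∣ (w m)))
  ... | no _  = ≃⇒≤ (∣∣-homo-* (v l) (w m))

  offDiagonal²≤ : ∀ l m → offDiagonal l m * offDiagonal l m ≤ v l * v l * (w m * w m)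
  offDiagonal²≤ l m with l Fin.≟ m
  ... | yes _ = ≤-trans (≃⇒≤ (zeroˡ 0ℝ)) (*-nonNeg (0≤x*x (v l)) (0≤x*x (w m)))
  ... | no _  = ≃⇒≤ (Solver.solve 2 (λ a b → (a :* b) :* (a :* b) := a :* a :* (b :* b)) ≃-refl (v l) (w m))
    where open Solver

  term : Hash → Fin d → Fin d → ℝ
  term (η , γ) l m = offDiagonal l m * (collide η l m * signs γ l m)

  -- Exchanging the sums puts the one over buckets innermost, where only the bucket of l survives; m
  -- lies in it exactly when the two keys collide.
  estimate-expand : ∀ y → estimate y ≃ sum λ l → sum λ m → v l * w m * (collide (proj₁ y) l m * signs (proj₂ y) l m)
  estimate-expand (η , γ) = begin-equality
    sum (λ k → rowSketch v (η , γ) k * rowSketch w (η , γ) k)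
      ≈⟨ ∑-cong (λ k → *-cong (∑-cong λ l → ≃-sym (𝟙*-select ⌊ Vec.lookup η l Fin.≟ k ⌋ (σ l * v l)))
                              (∑-cong λ m → ≃-sym (𝟙*-select ⌊ Vec.lookup η m Fin.≟ k ⌋ (σ m * w m)))) ⟩
    sum (λ k → sum (λ l → b l k * (σ l * v l)) * sum (λ m → b m k * (σ m * w m)))
      ≈⟨ ∑-cong (λ k → ∑*∑ (λ l → b l k * (σ l * v l)) (λ m → b m k * (σ m * w m))) ⟩
    sum (λ k → sum λ l → sum λ m → b l k * (σ l * v l) * (b m k * (σ m * w m)))
      ≈⟨ ∑-comm (λ k l → sum λ m → b l k * (σ l * v l) * (b m k * (σ m * w m))) ⟩
    sum (λ l → sum λ k → sum λ m → b l k * (σ l * v l) * (b m k * (σ m * w m)))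
      ≈⟨ ∑-cong (λ l → ∑-comm (λ k m → b l k * (σ l * v l) * (b m k * (σ m * w m)))) ⟩
    sum (λ l → sum λ m → sum λ k → b l k * (σ l * v l) * (b m k * (σ m * w m)))
      ≈⟨ ∑-cong (λ l → ∑-cong λ m → collect l m) ⟩
    sum (λ l → sum λ m → v l * w m * (collide η l m * signs γ l m))  ∎
    where
    open Solver
    σ : Fin d → ℝ
    σ l = signValue (Vec.lookup γ l)
    b : Fin d → Fin s → ℝ
    b l k = δ (Vec.lookup η l) k
    collect : ∀ l m → sum (λ k → b l k * (σ l * v l) * (b m k * (σ m * w m))) ≃
                      v l * w m * (collide η l m * signs γ l m)
    collect l m = begin-equality
      sum (λ k → b l k * (σ l * v l) * (b m k * (σ m * w m)))
        ≈⟨ ∑-cong (λ k → solve 6 (λ b b′ x y v w → b :* (x :* v) :* (b′ :* (y :* w)) := b :* (b′ :* (v :* w :* (x :* y))))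
             ≃-refl (b l k) (b m k) (σ l) (σ m) (v l) (w m)) ⟩
      sum (λ k → b l k * (b m k * (v l * w m * signs γ l m)))
        ≈⟨ ∑-δ (Vec.lookup η l) (λ k → b m k * (v l * w m * signs γ l m)) ⟩
      δ (Vec.lookup η m) (Vec.lookup η l) * (v l * w m * signs γ l m)
        ≈⟨ *-cong (≃-reflexive (δ-sym (Vec.lookup η m) (Vec.lookup η l))) ≃-refl ⟩
      collide η l m * (v l * w m * signs γ l m)
        ≈⟨ solve 3 (λ c u s → c :* (u :* s) := u :* (c :* s)) ≃-refl (collide η l m) (v l * w m) (signs γ l m) ⟩
      v l * w m * (collide η l m * signs γ l m)  ∎

  -- A key always collides with itself and its sign squares to 1, so the diagonal terms carry no
  -- randomness.
  split-diagonal : ∀ y l m → v l * w m * (collide (proj₁ y) l m * signs (proj₂ y) l m) ≃ term y l m + δ l m * (v l * w m)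
  split-diagonal (η , γ) l m with l Fin.≟ m
  ... | yes refl = begin-equality
    v l * w l * (collide η l l * signs γ l l)
      ≈⟨ *-congˡ (v l * w l) (≃-trans (*-cong (≃-reflexive (δ-refl (Vec.lookup η l))) (sign²≃1 (Vec.lookup γ l))) (*-identityˡ 1ℝ)) ⟩
    v l * w l * 1ℝ
      ≈⟨ *-comm (v l * w l) 1ℝ ⟩
    1ℝ * (v l * w l)
      ≈⟨ +-identityˡ _ ⟨
    0ℝ + 1ℝ * (v l * w l)
      ≈⟨ +-cong (zeroˡ _) ≃-refl ⟨
    0ℝ * (collide η l l * signs γ l l) + 1ℝ * (v l * w l)  ∎
  ... | no _ = ≃-sym (≃-trans (+-congˡ (zeroˡ (v l * w m))) (+-identityʳ _))

  err-expand : ∀ y → err y ≃ sum λ l → sum λ m → term y l m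
  err-expand y = begin-equality
    estimate y - ⟨ v , w ⟩
      ≈⟨ +-cong (≃-trans (estimate-expand y) (∑-cong λ l → ∑-cong λ m → split-diagonal y l m)) ≃-refl ⟩
    sum (λ l → sum λ m → term y l m + δ l m * (v l * w m)) - ⟨ v , w ⟩
      ≈⟨ +-cong (∑-cong λ l → ≃-trans (∑-distrib-+ (term y l) (λ m → δ l m * (v l * w m)))
                                      (+-congˡ (∑-δ l λ m → v l * w m))) ≃-refl ⟩
    sum (λ l → sum (term y l) + v l * w l) - ⟨ v , w ⟩
      ≈⟨ +-cong (∑-distrib-+ (λ l → sum (term y l)) (λ l → v l * w l)) ≃-refl ⟩
    sum (λ l → sum (term y l)) + ⟨ v , w ⟩ - ⟨ v , w ⟩
      ≈⟨ +-assoc _ ⟨ v , w ⟩ (- ⟨ v , w ⟩) ⟩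
    sum (λ l → sum (term y l)) + (⟨ v , w ⟩ - ⟨ v , w ⟩)
      ≈⟨ ≃-trans (+-congˡ (-‿inverseʳ ⟨ v , w ⟩)) (+-identityʳ _) ⟩
    sum (λ l → sum (term y l))  ∎

  module Moments (P : FiniteProbabilitySpace) where
    open FiniteProbabilitySpace P
    open Expectation P

    module _ (h : Ω → Vec (Fin s) d) (g : Ω → Vec Sign d)
             (h-2-wise : WiseIndependent Fin._≟_ s 2 h) (g-4-wise : WiseIndependent Sign._≟_ 2 4 g)
             (h⊥g : h ⊥ g) where

      private
        σ : Fin d → Ω → ℝ
        σ l ω = signValue (Vec.lookup (g ω) l)

        y : Ω → Hash
        y ω = h ω , g ω

      -- A collision happens in exactly one of the s buckets, and 2-wise independence puts both keys
      -- into a given one with probability 1/s².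
      𝔼-collide : ∀ {l m} → l ≢ m → 𝔼 (λ ω → collide (h ω) l m) ≃ inv s
      𝔼-collide {l} {m} l≢m = begin-equality
        𝔼 (λ ω → collide (h ω) l m)
          ≈⟨ 𝔼-cong (λ ω → ≃-trans (≃-reflexive (δ-sym (Vec.lookup (h ω) l) (Vec.lookup (h ω) m)))
               (≃-sym (∑-δ (Vec.lookup (h ω) l) λ k → δ (Vec.lookup (h ω) m) k))) ⟩
        𝔼 (λ ω → sum λ k → δ (Vec.lookup (h ω) l) k * δ (Vec.lookup (h ω) m) k)
          ≈⟨ 𝔼-∑ (λ k ω → δ (Vec.lookup (h ω) l) k * δ (Vec.lookup (h ω) m) k) ⟩
        sum (λ k → 𝔼 λ ω → δ (Vec.lookup (h ω) l) k * δ (Vec.lookup (h ω) m) k)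
          ≈⟨ ∑-cong both ⟩
        sum {s} (λ k → inv s * inv s)
          ≈⟨ ∑-const s (inv s * inv s) ⟩
        fromℕ s * (inv s * inv s)
          ≈⟨ *-assoc (fromℕ s) (inv s) (inv s) ⟨
        fromℕ s * inv s * inv s
          ≈⟨ ≃-trans (*-cong (fromℕ*inv s) ≃-refl) (*-identityˡ (inv s)) ⟩
        inv s  ∎
        where
        wise = h-2-wise 2 ℕ.≤-refl (pair l m) (pair-injective l≢m)
        both : ∀ k → 𝔼 (λ ω → δ (Vec.lookup (h ω) l) k * δ (Vec.lookup (h ω) m) k) ≃ inv s * inv s
        both k = begin-equality
          𝔼 (λ ω → δ (Vec.lookup (h ω) l) k * δ (Vec.lookup (h ω) m) k)
            ≈⟨ 𝔼-cong (λ ω → *-congˡ (δ (Vec.lookup (h ω) l) k) (*-identityʳ (δ (Vec.lookup (h ω) m) k))) ⟨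
          𝔼 (λ ω → product λ j → δ (Vec.lookup (h ω) (pair l m j)) k)
            ≈⟨ independent⇒𝔼-∏ (Fin-finite s) (λ j ω → Vec.lookup (h ω) (pair l m j)) (proj₁ wise) (λ _ a → δ a k) ⟩
          product (λ j → 𝔼 λ ω → δ (Vec.lookup (h ω) (pair l m j)) k)
            ≈⟨ ∏-cong (λ j → ≃-trans (proj₂ wise j k) (*-identityˡ (inv s))) ⟩
          inv s * (inv s * 1ℝ)
            ≈⟨ *-congˡ (inv s) (*-identityʳ (inv s)) ⟩
          inv s * inv s  ∎

      -- At most four distinct keys have independent signs, and already the first sign has mean
      -- zero. Taking `suc n` keys rules out the empty product.
      𝔼-∏signs : ∀ n → suc n ℕ.≤ 4 → (key : Fin (suc n) → Fin d) → Injective _≡_ _≡_ key →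
                 𝔼 (λ ω → product λ j → σ (key j) ω) ≃ 0ℝ
      𝔼-∏signs n n<4 key inj = begin-equality
        𝔼 (λ ω → product λ j → σ (key j) ω)
          ≈⟨ independent⇒𝔼-∏ Sign-finite (λ j ω → Vec.lookup (g ω) (key j)) (proj₁ wise) (λ _ → signValue) ⟩
        product (λ j → 𝔼 (σ (key j)))
          ≈⟨ ∏-nonempty-zero {f = λ j → 𝔼 (σ (key j))} mean-zero ⟩
        0ℝ  ∎
        where
        wise = g-4-wise (suc n) n<4 key inj
        a : Ω → Sign
        a ω = Vec.lookup (g ω) (key zero)
        split : ∀ s → signValue s ≃ 𝟙 ⌊ s Sign.≟ Sign.+ ⌋ + (- 1ℝ) * 𝟙 ⌊ s Sign.≟ Sign.- ⌋
        split Sign.+ = ≃-sym (≃-trans (+-congˡ (zeroʳ (- 1ℝ))) (+-identityʳ 1ℝ))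
        split Sign.- = ≃-sym (≃-trans (+-identityˡ _) (*-identityʳ (- 1ℝ)))
        mean-zero : 𝔼 (λ ω → signValue (a ω)) ≃ 0ℝ
        mean-zero = begin-equality
          𝔼 (λ ω → signValue (a ω))
            ≈⟨ 𝔼-cong (λ ω → split (a ω)) ⟩
          𝔼 (λ ω → 𝟙 ⌊ a ω Sign.≟ Sign.+ ⌋ + (- 1ℝ) * 𝟙 ⌊ a ω Sign.≟ Sign.- ⌋)
            ≈⟨ 𝔼-+ (λ ω → 𝟙 ⌊ a ω Sign.≟ Sign.+ ⌋) (λ ω → (- 1ℝ) * 𝟙 ⌊ a ω Sign.≟ Sign.- ⌋) ⟩
          ℙ (λ ω → ⌊ a ω Sign.≟ Sign.+ ⌋) + 𝔼 (λ ω → (- 1ℝ) * 𝟙 ⌊ a ω Sign.≟ Sign.- ⌋)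
            ≈⟨ +-cong (proj₂ wise zero Sign.+)
                 (≃-trans (𝔼-*ˡ (- 1ℝ) (λ ω → 𝟙 ⌊ a ω Sign.≟ Sign.- ⌋)) (*-congˡ (- 1ℝ) (proj₂ wise zero Sign.-))) ⟩
          1ℝ / 2 + (- 1ℝ) * (1ℝ / 2)
            ≈⟨ +-cong (*-identityˡ (1ℝ / 2)) ≃-refl ⟨
          1ℝ * (1ℝ / 2) + (- 1ℝ) * (1ℝ / 2)
            ≈⟨ distribʳ (1ℝ / 2) 1ℝ (- 1ℝ) ⟨
          (1ℝ - 1ℝ) * (1ℝ / 2)
            ≈⟨ ≃-trans (*-cong (-‿inverseʳ 1ℝ) ≃-refl) (zeroˡ (1ℝ / 2)) ⟩
          0ℝ  ∎

      𝔼-signs : ∀ {l m} → l ≢ m → 𝔼 (λ ω → signs (g ω) l m) ≃ 0ℝ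
      𝔼-signs {l} {m} l≢m = ≃-trans
        (𝔼-cong λ ω → *-congˡ (σ l ω) (≃-sym (*-identityʳ (σ m ω))))
        (𝔼-∏signs 1 (ℕ.s≤s (ℕ.s≤s ℕ.z≤n)) (pair l m) (pair-injective l≢m))

      private
        𝔼≃0 : ∀ {X : Ω → ℝ} p {q r} → q ≢ r → (∀ ω → X ω ≃ (σ p ω * σ p ω) * signs (g ω) q r) → 𝔼 X ≃ 0ℝ
        𝔼≃0 p {q} {r} q≢r h = ≃-trans
          (𝔼-cong λ ω → ≃-trans (h ω) (≃-trans (*-cong (sign²≃1 (Vec.lookup (g ω) p)) ≃-refl) (*-identityˡ _)))
          (𝔼-signs q≢r)

        𝔼≃1 : ∀ {X : Ω → ℝ} p q → (∀ ω → X ω ≃ (σ p ω * σ p ω) * (σ q ω * σ q ω)) → 𝔼 X ≃ 1ℝ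
        𝔼≃1 p q h = ≃-trans
          (𝔼-cong λ ω → ≃-trans (h ω)
            (≃-trans (*-cong (sign²≃1 (Vec.lookup (g ω) p)) (sign²≃1 (Vec.lookup (g ω) q))) (*-identityˡ 1ℝ)))
          (𝔼-const 1ℝ)

        0+0≃0 : ∀ {x y} → x ≃ 0ℝ → y ≃ 0ℝ → x + y ≃ 0ℝ
        0+0≃0 h k = ≃-trans (+-cong h k) (+-identityˡ 0ℝ)

      -- Two pairs of distinct keys agree in the same order, agree in opposite order, share one key
      -- or are disjoint. Shared signs square to 1: two shared keys leave 1, one leaves a product of
      -- two distinct signs, and only disjoint pairs call on the independence of four. The two
      -- products of `δ` are never both 1.
      𝔼-signs-signs : ∀ {l m l′ m′} → l ≢ m → l′ ≢ m′ →
                      𝔼 (λ ω → signs (g ω) l m * signs (g ω) l′ m′) ≃ δ l l′ * δ m m′ + δ m l′ * δ l m′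
      𝔼-signs-signs {l} {m} {l′} {m′} l≢m l′≢m′ with l Fin.≟ l′ | m Fin.≟ m′ | m Fin.≟ l′ | l Fin.≟ m′
      ... | yes refl | yes refl | yes m≡l  | _        = contradiction (sym m≡l) l≢m
      ... | yes refl | yes refl | no _     | yes l≡m  = contradiction l≡m l≢m
      ... | yes refl | yes refl | no _     | no _     = ≃-trans
        (𝔼≃1 l m λ ω → solve 2 (λ a b → (a :* b) :* (a :* b) := (a :* a) :* (b :* b)) ≃-refl (σ l ω) (σ m ω))
        (≃-sym (≃-trans (+-cong (*-identityˡ 1ℝ) (zeroˡ 0ℝ)) (+-identityʳ 1ℝ)))
        where open Solver
      ... | yes refl | no _     | yes m≡l  | _        = contradiction (sym m≡l) l≢m
      ... | yes refl | no _     | no _     | yes l≡m′ = contradiction l≡m′ l′≢m′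
      ... | yes refl | no m≢m′  | no _     | no _     = ≃-trans
        (𝔼≃0 l m≢m′ λ ω → solve 3 (λ a b c → (a :* b) :* (a :* c) := (a :* a) :* (b :* c)) ≃-refl (σ l ω) (σ m ω) (σ m′ ω))
        (≃-sym (0+0≃0 (zeroʳ 1ℝ) (zeroʳ 0ℝ)))
        where open Solver
      ... | no _     | yes refl | yes m≡l′ | _        = contradiction (sym m≡l′) l′≢m′
      ... | no _     | yes refl | no _     | yes l≡m  = contradiction l≡m l≢m
      ... | no l≢l′  | yes refl | no _     | no _     = ≃-trans
        (𝔼≃0 m l≢l′ λ ω → solve 3 (λ a b c → (a :* b) :* (c :* b) := (b :* b) :* (a :* c)) ≃-refl (σ l ω) (σ m ω) (σ l′ ω))
        (≃-sym (0+0≃0 (zeroˡ 1ℝ) (zeroʳ 0ℝ)))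
        where open Solver
      ... | no _     | no _     | yes refl | yes refl = ≃-trans
        (𝔼≃1 l m λ ω → solve 2 (λ a b → (a :* b) :* (b :* a) := (a :* a) :* (b :* b)) ≃-refl (σ l ω) (σ m ω))
        (≃-sym (≃-trans (+-cong (zeroˡ 0ℝ) (*-identityˡ 1ℝ)) (+-identityˡ 1ℝ)))
        where open Solver
      ... | no _     | no _     | yes refl | no l≢m′  = ≃-trans
        (𝔼≃0 m l≢m′ λ ω → solve 3 (λ a b c → (a :* b) :* (b :* c) := (b :* b) :* (a :* c)) ≃-refl (σ l ω) (σ m ω) (σ m′ ω))
        (≃-sym (0+0≃0 (zeroʳ 0ℝ) (zeroʳ 1ℝ)))
        where open Solver
      ... | no _     | no _     | no m≢l′  | yes refl = ≃-trans
        (𝔼≃0 l m≢l′ λ ω → solve 3 (λ a b c → (a :* b) :* (c :* a) := (a :* a) :* (b :* c)) ≃-refl (σ l ω) (σ m ω) (σ l′ ω))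
        (≃-sym (0+0≃0 (zeroʳ 0ℝ) (zeroˡ 1ℝ)))
        where open Solver
      ... | no l≢l′  | no m≢m′  | no m≢l′  | no l≢m′  = ≃-trans
        (≃-trans
          (𝔼-cong λ ω → ≃-trans (*-assoc (σ l ω) (σ m ω) (signs (g ω) l′ m′))
            (*-congˡ (σ l ω) (*-congˡ (σ m ω) (*-congˡ (σ l′ ω) (≃-sym (*-identityʳ (σ m′ ω)))))))
          (𝔼-∏signs 3 ℕ.≤-refl (Vec.lookup (l ∷ m ∷ l′ ∷ m′ ∷ [])) (distinct₄ l≢m l≢l′ l≢m′ m≢l′ m≢m′ l′≢m′)))
        (≃-sym (0+0≃0 (zeroʳ 0ℝ) (zeroʳ 0ℝ)))

      private
        𝔼-* : ∀ (φ : Vec (Fin s) d → ℝ) (ψ : Vec Sign d → ℝ) → 𝔼 (λ ω → φ (h ω) * ψ (g ω)) ≃ 𝔼 (φ ∘ h) * 𝔼 (ψ ∘ g)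
        𝔼-* = ⊥⇒𝔼-* (Vec-finite (Fin-finite s) d) (Vec-finite Sign-finite d) h g h⊥g

        𝔼-∑∑ : (X : Fin d → Fin d → Ω → ℝ) → 𝔼 (λ ω → sum λ l → sum λ m → X l m ω) ≃ sum λ l → sum λ m → 𝔼 (X l m)
        𝔼-∑∑ X = ≃-trans (𝔼-∑ λ l ω → sum λ m → X l m ω) (∑-cong λ l → 𝔼-∑ (X l))

      𝔼-err : 𝔼 (err ∘ y) ≃ 0ℝ
      𝔼-err = begin-equality
        𝔼 (err ∘ y)                                            ≈⟨ 𝔼-cong (λ ω → err-expand (y ω)) ⟩
        𝔼 (λ ω → sum λ l → sum λ m → term (y ω) l m)           ≈⟨ 𝔼-∑∑ (λ l m ω → term (y ω) l m) ⟩
        sum (λ l → sum λ m → 𝔼 λ ω → term (y ω) l m)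
          ≈⟨ ∑-zero (λ l → ∑-zero {f = λ m → 𝔼 λ ω → term (y ω) l m} (vanish l)) ⟩
        0ℝ                                                     ∎
        where
        vanish : ∀ l m → 𝔼 (λ ω → term (y ω) l m) ≃ 0ℝ
        vanish l m = begin-equality
          𝔼 (λ ω → offDiagonal l m * (collide (h ω) l m * signs (g ω) l m))
            ≈⟨ 𝔼-*ˡ (offDiagonal l m) (λ ω → collide (h ω) l m * signs (g ω) l m) ⟩
          offDiagonal l m * 𝔼 (λ ω → collide (h ω) l m * signs (g ω) l m)
            ≈⟨ *-congˡ (offDiagonal l m) (𝔼-* (λ η → collide η l m) (λ γ → signs γ l m)) ⟩
          offDiagonal l m * (𝔼 (λ ω → collide (h ω) l m) * 𝔼 (λ ω → signs (g ω) l m))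
            ≈⟨ offDiagonal-cong l m (λ l≢m → ≃-trans (*-congˡ _ (𝔼-signs l≢m)) (zeroʳ _)) ⟩
          offDiagonal l m * 0ℝ
            ≈⟨ zeroʳ _ ⟩
          0ℝ  ∎

      𝔼-∣err∣ : 𝔼 (λ ω → ∣ err (y ω) ∣) ≤ ‖ v ‖₁ * ‖ w ‖₁ * inv s
      𝔼-∣err∣ = begin
        𝔼 (λ ω → ∣ err (y ω) ∣)
          ≤⟨ 𝔼-mono (λ ω → ∣err∣≤ (y ω)) ⟩
        𝔼 (λ ω → sum λ l → sum λ m → ∣ offDiagonal l m ∣ * collide (h ω) l m)
          ≈⟨ 𝔼-∑∑ (λ l m ω → ∣ offDiagonal l m ∣ * collide (h ω) l m) ⟩
        sum (λ l → sum λ m → 𝔼 λ ω → ∣ offDiagonal l m ∣ * collide (h ω) l m)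
          ≈⟨ ∑-cong (λ l → ∑-cong λ m → ≃-trans (𝔼-*ˡ ∣ offDiagonal l m ∣ (λ ω → collide (h ω) l m))
               (∣offDiagonal∣-cong l m 𝔼-collide)) ⟩
        sum (λ l → sum λ m → ∣ offDiagonal l m ∣ * inv s)
          ≤⟨ ∑-mono (λ l → ∑-mono λ m → *-mono-≤ (0≤∣x∣ (offDiagonal l m)) (0≤inv s) (∣offDiagonal∣≤ l m) ≤-refl) ⟩
        sum (λ l → sum λ m → ∣ v l ∣ * ∣ w m ∣ * inv s)
          ≈⟨ ≃-trans (∑-cong λ l → ≃-sym (*-distribʳ-sum (inv s) λ m → ∣ v l ∣ * ∣ w m ∣))
               (≃-sym (*-distribʳ-sum (inv s) λ l → sum λ m → ∣ v l ∣ * ∣ w m ∣)) ⟩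
        sum (λ l → sum λ m → ∣ v l ∣ * ∣ w m ∣) * inv s
          ≈⟨ *-cong (∑*∑ (λ l → ∣ v l ∣) (λ m → ∣ w m ∣)) ≃-refl ⟨
        ‖ v ‖₁ * ‖ w ‖₁ * inv s  ∎
        where
        ∣term∣ : ∀ y l m → ∣ term y l m ∣ ≃ ∣ offDiagonal l m ∣ * collide (proj₁ y) l m
        ∣term∣ (η , γ) l m = begin-equality
          ∣ offDiagonal l m * (collide η l m * signs γ l m) ∣
            ≈⟨ ∣∣-homo-* (offDiagonal l m) (collide η l m * signs γ l m) ⟩
          ∣ offDiagonal l m ∣ * ∣ collide η l m * signs γ l m ∣
            ≈⟨ *-congˡ ∣ offDiagonal l m ∣ (begin-equality
                 ∣ collide η l m * signs γ l m ∣
                   ≈⟨ ∣∣-homo-* (collide η l m) (signs γ l m) ⟩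
                 ∣ collide η l m ∣ * ∣ signs γ l m ∣
                   ≈⟨ *-cong (∣δ∣≃δ (Vec.lookup η l) (Vec.lookup η m)) (≃-trans (∣∣-homo-* (signValue (Vec.lookup γ l)) (signValue (Vec.lookup γ m)))
                        (≃-trans (*-cong (∣sign∣≃1 (Vec.lookup γ l)) (∣sign∣≃1 (Vec.lookup γ m))) (*-identityˡ 1ℝ))) ⟩
                 collide η l m * 1ℝ
                   ≈⟨ *-identityʳ _ ⟩
                 collide η l m  ∎) ⟩
          ∣ offDiagonal l m ∣ * collide η l m  ∎
        ∣err∣≤ : ∀ y → ∣ err y ∣ ≤ sum λ l → sum λ m → ∣ offDiagonal l m ∣ * collide (proj₁ y) l m
        ∣err∣≤ y = begin
          ∣ err y ∣
            ≈⟨ ∣∣-cong (err-expand y) ⟩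
          ∣ (sum λ l → sum λ m → term y l m) ∣
            ≤⟨ ∣∑∣≤∑∣∣ (λ l → sum λ m → term y l m) ⟩
          sum (λ l → ∣ (sum λ m → term y l m) ∣)
            ≤⟨ ∑-mono (λ l → ∣∑∣≤∑∣∣ (term y l)) ⟩
          sum (λ l → sum λ m → ∣ term y l m ∣)
            ≈⟨ ∑-cong (λ l → ∑-cong λ m → ∣term∣ y l m) ⟩
          sum (λ l → sum λ m → ∣ offDiagonal l m ∣ * collide (proj₁ y) l m)  ∎

      private
        u : Fin d → Fin d → ℝ
        u = offDiagonal

        -- A joint collision probability that stays symbolic: for two arbitrary pairs it may concern
        -- four keys, while h is only 2-wise independent. The `δ` factors later leave only pairs
        -- with the same two keys, where it is 1/s.
        cc : Fin d → Fin d → Fin d → Fin d → ℝ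
        cc l m l′ m′ = 𝔼 λ ω → collide (h ω) l m * collide (h ω) l′ m′

        𝔼-term-term : ∀ l m l′ m′ → 𝔼 (λ ω → term (y ω) l m * term (y ω) l′ m′) ≃
          δ l l′ * δ m m′ * (u l m * u l′ m′ * cc l m l′ m′) + δ m l′ * δ l m′ * (u l m * u l′ m′ * cc l m l′ m′)
        𝔼-term-term l m l′ m′ = begin-equality
          𝔼 (λ ω → u l m * (collide (h ω) l m * signs (g ω) l m) * (u l′ m′ * (collide (h ω) l′ m′ * signs (g ω) l′ m′)))
            ≈⟨ 𝔼-cong (λ ω → solve 6 (λ u c s u′ c′ s′ → u :* (c :* s) :* (u′ :* (c′ :* s′)) := u :* (u′ :* ((c :* c′) :* (s :* s′))))
                 ≃-refl (u l m) (collide (h ω) l m) (signs (g ω) l m) (u l′ m′) (collide (h ω) l′ m′) (signs (g ω) l′ m′)) ⟩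
          𝔼 (λ ω → u l m * (u l′ m′ * (CC ω * SS ω)))
            ≈⟨ 𝔼-*ˡ (u l m) (λ ω → u l′ m′ * (CC ω * SS ω)) ⟩
          u l m * 𝔼 (λ ω → u l′ m′ * (CC ω * SS ω))
            ≈⟨ *-congˡ (u l m) (𝔼-*ˡ (u l′ m′) (λ ω → CC ω * SS ω)) ⟩
          u l m * (u l′ m′ * 𝔼 (λ ω → CC ω * SS ω))
            ≈⟨ *-congˡ (u l m) (*-congˡ (u l′ m′) (𝔼-* (λ η → collide η l m * collide η l′ m′) (λ γ → signs γ l m * signs γ l′ m′))) ⟩
          u l m * (u l′ m′ * (cc l m l′ m′ * 𝔼 SS))
            ≈⟨ offDiagonal-cong l m (λ l≢m → offDiagonal-cong l′ m′ (λ l′≢m′ → *-congˡ (cc l m l′ m′) (𝔼-signs-signs l≢m l′≢m′))) ⟩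
          u l m * (u l′ m′ * (cc l m l′ m′ * (δ l l′ * δ m m′ + δ m l′ * δ l m′)))
            ≈⟨ solve 5 (λ u u′ c p q → u :* (u′ :* (c :* (p :+ q))) := p :* (u :* u′ :* c) :+ q :* (u :* u′ :* c))
                 ≃-refl (u l m) (u l′ m′) (cc l m l′ m′) (δ l l′ * δ m m′) (δ m l′ * δ l m′) ⟩
          δ l l′ * δ m m′ * (u l m * u l′ m′ * cc l m l′ m′) + δ m l′ * δ l m′ * (u l m * u l′ m′ * cc l m l′ m′)  ∎
          where
          open Solver
          CC SS : Ω → ℝ
          CC ω = collide (h ω) l m * collide (h ω) l′ m′
          SS ω = signs (g ω) l m * signs (g ω) l′ m′

        cc-same : ∀ {l m} → l ≢ m → cc l m l m ≃ inv s
        cc-same {l} {m} l≢m = ≃-trans (𝔼-cong λ ω → δ-idem (Vec.lookup (h ω) l) (Vec.lookup (h ω) m)) (𝔼-collide l≢m)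

        cc-swap : ∀ {l m} → l ≢ m → cc l m m l ≃ inv s
        cc-swap {l} {m} l≢m = ≃-trans
          (𝔼-cong λ ω → *-congˡ (collide (h ω) l m) (≃-reflexive (δ-sym (Vec.lookup (h ω) m) (Vec.lookup (h ω) l))))
          (cc-same l≢m)

        -- Only (l, m) itself and its reversal (m, l) are correlated with the term at (l, m).
        row-sum : ∀ l m → sum (λ l′ → sum λ m′ → 𝔼 λ ω → term (y ω) l m * term (y ω) l′ m′) ≃
                          (u l m * u l m + u l m * u m l) * inv s
        row-sum l m = begin-equality
          sum (λ l′ → sum λ m′ → 𝔼 λ ω → term (y ω) l m * term (y ω) l′ m′)
            ≈⟨ ∑-cong (λ l′ → ≃-trans (∑-cong λ m′ → 𝔼-term-term l m l′ m′)
                 (∑-distrib-+ (λ m′ → δ l l′ * δ m m′ * K l′ m′) (λ m′ → δ m l′ * δ l m′ * K l′ m′))) ⟩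
          sum (λ l′ → sum (λ m′ → δ l l′ * δ m m′ * K l′ m′) + sum (λ m′ → δ m l′ * δ l m′ * K l′ m′))
            ≈⟨ ∑-distrib-+ (λ l′ → sum λ m′ → δ l l′ * δ m m′ * K l′ m′) (λ l′ → sum λ m′ → δ m l′ * δ l m′ * K l′ m′) ⟩
          sum (λ l′ → sum λ m′ → δ l l′ * δ m m′ * K l′ m′) + sum (λ l′ → sum λ m′ → δ m l′ * δ l m′ * K l′ m′)
            ≈⟨ +-cong (∑∑-δδ l m K) (∑∑-δδ m l K) ⟩
          u l m * u l m * cc l m l m + u l m * u m l * cc l m m l
            ≈⟨ +-cong (*-assoc (u l m) (u l m) (cc l m l m)) (*-assoc (u l m) (u m l) (cc l m m l)) ⟩
          u l m * (u l m * cc l m l m) + u l m * (u m l * cc l m m l)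
            ≈⟨ +-cong (offDiagonal-cong l m λ l≢m → *-congˡ (u l m) (cc-same l≢m))
                      (offDiagonal-cong l m λ l≢m → *-congˡ (u m l) (cc-swap l≢m)) ⟩
          u l m * (u l m * inv s) + u l m * (u m l * inv s)
            ≈⟨ solve 3 (λ a b i → a :* (a :* i) :+ a :* (b :* i) := (a :* a :+ a :* b) :* i) ≃-refl (u l m) (u m l) (inv s) ⟩
          (u l m * u l m + u l m * u m l) * inv s  ∎
          where
          open Solver
          K : Fin d → Fin d → ℝ
          K l′ m′ = u l m * u l′ m′ * cc l m l′ m′

        ∑∑ : (Fin d → Fin d → ℝ) → ℝ
        ∑∑ f = sum λ l → sum λ m → f l m

        ∑∑-+ : ∀ f g → ∑∑ (λ l m → f l m + g l m) ≃ ∑∑ f + ∑∑ g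
        ∑∑-+ f g = ≃-trans (∑-cong λ l → ∑-distrib-+ (f l) (g l)) (∑-distrib-+ (λ l → sum (f l)) (λ l → sum (g l)))

        ∑∑-*ˡ : ∀ c f → ∑∑ (λ l m → c * f l m) ≃ c * ∑∑ f
        ∑∑-*ˡ c f = ≃-trans (∑-cong λ l → ≃-sym (*-distribˡ-sum c (f l))) (≃-sym (*-distribˡ-sum c λ l → sum (f l)))

        -- Each product is at most the mean of the two squares, and exchanging the sums shows that
        -- both halves have the same total. Reversed pairs thus cost no more than equal ones, whence
        -- the factor 2 in the second moment.
        ∑∑-cross : ∑∑ (λ l m → u l m * u m l) ≤ ∑∑ (λ l m → u l m * u l m)
        ∑∑-cross = begin
          ∑∑ (λ l m → u l m * u m l)
            ≤⟨ ∑-mono (λ l → ∑-mono λ m → x*y≤½x²+½y² (u l m) (u m l)) ⟩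
          ∑∑ (λ l m → half * (u l m * u l m) + half * (u m l * u m l))
            ≈⟨ ∑∑-+ (λ l m → half * (u l m * u l m)) (λ l m → half * (u m l * u m l)) ⟩
          ∑∑ (λ l m → half * (u l m * u l m)) + ∑∑ (λ l m → half * (u m l * u m l))
            ≈⟨ +-congˡ (∑-comm λ l m → half * (u m l * u m l)) ⟩
          ∑∑ (λ l m → half * (u l m * u l m)) + ∑∑ (λ l m → half * (u l m * u l m))
            ≈⟨ +-cong (∑∑-*ˡ half (λ l m → u l m * u l m)) (∑∑-*ˡ half (λ l m → u l m * u l m)) ⟩
          half * ∑∑ (λ l m → u l m * u l m) + half * ∑∑ (λ l m → u l m * u l m)
            ≈⟨ distribʳ (∑∑ λ l m → u l m * u l m) half half ⟨
          (half + half) * ∑∑ (λ l m → u l m * u l m)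
            ≈⟨ ≃-trans (*-cong half+half ≃-refl) (*-identityˡ _) ⟩
          ∑∑ (λ l m → u l m * u l m)  ∎

        ∑∑-u² : ∑∑ (λ l m → u l m * u l m) ≤ ‖ v ‖₂ ^ 2 * ‖ w ‖₂ ^ 2
        ∑∑-u² = begin
          ∑∑ (λ l m → u l m * u l m)
            ≤⟨ ∑-mono (λ l → ∑-mono λ m → offDiagonal²≤ l m) ⟩
          ∑∑ (λ l m → v l * v l * (w m * w m))
            ≈⟨ ∑*∑ (λ l → v l * v l) (λ m → w m * w m) ⟨
          sum (λ l → v l * v l) * sum (λ m → w m * w m)
            ≤⟨ *-mono-≤ (∑-nonNeg λ l → 0≤x*x (v l)) (≤-trans (∑-nonNeg λ m → 0≤x*x (w m)) (∑²≤ w)) (∑²≤ v) (∑²≤ w) ⟩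
          ‖ v ‖₂ ^ 2 * ‖ w ‖₂ ^ 2  ∎
          where
          ∑²≤ : ∀ x → sum (λ l → x l * x l) ≤ ‖ x ‖₂ ^ 2
          ∑²≤ x = begin
            sum (λ l → x l * x l)   ≈⟨ ∑-cong (λ l → *-congˡ (x l) (*-identityʳ (x l))) ⟨
            sum (λ l → x l ^ 2)     ≤⟨ x≤√x*√x (sum λ l → x l ^ 2) ⟩
            ‖ x ‖₂ * ‖ x ‖₂         ≈⟨ *-congˡ ‖ x ‖₂ (*-identityʳ ‖ x ‖₂) ⟨
            ‖ x ‖₂ ^ 2              ∎

      𝔼-err² : 𝔼 (λ ω → err (y ω) * err (y ω)) ≤ fromℕ 2 * ‖ v ‖₂ ^ 2 * ‖ w ‖₂ ^ 2 * inv s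
      𝔼-err² = begin
        𝔼 (λ ω → err (y ω) * err (y ω))
          ≈⟨ 𝔼-cong (λ ω → ≃-trans (*-cong (err-expand (y ω)) (err-expand (y ω))) (square (term (y ω)))) ⟩
        𝔼 (λ ω → ∑∑ λ l m → ∑∑ λ l′ m′ → term (y ω) l m * term (y ω) l′ m′)
          ≈⟨ 𝔼-∑∑ (λ l m ω → ∑∑ λ l′ m′ → term (y ω) l m * term (y ω) l′ m′) ⟩
        ∑∑ (λ l m → 𝔼 λ ω → ∑∑ λ l′ m′ → term (y ω) l m * term (y ω) l′ m′)
          ≈⟨ ∑-cong (λ l → ∑-cong λ m → ≃-trans (𝔼-∑∑ (λ l′ m′ ω → term (y ω) l m * term (y ω) l′ m′)) (row-sum l m)) ⟩
        ∑∑ (λ l m → (u l m * u l m + u l m * u m l) * inv s)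
          ≈⟨ ≃-trans (∑-cong λ l → ≃-sym (*-distribʳ-sum (inv s) λ m → u l m * u l m + u l m * u m l))
               (≃-sym (*-distribʳ-sum (inv s) λ l → sum λ m → u l m * u l m + u l m * u m l)) ⟩
        ∑∑ (λ l m → u l m * u l m + u l m * u m l) * inv s
          ≈⟨ *-cong (∑∑-+ (λ l m → u l m * u l m) (λ l m → u l m * u m l)) ≃-refl ⟩
        (∑∑ (λ l m → u l m * u l m) + ∑∑ (λ l m → u l m * u m l)) * inv s
          ≤⟨ *-monoˡ-≤ (0≤inv s) (+-mono-≤ ∑∑-u² (≤-trans ∑∑-cross ∑∑-u²)) ⟩
        (‖ v ‖₂ ^ 2 * ‖ w ‖₂ ^ 2 + ‖ v ‖₂ ^ 2 * ‖ w ‖₂ ^ 2) * inv s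
          ≈⟨ *-cong (two-* (‖ v ‖₂ ^ 2) (‖ w ‖₂ ^ 2)) ≃-refl ⟩
        fromℕ 2 * ‖ v ‖₂ ^ 2 * ‖ w ‖₂ ^ 2 * inv s  ∎
        where
        square : ∀ f → (∑∑ f) * (∑∑ f) ≃ ∑∑ λ l m → ∑∑ λ l′ m′ → f l m * f l′ m′
        square f = ≃-trans (*-distribʳ-sum (∑∑ f) (λ l → sum (f l))) (∑-cong λ l →
          ≃-trans (*-distribʳ-sum (∑∑ f) (f l)) (∑-cong λ m → ≃-sym (∑∑-*ˡ (f l m) f)))
        two-* : ∀ a b → a * b + a * b ≃ fromℕ 2 * a * b
        two-* a b = ≃-trans
          (≃-trans (+-cong (≃-sym (*-identityˡ (a * b))) (≃-sym (*-identityˡ (a * b)))) (≃-sym (distribʳ (a * b) 1ℝ 1ℝ)))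
          (≃-trans (*-cong (≃-sym (fromℕ-suc 1)) ≃-refl) (≃-sym (*-assoc (fromℕ 2) a b)))

-- The numerical constants of the bounds

fromℕ-+ : ∀ m n → fromℕ (m ℕ.+ n) ≃ fromℕ m + fromℕ n
fromℕ-+ zero    n = ≃-sym (+-identityˡ (fromℕ n))
fromℕ-+ (suc m) n = begin-equality
  fromℕ (suc (m ℕ.+ n))        ≈⟨ fromℕ-suc (m ℕ.+ n) ⟩
  1ℝ + fromℕ (m ℕ.+ n)         ≈⟨ +-congˡ (fromℕ-+ m n) ⟩
  1ℝ + (fromℕ m + fromℕ n)     ≈⟨ +-assoc 1ℝ (fromℕ m) (fromℕ n) ⟨
  1ℝ + fromℕ m + fromℕ n       ≈⟨ +-cong (fromℕ-suc m) ≃-refl ⟨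
  fromℕ (suc m) + fromℕ n      ∎

fromℕ-* : ∀ m n → fromℕ (m ℕ.* n) ≃ fromℕ m * fromℕ n
fromℕ-* zero    n = ≃-sym (zeroˡ (fromℕ n))
fromℕ-* (suc m) n = begin-equality
  fromℕ (n ℕ.+ m ℕ.* n)                 ≈⟨ fromℕ-+ n (m ℕ.* n) ⟩
  fromℕ n + fromℕ (m ℕ.* n)             ≈⟨ +-cong (≃-sym (*-identityˡ (fromℕ n))) (fromℕ-* m n) ⟩
  1ℝ * fromℕ n + fromℕ m * fromℕ n      ≈⟨ distribʳ (fromℕ n) 1ℝ (fromℕ m) ⟨
  (1ℝ + fromℕ m) * fromℕ n              ≈⟨ *-cong (fromℕ-suc m) ≃-refl ⟨
  fromℕ (suc m) * fromℕ n               ∎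

fromℕ-^ : ∀ m n → fromℕ (m ℕ.^ n) ≃ fromℕ m ^ n
fromℕ-^ m zero    = ≃-refl
fromℕ-^ m (suc n) = ≃-trans (fromℕ-* m (m ℕ.^ n)) (*-congˡ (fromℕ m) (fromℕ-^ m n))

0≤fromℕ : ∀ n → 0ℝ ≤ fromℕ n
0≤fromℕ zero    = ≤-refl
0≤fromℕ (suc n) = ≤-trans (+-nonNeg 0≤1 (0≤fromℕ n)) (≃⇒≥ (fromℕ-suc n))

fromℕ-mono : ∀ {m n} → m ℕ.≤ n → fromℕ m ≤ fromℕ n
fromℕ-mono {m} {n} m≤n = begin
  fromℕ m                        ≈⟨ +-identityʳ (fromℕ m) ⟨
  fromℕ m + 0ℝ                   ≤⟨ +-mono-≤ ≤-refl (0≤fromℕ (n ℕ.∸ m)) ⟩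
  fromℕ m + fromℕ (n ℕ.∸ m)      ≈⟨ fromℕ-+ m (n ℕ.∸ m) ⟨
  fromℕ (m ℕ.+ (n ℕ.∸ m))        ≡⟨ cong fromℕ (ℕ.m+[n∸m]≡n m≤n) ⟩
  fromℕ n                        ∎

inv-unique : ∀ n .{{_ : NonZero n}} {x} → fromℕ n * x ≃ 1ℝ → inv n ≃ x
inv-unique n {x} h = begin-equality
  inv n                     ≈⟨ *-identityʳ (inv n) ⟨
  inv n * 1ℝ                ≈⟨ *-congˡ (inv n) h ⟨
  inv n * (fromℕ n * x)     ≈⟨ solve 3 (λ i n x → i :* (n :* x) := n :* i :* x) ≃-refl (inv n) (fromℕ n) x ⟩
  fromℕ n * inv n * x       ≈⟨ ≃-trans (*-cong (fromℕ*inv n) ≃-refl) (*-identityˡ x) ⟩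
  x                         ∎
  where open Solver

1^n≃1 : ∀ n → 1ℝ ^ n ≃ 1ℝ
1^n≃1 zero    = ≃-refl
1^n≃1 (suc n) = ≃-trans (*-identityˡ _) (1^n≃1 n)

inv-^ : ∀ s .{{_ : NonZero s}} n → inv (s ℕ.^ n) {{m^n≢0 s n}} ≃ inv s ^ n
inv-^ s n = inv-unique (s ℕ.^ n) {{m^n≢0 s n}} (begin-equality
  fromℕ (s ℕ.^ n) * inv s ^ n   ≈⟨ *-cong (fromℕ-^ s n) ≃-refl ⟩
  fromℕ s ^ n * inv s ^ n       ≈⟨ ^-distrib-* (fromℕ s) (inv s) n ⟨
  (fromℕ s * inv s) ^ n         ≈⟨ ^-congˡ n (fromℕ*inv s) ⟩
  1ℝ ^ n                        ≈⟨ 1^n≃1 n ⟩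
  1ℝ                            ∎)

-- The left side is binom(n, k) b^k and its recursion is Pascal's rule; bounding each of the two
-- summands with the factor 2^n gives 2^(n + 1).
e-const-≤ : ∀ n k {b} → 0ℝ ≤ b → e k (Vec.tabulate {n = n} λ _ → b) ≤ fromℕ (2 ℕ.^ n) * b ^ k
e-const-≤ n zero {b} 0≤b = ≤-trans (fromℕ-mono (ℕ.m^n>0 2 n)) (≃⇒≥ (*-identityʳ _))
e-const-≤ zero (suc k) {b} 0≤b = *-nonNeg 0≤1 (^-nonNeg (suc k) 0≤b)
e-const-≤ (suc n) (suc k) {b} 0≤b = begin
  b * e k (Vec.tabulate {n = n} λ _ → b) + e (suc k) (Vec.tabulate {n = n} λ _ → b)
    ≤⟨ +-mono-≤ (*-monoʳ-≤ 0≤b (e-const-≤ n k 0≤b)) (e-const-≤ n (suc k) 0≤b) ⟩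
  b * (fromℕ (2 ℕ.^ n) * b ^ k) + fromℕ (2 ℕ.^ n) * (b * b ^ k)
    ≈⟨ solve 3 (λ b c p → b :* (c :* p) :+ c :* (b :* p) := (c :+ c) :* (b :* p)) ≃-refl b (fromℕ (2 ℕ.^ n)) (b ^ k) ⟩
  (fromℕ (2 ℕ.^ n) + fromℕ (2 ℕ.^ n)) * (b * b ^ k)
    ≈⟨ *-cong (≃-trans (≃-reflexive (cong (λ m → fromℕ (2 ℕ.^ n ℕ.+ m)) (ℕ.+-identityʳ (2 ℕ.^ n))))
                       (fromℕ-+ (2 ℕ.^ n) (2 ℕ.^ n))) ≃-refl ⟨
  fromℕ (2 ℕ.^ suc n) * (b * b ^ k)  ∎
  where open Solver

-- The exact count binom(3, 2) = 3 in place of the cruder 2^3; it is the 3 in the bound for t = 2.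
e₂-const : ∀ b → e 2 (Vec.tabulate {n = 3} λ _ → b) ≃ fromℕ 3 * (b * b)
e₂-const b = begin-equality
  e 2 (Vec.tabulate {n = 3} λ _ → b)
    ≈⟨ solve 1 (λ b → b :* (b :* con 1 :+ (b :* con 1 :+ con 0)) :+ (b :* (b :* con 1 :+ con 0) :+ (b :* con 0 :+ con 0))
         := (con 1 :+ (con 1 :+ con 1)) :* (b :* b)) ≃-refl b ⟩
  (1ℝ + (1ℝ + 1ℝ)) * (b * b)
    ≈⟨ *-cong (≃-trans (fromℕ-suc 2) (+-congˡ (fromℕ-suc 1))) ≃-refl ⟨
  fromℕ 3 * (b * b)  ∎
  where open Solver

-- All rows together

module Sketches {d s rows : ℕ} .{{_ : NonZero s}} (v w : Vector ℝ d)
                (P : FiniteProbabilitySpace) (C : CountSketch P d s rows) where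
  open FiniteProbabilitySpace P
  open Expectation P
  open CountSketch C
  open Row v w
  open Moments P

  y : Fin rows → Ω → Hash
  y i ω = h i ω , g i ω

  Hash-finite : Finite Hash
  Hash-finite = ×-finite (Vec-finite (Fin-finite s) d) (Vec-finite Sign-finite d)

  -- Independence moves the expectation inside `e`, which is monotone on nonnegative arguments, so
  -- every row's moment may be replaced by a common bound.
  𝔼-e-≤ : ∀ k f {b} → (∀ a → 0ℝ ≤ f a) → (∀ i → 𝔼 (f ∘ y i) ≤ b) →
          𝔼 (λ ω → e k (Vec.tabulate λ i → f (y i ω))) ≤ e k (Vec.tabulate {n = rows} λ _ → b)
  𝔼-e-≤ k f 0≤f h = ≤-trans
    (≃⇒≤ (independent⇒𝔼-e Hash-finite y rows-independent k (λ _ → f)))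
    (e-mono k (λ i → 𝔼-nonNeg λ ω → 0≤f (y i ω)) h)

  rows-mean-zero : ∀ i → 𝔼 (err ∘ y i) ≃ 0ℝ
  rows-mean-zero i = 𝔼-err (h i) (g i) (h-2-wise i) (g-4-wise i) (h⊥g i)

  rows-∣err∣ : ∀ i → 𝔼 (λ ω → ∣ err (y i ω) ∣) ≤ ‖ v ‖₁ * ‖ w ‖₁ * inv s
  rows-∣err∣ i = 𝔼-∣err∣ (h i) (g i) (h-2-wise i) (g-4-wise i) (h⊥g i)

  rows-err² : ∀ i → 𝔼 (λ ω → err (y i ω) * err (y i ω)) ≤ fromℕ 2 * ‖ v ‖₂ ^ 2 * ‖ w ‖₂ ^ 2 * inv s
  rows-err² i = 𝔼-err² (h i) (g i) (h-2-wise i) (g-4-wise i) (h⊥g i)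

module _ {d s : ℕ} .{{_ : NonZero s}} (v w : Vector ℝ d) (P : FiniteProbabilitySpace) where
  open FiniteProbabilitySpace P
  open Expectation P
  open Row {s = s} v w

  private
    B₁ B₂ : ℝ
    B₁ = ‖ v ‖₁ * ‖ w ‖₁ * inv s
    B₂ = fromℕ 2 * ‖ v ‖₂ ^ 2 * ‖ w ‖₂ ^ 2 * inv s

  module _ (t : ℕ) .{{_ : NonZero t}} (C : CountSketch P d s (2 ℕ.* t ℕ.∸ 1)) where
    open Sketches v w P C

    private
      n : ℕ
      n = 2 ℕ.* t ℕ.∸ 1

      X : Ω → ℝ
      X ω = median t (λ i → estimate (y i ω))

    𝔼-∣X-μ∣^t : 𝔼 (λ ω → ∣ X ω - ⟨ v , w ⟩ ∣ ^ t) ≤ e t (Vec.tabulate {n = n} λ _ → B₁)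
    𝔼-∣X-μ∣^t = ≤-trans (𝔼-mono λ ω → median-∣∣-bound t (λ i → estimate (y i ω)) ⟨ v , w ⟩)
      (𝔼-e-≤ t (λ a → ∣ err a ∣) (λ a → 0≤∣x∣ (err a)) rows-∣err∣)

    𝔼-[X-μ]^2t : 𝔼 (λ ω → (X ω - ⟨ v , w ⟩) ^ (2 ℕ.* t)) ≤ e t (Vec.tabulate {n = n} λ _ → B₂)
    𝔼-[X-μ]^2t = ≤-trans (𝔼-mono λ ω → median-^2-bound t (λ i → estimate (y i ω)) ⟨ v , w ⟩)
      (𝔼-e-≤ t (λ a → err a ^ 2) (λ a → 0≤x^2 (err a))
        (λ i → ≤-trans (≃⇒≤ (𝔼-cong λ ω → *-congˡ (err (y i ω)) (*-identityʳ (err (y i ω))))) (rows-err² i)))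

  module _ (C : CountSketch P d s 3) where
    open CountSketch C using (rows-independent)
    open Sketches v w P C

    -- G need not be a product, so it is expanded into indicators of its two hashes; each summand is
    -- a product over the three rows with the mean-zero error as a factor. The indices i, j, k with
    -- f and `reorder` let one argument serve every choice of the distinguished row.
    𝔼-err-* : ∀ i j k (f : (Hash → ℝ) → (Hash → ℝ) → Fin 3 → Hash → ℝ) →
              (∀ p q a → f p q i a ≡ err a) → (∀ p q a → f p q j a ≡ p a) → (∀ p q a → f p q k a ≡ q a) →
              (∀ (x : Fin 3 → ℝ) → product x ≃ x i * (x j * x k)) →
              (G : Hash → Hash → ℝ) → 𝔼 (λ ω → err (y i ω) * G (y j ω) (y k ω)) ≃ 0ℝ
    𝔼-err-* i j k f fi fj fk reorder G = begin-equality
      𝔼 (λ ω → err (y i ω) * G (y j ω) (y k ω))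
        ≈⟨ 𝔼-cong (λ ω → ≃-trans (*-congˡ (err (y i ω)) (expand₂ (y j ω) (y k ω)))
             (≃-trans (*-distribˡ-sum (err (y i ω)) (λ p → ind p (y j ω) * sum λ q → ind q (y k ω) * G′ p q))
               (∑-cong λ p → ≃-trans (*-congˡ (err (y i ω)) (*-distribˡ-sum (ind p (y j ω)) (λ q → ind q (y k ω) * G′ p q)))
                 (≃-trans (*-distribˡ-sum (err (y i ω)) (λ q → ind p (y j ω) * (ind q (y k ω) * G′ p q)))
                   (∑-cong λ q → solve 4 (λ x a b g → x :* (a :* (b :* g)) := g :* (x :* (a :* b)))
                     ≃-refl (err (y i ω)) (ind p (y j ω)) (ind q (y k ω)) (G′ p q)))))) ⟩
      𝔼 (λ ω → sum λ p → sum λ q → G′ p q * (err (y i ω) * (ind p (y j ω) * ind q (y k ω))))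
        ≈⟨ 𝔼-∑ (λ p ω → sum λ q → G′ p q * (err (y i ω) * (ind p (y j ω) * ind q (y k ω)))) ⟩
      sum (λ p → 𝔼 λ ω → sum λ q → G′ p q * (err (y i ω) * (ind p (y j ω) * ind q (y k ω))))
        ≈⟨ ∑-zero (λ p → ≃-trans (𝔼-∑ (λ q ω → G′ p q * (err (y i ω) * (ind p (y j ω) * ind q (y k ω)))))
             (∑-zero {f = λ q → 𝔼 λ ω → G′ p q * (err (y i ω) * (ind p (y j ω) * ind q (y k ω)))} λ q →
               ≃-trans (𝔼-*ˡ (G′ p q) (λ ω → err (y i ω) * (ind p (y j ω) * ind q (y k ω))))
                 (≃-trans (*-congˡ (G′ p q) (vanish p q)) (zeroʳ (G′ p q))))) ⟩
      0ℝ  ∎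
      where
      open Finite Hash-finite renaming (size to N)
      open Solver
      ind : Fin N → Hash → ℝ
      ind p a = δ (encode a) p
      G′ : Fin N → Fin N → ℝ
      G′ p q = G (decode p) (decode q)
      expand₂ : ∀ a b → G a b ≃ sum λ p → ind p a * sum λ q → ind q b * G′ p q
      expand₂ a b = ≃-trans (expand (λ a → G a b) a) (∑-cong λ p → *-congˡ (ind p a) (expand (G (decode p)) b))
      vanish : ∀ p q → 𝔼 (λ ω → err (y i ω) * (ind p (y j ω) * ind q (y k ω))) ≃ 0ℝ
      vanish p q = begin-equality
        𝔼 (λ ω → err (y i ω) * (ind p (y j ω) * ind q (y k ω)))
          ≈⟨ 𝔼-cong (λ ω → *-cong (≃-reflexive (fi (ind p) (ind q) (y i ω)))
               (*-cong (≃-reflexive (fj (ind p) (ind q) (y j ω))) (≃-reflexive (fk (ind p) (ind q) (y k ω))))) ⟨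
        𝔼 (λ ω → F i (y i ω) * (F j (y j ω) * F k (y k ω)))
          ≈⟨ 𝔼-cong (λ ω → reorder λ r → F r (y r ω)) ⟨
        𝔼 (λ ω → product λ r → F r (y r ω))
          ≈⟨ independent⇒𝔼-∏ Hash-finite y rows-independent F ⟩
        product (λ r → 𝔼 (F r ∘ y r))
          ≈⟨ reorder (λ r → 𝔼 (F r ∘ y r)) ⟩
        𝔼 (F i ∘ y i) * (𝔼 (F j ∘ y j) * 𝔼 (F k ∘ y k))
          ≈⟨ *-cong (≃-trans (𝔼-cong λ ω → ≃-reflexive (fi (ind p) (ind q) (y i ω))) (rows-mean-zero i)) ≃-refl ⟩
        0ℝ * (𝔼 (F j ∘ y j) * 𝔼 (F k ∘ y k))
          ≈⟨ zeroˡ _ ⟩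
        0ℝ  ∎
        where
        F : Fin 3 → Hash → ℝ
        F = f (ind p) (ind q)

    𝔼-[X-μ]²-three : 𝔼 (λ ω → (median 2 (λ i → estimate (y i ω)) - ⟨ v , w ⟩) ^ 2) ≤ B₂
    𝔼-[X-μ]²-three = ≤-trans
      (≃⇒≤ (𝔼-cong λ ω → *-congˡ (D ω) (*-identityʳ (D ω))))
      (thrice-cancel-≤ (begin
        𝔼 D² + 𝔼 D² + 𝔼 D²
          ≈⟨ ≃-trans (𝔼-+ (λ ω → D² ω + D² ω) D²) (+-cong (𝔼-+ D² D²) ≃-refl) ⟨
        𝔼 (λ ω → D² ω + D² ω + D² ω)
          -- `median 2` of the three estimates computes to the nested minima and maxima of
          -- `median₃-bound`.
          ≤⟨ 𝔼-mono (λ ω → median₃-bound (estimate (y 0F ω)) (estimate (y 1F ω)) (estimate (y 2F ω)) ⟨ v , w ⟩) ⟩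
        𝔼 (λ ω → (a ω * a ω + b ω * b ω + c ω * c ω) + (ga ω + gb ω + gc ω))
          ≈⟨ ≃-trans (𝔼-+ (λ ω → a ω * a ω + b ω * b ω + c ω * c ω) (λ ω → ga ω + gb ω + gc ω))
               (+-cong (𝔼-+₃ (λ ω → a ω * a ω) (λ ω → b ω * b ω) (λ ω → c ω * c ω)) (𝔼-+₃ ga gb gc)) ⟩
        (𝔼 (λ ω → a ω * a ω) + 𝔼 (λ ω → b ω * b ω) + 𝔼 (λ ω → c ω * c ω)) + (𝔼 ga + 𝔼 gb + 𝔼 gc)
          ≤⟨ +-mono-≤ (+-mono-≤ (+-mono-≤ (rows-err² 0F) (rows-err² 1F)) (rows-err² 2F))
               (≃⇒≤ (≃-trans (+-cong (≃-trans (+-cong 𝔼ga 𝔼gb) (+-identityˡ 0ℝ)) 𝔼gc) (+-identityˡ 0ℝ))) ⟩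
        B₂ + B₂ + B₂ + 0ℝ
          ≈⟨ +-identityʳ _ ⟩
        B₂ + B₂ + B₂  ∎))
      where
      open Solver
      D D² a b c ga gb gc : Ω → ℝ
      D ω = median 2 (λ i → estimate (y i ω)) - ⟨ v , w ⟩
      D² ω = D ω * D ω
      a ω = err (y 0F ω)
      b ω = err (y 1F ω)
      c ω = err (y 2F ω)
      ga ω = a ω * gap (b ω) (c ω)
      gb ω = b ω * gap (a ω) (c ω)
      gc ω = c ω * gap (a ω) (b ω)
      𝔼-+₃ : (X Y Z : Ω → ℝ) → 𝔼 (λ ω → X ω + Y ω + Z ω) ≃ 𝔼 X + 𝔼 Y + 𝔼 Z
      𝔼-+₃ X Y Z = ≃-trans (𝔼-+ (λ ω → X ω + Y ω) Z) (+-cong (𝔼-+ X Y) ≃-refl)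
      G : Hash → Hash → ℝ
      G p q = gap (err p) (err q)
      reorder : ∀ p q r → p * (q * (r * 1ℝ)) ≃ p * (q * r)
      reorder p q r = *-congˡ p (*-congˡ q (*-identityʳ r))
      𝔼ga : 𝔼 ga ≃ 0ℝ
      𝔼ga = 𝔼-err-* 0F 1F 2F (λ p q → Vec.lookup (err ∷ p ∷ q ∷ [])) (λ _ _ _ → refl) (λ _ _ _ → refl) (λ _ _ _ → refl)
        (λ x → reorder (x 0F) (x 1F) (x 2F)) G
      𝔼gb : 𝔼 gb ≃ 0ℝ
      𝔼gb = 𝔼-err-* 1F 0F 2F (λ p q → Vec.lookup (p ∷ err ∷ q ∷ [])) (λ _ _ _ → refl) (λ _ _ _ → refl) (λ _ _ _ → refl)
        (λ x → ≃-trans (reorder (x 0F) (x 1F) (x 2F))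
          (solve 3 (λ p q r → p :* (q :* r) := q :* (p :* r)) ≃-refl (x 0F) (x 1F) (x 2F))) G
      𝔼gc : 𝔼 gc ≃ 0ℝ
      𝔼gc = 𝔼-err-* 2F 0F 1F (λ p q → Vec.lookup (p ∷ q ∷ err ∷ [])) (λ _ _ _ → refl) (λ _ _ _ → refl) (λ _ _ _ → refl)
        (λ x → ≃-trans (reorder (x 0F) (x 1F) (x 2F))
          (solve 3 (λ p q r → p :* (q :* r) := r :* (p :* q)) ≃-refl (x 0F) (x 1F) (x 2F))) G

-- The moment bounds in their final form

x*y*inv-^ : ∀ s .{{_ : NonZero s}} t x y → (x * y * inv s) ^ t ≃ x ^ t * y ^ t * inv (s ℕ.^ t) {{m^n≢0 s t}}
x*y*inv-^ s t x y = begin-equality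
  (x * y * inv s) ^ t                        ≈⟨ ^-distrib-* (x * y) (inv s) t ⟩
  (x * y) ^ t * inv s ^ t                    ≈⟨ *-cong (^-distrib-* x y t) (≃-sym (inv-^ s t)) ⟩
  x ^ t * y ^ t * inv (s ℕ.^ t) {{m^n≢0 s t}}  ∎

theorem4 :
    (d s t : ℕ) .{{_ : NonZero d}} .{{_ : NonZero s}} .{{_ : NonZero t}}
    (v w : Vector ℝ d)
    (P : FiniteProbabilitySpace) (C : CountSketch P d s (2 ℕ.* t ℕ.∸ 1)) →
    let open FiniteProbabilitySpace P
        open CountSketch C
        X : Ω → ℝ
        X = λ ω → median t (λ i → ⟨ sketch v ω i , sketch w ω i ⟩)
    in (t ≡ 2 →
          𝔼 (λ ω → (X ω - ⟨ v , w ⟩) ^ 2) ≤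
            (_/_ (fromℕ 3 * ‖ v ‖₁ ^ 2 * ‖ w ‖₁ ^ 2) (s ℕ.^ 2) {{m^n≢0 s 2}})
            ⊓ (fromℕ 2 * ‖ v ‖₂ ^ 2 * ‖ w ‖₂ ^ 2 / s))
       ×
       (1 ℕ.< t →
          (𝔼 (λ ω → ∣ X ω - ⟨ v , w ⟩ ∣ ^ t) ≤
            fromℕ (2 ℕ.^ (2 ℕ.* t ℕ.∸ 1)) *
              _/_ (‖ v ‖₁ ^ t * ‖ w ‖₁ ^ t) (s ℕ.^ t) {{m^n≢0 s t}})
          ×
          (𝔼 (λ ω → (X ω - ⟨ v , w ⟩) ^ (2 ℕ.* t)) ≤
            fromℕ (4 ℕ.^ (2 ℕ.* t ℕ.∸ 1)) *
              _/_ (‖ v ‖₂ ^ (2 ℕ.* t) * ‖ w ‖₂ ^ (2 ℕ.* t)) (s ℕ.^ t) {{m^n≢0 s t}}))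
theorem4 d s t v w P C = t≡2-case t C , λ _ → first , second
  where
  open FiniteProbabilitySpace P
  open Expectation P

  X : Ω → ℝ
  X ω = median t (λ i → ⟨ CountSketch.sketch C v ω i , CountSketch.sketch C w ω i ⟩)

  V₁ W₁ V₂ W₂ : ℝ
  V₁ = ‖ v ‖₁
  W₁ = ‖ w ‖₁
  V₂ = ‖ v ‖₂
  W₂ = ‖ w ‖₂

  n : ℕ
  n = 2 ℕ.* t ℕ.∸ 1

  s^t-inv : ℝ
  s^t-inv = inv (s ℕ.^ t) {{m^n≢0 s t}}

  0≤‖‖₁ : ∀ u → 0ℝ ≤ ‖ u ‖₁
  0≤‖‖₁ u = ∑-nonNeg λ l → 0≤∣x∣ (u l)

  0≤B₁ : 0ℝ ≤ V₁ * W₁ * inv s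
  0≤B₁ = *-nonNeg (*-nonNeg (0≤‖‖₁ v) (0≤‖‖₁ w)) (0≤inv s)

  0≤B₂ : 0ℝ ≤ fromℕ 2 * V₂ ^ 2 * W₂ ^ 2 * inv s
  0≤B₂ = *-nonNeg (*-nonNeg (*-nonNeg (0≤fromℕ 2) (0≤x^2 V₂)) (0≤x^2 W₂)) (0≤inv s)

  -- Abstracted over t and C afresh: the type of C depends on t, so matching the equation with
  -- `refl` has to turn t into 2 in that type as well.
  t≡2-case : ∀ t .{{_ : NonZero t}} (C : CountSketch P d s (2 ℕ.* t ℕ.∸ 1)) → t ≡ 2 →
    𝔼 (λ ω → (median t (λ i → ⟨ CountSketch.sketch C v ω i , CountSketch.sketch C w ω i ⟩) - ⟨ v , w ⟩) ^ 2) ≤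
      (fromℕ 3 * V₁ ^ 2 * W₁ ^ 2 * inv (s ℕ.^ 2) {{m^n≢0 s 2}}) ⊓ (fromℕ 2 * V₂ ^ 2 * W₂ ^ 2 * inv s)
  t≡2-case t C refl = ⊓-glb bound₁ (𝔼-[X-μ]²-three v w P C)
    where
    bound₁ : _
    bound₁ = begin
      𝔼 (λ ω → (median t (λ i → ⟨ CountSketch.sketch C v ω i , CountSketch.sketch C w ω i ⟩) - ⟨ v , w ⟩) ^ 2)
        -- For t = 2 the absolute moment of order t is the mean squared error.
        ≈⟨ 𝔼-cong (λ ω → ∣x∣^2≃x^2 _) ⟨
      𝔼 (λ ω → ∣ median t (λ i → ⟨ CountSketch.sketch C v ω i , CountSketch.sketch C w ω i ⟩) - ⟨ v , w ⟩ ∣ ^ 2)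
        ≤⟨ 𝔼-∣X-μ∣^t v w P 2 C ⟩
      e 2 (Vec.tabulate {n = 3} λ _ → V₁ * W₁ * inv s)
        ≈⟨ e₂-const (V₁ * W₁ * inv s) ⟩
      fromℕ 3 * (V₁ * W₁ * inv s * (V₁ * W₁ * inv s))
        ≈⟨ *-congˡ (fromℕ 3) (≃-trans (*-congˡ (V₁ * W₁ * inv s) (≃-sym (*-identityʳ (V₁ * W₁ * inv s)))) (x*y*inv-^ s 2 V₁ W₁)) ⟩
      fromℕ 3 * (V₁ ^ 2 * W₁ ^ 2 * inv (s ℕ.^ 2) {{m^n≢0 s 2}})
        ≈⟨ solve 4 (λ c x y i → c :* (x :* y :* i) := c :* x :* y :* i) ≃-refl (fromℕ 3) (V₁ ^ 2) (W₁ ^ 2) (inv (s ℕ.^ 2) {{m^n≢0 s 2}}) ⟩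
      fromℕ 3 * V₁ ^ 2 * W₁ ^ 2 * inv (s ℕ.^ 2) {{m^n≢0 s 2}}  ∎
      where open Solver

  first : 𝔼 (λ ω → ∣ X ω - ⟨ v , w ⟩ ∣ ^ t) ≤ fromℕ (2 ℕ.^ n) * (V₁ ^ t * W₁ ^ t * s^t-inv)
  first = begin
    𝔼 (λ ω → ∣ X ω - ⟨ v , w ⟩ ∣ ^ t)
      ≤⟨ 𝔼-∣X-μ∣^t v w P t C ⟩
    e t (Vec.tabulate {n = n} λ _ → V₁ * W₁ * inv s)
      ≤⟨ e-const-≤ n t 0≤B₁ ⟩
    fromℕ (2 ℕ.^ n) * (V₁ * W₁ * inv s) ^ t
      ≈⟨ *-congˡ (fromℕ (2 ℕ.^ n)) (x*y*inv-^ s t V₁ W₁) ⟩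
    fromℕ (2 ℕ.^ n) * (V₁ ^ t * W₁ ^ t * s^t-inv)  ∎

  second : 𝔼 (λ ω → (X ω - ⟨ v , w ⟩) ^ (2 ℕ.* t)) ≤ fromℕ (4 ℕ.^ n) * (V₂ ^ (2 ℕ.* t) * W₂ ^ (2 ℕ.* t) * s^t-inv)
  second = begin
    𝔼 (λ ω → (X ω - ⟨ v , w ⟩) ^ (2 ℕ.* t))
      ≤⟨ 𝔼-[X-μ]^2t v w P t C ⟩
    e t (Vec.tabulate {n = n} λ _ → fromℕ 2 * V₂ ^ 2 * W₂ ^ 2 * inv s)
      ≤⟨ e-const-≤ n t 0≤B₂ ⟩
    fromℕ (2 ℕ.^ n) * (fromℕ 2 * V₂ ^ 2 * W₂ ^ 2 * inv s) ^ t
      ≈⟨ *-congˡ (fromℕ (2 ℕ.^ n)) (begin-equality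
           (fromℕ 2 * V₂ ^ 2 * W₂ ^ 2 * inv s) ^ t
             ≈⟨ x*y*inv-^ s t (fromℕ 2 * V₂ ^ 2) (W₂ ^ 2) ⟩
           (fromℕ 2 * V₂ ^ 2) ^ t * (W₂ ^ 2) ^ t * s^t-inv
             ≈⟨ *-cong (*-cong (≃-trans (^-distrib-* (fromℕ 2) (V₂ ^ 2) t)
                  (*-cong (≃-sym (fromℕ-^ 2 t)) (^-assocʳ V₂ 2 t))) (^-assocʳ W₂ 2 t)) ≃-refl ⟩
           fromℕ (2 ℕ.^ t) * V₂ ^ (2 ℕ.* t) * W₂ ^ (2 ℕ.* t) * s^t-inv  ∎) ⟩
    fromℕ (2 ℕ.^ n) * (fromℕ (2 ℕ.^ t) * V₂ ^ (2 ℕ.* t) * W₂ ^ (2 ℕ.* t) * s^t-inv)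
      ≈⟨ solve 5 (λ c c′ x y i → c :* (c′ :* x :* y :* i) := c :* c′ :* (x :* y :* i)) ≃-refl
           (fromℕ (2 ℕ.^ n)) (fromℕ (2 ℕ.^ t)) (V₂ ^ (2 ℕ.* t)) (W₂ ^ (2 ℕ.* t)) s^t-inv ⟩
    fromℕ (2 ℕ.^ n) * fromℕ (2 ℕ.^ t) * (V₂ ^ (2 ℕ.* t) * W₂ ^ (2 ℕ.* t) * s^t-inv)
      ≤⟨ *-mono-≤ (*-nonNeg (0≤fromℕ (2 ℕ.^ n)) (0≤fromℕ (2 ℕ.^ t)))
           (*-nonNeg (*-nonNeg (0≤x^2t V₂) (0≤x^2t W₂)) (0≤inv (s ℕ.^ t) {{m^n≢0 s t}}))
           (≤-trans (≃⇒≥ (fromℕ-* (2 ℕ.^ n) (2 ℕ.^ t))) (fromℕ-mono (2^n*2^t≤4^n t))) ≤-refl ⟩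
    fromℕ (4 ℕ.^ n) * (V₂ ^ (2 ℕ.* t) * W₂ ^ (2 ℕ.* t) * s^t-inv)  ∎
    where
    open Solver
    0≤x^2t : ∀ x → 0ℝ ≤ x ^ (2 ℕ.* t)
    0≤x^2t x = ≤-trans (^-nonNeg t (0≤x^2 x)) (≃⇒≤ (^-assocʳ x 2 t))
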